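{- Let $G=(V,E)$ be a simple finite graph on $m$ vertices $\{v_1,\ldots,v_m\}$ and suppose that for some positive integer $d$ the graph has a unique vertex $v_k$ of degree $d$. Then the zeon combinatorial Laplacian $\Lambda=\Delta-\Psi$ of $G$ has a spectrally simple eigenvalue $\lambda$ satisfying $$\lambda = d+\sum_{I\subseteq[m]}\omega_I\,\zeta_I\prod_{j\in I\setminus\{k\}}\bigl(d-\deg(v_j)\bigr)^{ -1},$$ where $(-1)^{|I|}\omega_I$ is the number of cycles based at $v_k$ on vertices indexed by $I$.
   Context: Zeon algebra: $\mathbb{C}\mathfrak{Z}$ is the commutative unital complex algebra generated by $\zeta_{\{i\}}$, $i\in\mathbb{N}=\{1,2,\ldots\}$, and the scalar $1=\zeta_\varnothing$, with $\zeta_{\{i\}}\zeta_{\{j\}}=\zeta_{\{j\}}\zeta_{\{i\}}=\zeta_{\{i,j\}}$ for $i\neq j$ and $\zeta_{\{i\}}^2=0$. For finite $I\subset\mathbb{N}$, $\zeta_I=\prod_{i\in I}\zeta_{\{i\}}$; the $\zeta_I$ form a vector space basis, and $\zeta_I\zeta_J=\zeta_{I\cup J}$ if $I\cap J=\varnothing$, and $0$ otherwise. For $u=\sum_I u_I\zeta_I$ (finite sum, $u_I\in\mathbb{C}$), the scalar part is $\mathfrak{C}u=u_\varnothing$. For a matrix $A$ over $\mathbb{C}\mathfrak{Z}$, $\mathfrak{C}A$ is the complex matrix of scalar parts of the entries. Eigenvalues: for $A\in\mathrm{Mat}(m,\mathbb{C}\mathfrak{Z})$, $\lambda\in\mathbb{C}\mathfrak{Z}$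 is an eigenvalue if $A\xi=\lambda\xi$ for some non-null $\xi\in\mathbb{C}\mathfrak{Z}^m$ (non-null: $\mathfrak{C}(\overline{\xi}^{\intercal}\xi)\ne 0$, where the bar is complex conjugation of coefficients; equivalently some component of $\xi$ has nonzero scalar part). The characteristic polynomial is $\chi_A(t)=\det(t\mathbb{I}-A)$. An eigenvalue $\lambda$ is spectrally simple if it is a simple zero of $\chi_A$ (i.e. $\chi_A(u)=(u-\lambda)g(u)$ with $g(\lambda)\neq 0$ for a polynomial $g$ over $\mathbb{C}\mathfrak{Z}$) and $\mathfrak{C}\lambda$ is a simple zero of the complex polynomial obtained by taking scalar parts of the coefficients of $\chi_A$. Graphs: $[m]=\{1,\ldots,m\}$. The nilpotent adjacency matrix $\Psi=(\psi_{ij})$ of $G$ has $\psi_{ij}=\zeta_{\{j\}}$ if $\{v_i,v_j\}\in E$ and $\psi_{ij}=0$ otherwise. $\Delta=\mathrm{diag}(\deg v_1,\ldots,\deg v_m)$. The zeon combinatorial Laplacian is $\Lambda=\Delta-\Psi$. Cycles: a $k$-cycle based at $v$ is a sequence of vertices $(w_0,w_1,\ldots,w_k)$ with $w_0=w_k=v$, consecutive vertices adjacent, and $w_0,\ldots,w_{k-1}$ distinct. Cycles are counted as sequences, so 2-cycles $(v,w,v)$ along an edge are counted and the two orientations of a longer cycle are counted separately. The cycle is on vertices indexed by $I$ if $\{w_0,\ldots,w_{k-1}\}=\{v_i:i\in I\}$. -}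

module Defs where

open import Level using (0ℓ)
open import Algebra.Bundles using (RawRing)
import Algebra.Definitions.RawMonoid as RawMonoidOps
import Algebra.Definitions.RawSemiring as RawSemiringOps
open import Data.Bool.Base using (if_then_else_)
open import Data.Nat.Base as ℕ using (ℕ; zero; suc)
import Data.Nat.Properties as ℕ
open import Data.Integer.Base as ℤ using (ℤ; +_; -[1+_]; +[1+_])
open import Data.Rational.Base as ℚ using (ℚ; 0ℚ; 1ℚ; ½)
import Data.Rational.Properties as ℚ
open import Data.Rational.Solver using (module +-*-Solver)
open import Data.Fin.Base using (Fin; zero; suc; toℕ)
import Data.Fin.Properties as Fin
open import Data.Fin.Subset using (Subset; inside; outside) renaming (_∈_ to _∈ˢ_)
open import Data.Fin.Subset.Properties using (_∈?_)
open import Data.Vec.Base using ([]; _∷_)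
open import Data.Vec.Functional using (Vector; removeAt)
open import Data.List.Base as List
  using (List; []; _∷_; _++_; [_]; length; map; filter; foldr; concatMap; allFin)
open import Data.List.Membership.Propositional using (_∈_)
open import Data.List.Relation.Unary.Linked using (Linked)
open import Data.List.Relation.Unary.Unique.Propositional using (Unique)
open import Data.List.Relation.Binary.Subset.DecPropositional ℕ._≟_ using (_⊆_; _⊆?_)
open import Data.List.Relation.Binary.Disjoint.DecPropositional ℕ._≟_ using (disjoint?)
open import Data.Product.Base using (∃; ∃-syntax; _×_; _,_; proj₁; proj₂)
open import Function.Bundles using (_⇔_)
open import Relation.Binary.Definitions using (Decidable; Symmetric; Irreflexive)
open import Relation.Binary.PropositionalEquality using (_≡_; refl; cong; subst; sym; trans)
open import Relation.Nullary using (¬_; Dec; does)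
open import Relation.Nullary.Decidable using (_×-dec_)

-- Real numbers: Cauchy sequences of rationals with pointwise operations.
-- Two sequences denote the same real when their difference tends to 0.

Cauchy : (ℕ → ℚ) → Set
Cauchy s = ∀ ε → 0ℚ ℚ.< ε →
  ∃[ N ] (∀ m n → N ℕ.≤ m → N ℕ.≤ n → ℚ.∣ s m ℚ.- s n ∣ ℚ.< ε)

record ℝ : Set where
  constructor mkℝ
  field
    seq    : ℕ → ℚ
    cauchy : Cauchy seq
open ℝ public

infix 4 _≈ᴿ_
_≈ᴿ_ : ℝ → ℝ → Set
x ≈ᴿ y = ∀ ε → 0ℚ ℚ.< ε → ∃[ N ] (∀ n → N ℕ.≤ n → ℚ.∣ seq x n ℚ.- seq y n ∣ ℚ.< ε)

abstract
  half-pos : ∀ {ε} → 0ℚ ℚ.< ε → 0ℚ ℚ.< ε ℚ.* ½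
  half-pos {ε} 0<ε = ℚ.positive⁻¹ (ε ℚ.* ½) ⦃ ℚ.pos*pos⇒pos ε ⦃ ℚ.positive 0<ε ⦄ ½ ⦄

  half+half : ∀ ε → ε ℚ.* ½ ℚ.+ ε ℚ.* ½ ≡ ε
  half+half ε = trans (sym (ℚ.*-distribˡ-+ ε ½ ½)) (ℚ.*-identityʳ ε)

  bound : ∀ {s} → Cauchy s → ∃[ B ] (0ℚ ℚ.< B × ∃[ N ] (∀ n → N ℕ.≤ n → ℚ.∣ s n ∣ ℚ.< B))
  bound {s} c with c 1ℚ (ℚ.positive⁻¹ 1ℚ)
  ... | N , close = 1ℚ ℚ.+ ℚ.∣ s N ∣ , 0<B , N , below
    where
    0<B : 0ℚ ℚ.< 1ℚ ℚ.+ ℚ.∣ s N ∣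
    0<B = ℚ.+-mono-<-≤ (ℚ.positive⁻¹ 1ℚ) (ℚ.0≤∣p∣ (s N))
    split : ∀ a b → a ≡ (a ℚ.- b) ℚ.+ b
    split = solve 2 (λ a b → a := (a :- b) :+ b) refl
      where open +-*-Solver
    below : ∀ n → N ℕ.≤ n → ℚ.∣ s n ∣ ℚ.< 1ℚ ℚ.+ ℚ.∣ s N ∣
    below n N≤n = begin-strict
      ℚ.∣ s n ∣                          ≡⟨ cong ℚ.∣_∣ (split (s n) (s N)) ⟩
      ℚ.∣ (s n ℚ.- s N) ℚ.+ s N ∣        ≤⟨ ℚ.∣p+q∣≤∣p∣+∣q∣ (s n ℚ.- s N) (s N) ⟩
      ℚ.∣ s n ℚ.- s N ∣ ℚ.+ ℚ.∣ s N ∣    <⟨ ℚ.+-monoˡ-< ℚ.∣ s N ∣ (close n N N≤n ℕ.≤-refl) ⟩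
      1ℚ ℚ.+ ℚ.∣ s N ∣                   ∎
      where open ℚ.≤-Reasoning

  +-cauchy : ∀ {s t} → Cauchy s → Cauchy t → Cauchy (λ n → s n ℚ.+ t n)
  +-cauchy {s} {t} cs ct ε 0<ε
    with cs (ε ℚ.* ½) (half-pos 0<ε) | ct (ε ℚ.* ½) (half-pos 0<ε)
  ... | M , ps | N , pt = M ℕ.⊔ N , λ m n ≤m ≤n → begin-strict
    ℚ.∣ (s m ℚ.+ t m) ℚ.- (s n ℚ.+ t n) ∣
      ≡⟨ cong ℚ.∣_∣ (regroup (s m) (t m) (s n) (t n)) ⟩
    ℚ.∣ (s m ℚ.- s n) ℚ.+ (t m ℚ.- t n) ∣
      ≤⟨ ℚ.∣p+q∣≤∣p∣+∣q∣ (s m ℚ.- s n) (t m ℚ.- t n) ⟩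
    ℚ.∣ s m ℚ.- s n ∣ ℚ.+ ℚ.∣ t m ℚ.- t n ∣
      <⟨ ℚ.+-mono-< (ps m n (ℕ.m⊔n≤o⇒m≤o M N ≤m) (ℕ.m⊔n≤o⇒m≤o M N ≤n))
                    (pt m n (ℕ.m⊔n≤o⇒n≤o M N ≤m) (ℕ.m⊔n≤o⇒n≤o M N ≤n)) ⟩
    ε ℚ.* ½ ℚ.+ ε ℚ.* ½
      ≡⟨ half+half ε ⟩
    ε ∎
    where
    open ℚ.≤-Reasoning
    regroup : ∀ a b c d → (a ℚ.+ b) ℚ.- (c ℚ.+ d) ≡ (a ℚ.- c) ℚ.+ (b ℚ.- d)
    regroup = solve 4 (λ a b c d → (a :+ b) :- (c :+ d) := (a :- c) :+ (b :- d)) refl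
      where open +-*-Solver

  neg-cauchy : ∀ {s} → Cauchy s → Cauchy (λ n → ℚ.- s n)
  neg-cauchy {s} c ε 0<ε with c ε 0<ε
  ... | N , p = N , λ m n ≤m ≤n →
    subst (ℚ._< ε) (cong ℚ.∣_∣ (flip (s n) (s m))) (p n m ≤n ≤m)
    where
    flip : ∀ a b → a ℚ.- b ≡ (ℚ.- b) ℚ.- (ℚ.- a)
    flip = solve 2 (λ a b → a :- b := (:- b) :- (:- a)) refl
      where open +-*-Solver

  scaled : ∀ {B ε} (0<B : 0ℚ ℚ.< B) (0<ε : 0ℚ ℚ.< ε) →
    ∃[ δ ] (0ℚ ℚ.< δ × (∀ x y → ℚ.∣ x ∣ ℚ.< B → ℚ.∣ y ∣ ℚ.< δ → ℚ.∣ x ℚ.* y ∣ ℚ.< ε))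
  scaled {B} {ε} 0<B 0<ε = δ , ℚ.positive⁻¹ δ , λ x y x<B y<δ → begin-strict
    ℚ.∣ x ℚ.* y ∣          ≡⟨ ℚ.∣p*q∣≡∣p∣*∣q∣ x y ⟩
    ℚ.∣ x ∣ ℚ.* ℚ.∣ y ∣    ≤⟨ ℚ.*-monoʳ-≤-nonNeg ℚ.∣ y ∣ ⦃ ℚ.nonNegative (ℚ.0≤∣p∣ y) ⦄ (ℚ.<⇒≤ x<B) ⟩
    B ℚ.* ℚ.∣ y ∣          <⟨ ℚ.*-monoʳ-<-pos B y<δ ⟩
    B ℚ.* δ                ≡⟨ ℚ.*-assoc B (ℚ.1/ B) ε ⟨
    B ℚ.* (ℚ.1/ B) ℚ.* ε   ≡⟨ cong (ℚ._* ε) (ℚ.*-inverseʳ B) ⟩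
    1ℚ ℚ.* ε               ≡⟨ ℚ.*-identityˡ ε ⟩
    ε                      ∎
    where
    open ℚ.≤-Reasoning
    instance
      B>0 : ℚ.Positive B
      B>0 = ℚ.positive 0<B
      B≢0 : ℚ.NonZero B
      B≢0 = ℚ.pos⇒nonZero B
      1/B>0 : ℚ.Positive (ℚ.1/ B)
      1/B>0 = ℚ.1/pos⇒pos B
    δ : ℚ
    δ = (ℚ.1/ B) ℚ.* ε
    instance
      δ>0 : ℚ.Positive δ
      δ>0 = ℚ.pos*pos⇒pos (ℚ.1/ B) ε ⦃ ℚ.positive 0<ε ⦄

  *-cauchy : ∀ {s t} → Cauchy s → Cauchy t → Cauchy (λ n → s n ℚ.* t n)
  *-cauchy {s} {t} cs ct ε 0<ε =
    let B , 0<B , K , s<B    = bound cs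
        C , 0<C , L , t<C    = bound ct
        δ , 0<δ , small-st   = scaled 0<B (half-pos 0<ε)
        η , 0<η , small-ts   = scaled 0<C (half-pos 0<ε)
        M , pt               = ct δ 0<δ
        N , ps               = cs η 0<η
        R                    = (K ℕ.⊔ L) ℕ.⊔ (M ℕ.⊔ N)
        toK : ∀ {n} → R ℕ.≤ n → K ℕ.≤ n
        toK p = ℕ.m⊔n≤o⇒m≤o K L (ℕ.m⊔n≤o⇒m≤o (K ℕ.⊔ L) (M ℕ.⊔ N) p)
        toL : ∀ {n} → R ℕ.≤ n → L ℕ.≤ n
        toL p = ℕ.m⊔n≤o⇒n≤o K L (ℕ.m⊔n≤o⇒m≤o (K ℕ.⊔ L) (M ℕ.⊔ N) p)
        toM : ∀ {n} → R ℕ.≤ n → M ℕ.≤ n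
        toM p = ℕ.m⊔n≤o⇒m≤o M N (ℕ.m⊔n≤o⇒n≤o (K ℕ.⊔ L) (M ℕ.⊔ N) p)
        toN : ∀ {n} → R ℕ.≤ n → N ℕ.≤ n
        toN p = ℕ.m⊔n≤o⇒n≤o M N (ℕ.m⊔n≤o⇒n≤o (K ℕ.⊔ L) (M ℕ.⊔ N) p)
    in R , λ m n ≤m ≤n →
      combine (s m) (t m) (s n) (t n)
        (small-st (s m) (t m ℚ.- t n)
          (s<B m (toK ≤m)) (pt m n (toM ≤m) (toM ≤n)))
        (small-ts (t n) (s m ℚ.- s n)
          (t<C n (toL ≤n)) (ps m n (toN ≤m) (toN ≤n)))
    where
    regroup : ∀ a b c d →
      a ℚ.* b ℚ.- c ℚ.* d ≡ a ℚ.* (b ℚ.- d) ℚ.+ d ℚ.* (a ℚ.- c)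
    regroup = solve 4 (λ a b c d → a :* b :- c :* d := a :* (b :- d) :+ d :* (a :- c)) refl
      where open +-*-Solver
    combine : ∀ a b c d → ℚ.∣ a ℚ.* (b ℚ.- d) ∣ ℚ.< ε ℚ.* ½ → ℚ.∣ d ℚ.* (a ℚ.- c) ∣ ℚ.< ε ℚ.* ½ →
      ℚ.∣ a ℚ.* b ℚ.- c ℚ.* d ∣ ℚ.< ε
    combine a b c d p q = begin-strict
      ℚ.∣ a ℚ.* b ℚ.- c ℚ.* d ∣                          ≡⟨ cong ℚ.∣_∣ (regroup a b c d) ⟩
      ℚ.∣ a ℚ.* (b ℚ.- d) ℚ.+ d ℚ.* (a ℚ.- c) ∣          ≤⟨ ℚ.∣p+q∣≤∣p∣+∣q∣ (a ℚ.* (b ℚ.- d)) (d ℚ.* (a ℚ.- c)) ⟩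
      ℚ.∣ a ℚ.* (b ℚ.- d) ∣ ℚ.+ ℚ.∣ d ℚ.* (a ℚ.- c) ∣    <⟨ ℚ.+-mono-< p q ⟩
      ε ℚ.* ½ ℚ.+ ε ℚ.* ½                                ≡⟨ half+half ε ⟩
      ε                                                  ∎
      where open ℚ.≤-Reasoning

  const-cauchy : ∀ q → Cauchy (λ _ → q)
  const-cauchy q ε 0<ε = 0 , λ _ _ _ _ →
    subst (ℚ._< ε) (sym (cong ℚ.∣_∣ (ℚ.+-inverseʳ q))) 0<ε

fromℚᴿ : ℚ → ℝ
fromℚᴿ q = mkℝ (λ _ → q) (const-cauchy q)

infixl 6 _+ᴿ_
infixl 7 _*ᴿ_
infix  8 -ᴿ_

_+ᴿ_ _*ᴿ_ : ℝ → ℝ → ℝ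
x +ᴿ y = mkℝ (λ n → seq x n ℚ.+ seq y n) (+-cauchy {seq x} {seq y} (cauchy x) (cauchy y))
x *ᴿ y = mkℝ (λ n → seq x n ℚ.* seq y n) (*-cauchy {seq x} {seq y} (cauchy x) (cauchy y))

-ᴿ_ : ℝ → ℝ
-ᴿ x = mkℝ (λ n → ℚ.- seq x n) (neg-cauchy {seq x} (cauchy x))

record ℂ : Set where
  constructor _+i_
  field
    re im : ℝ
open ℂ public

fromℚ : ℚ → ℂ
fromℚ q = fromℚᴿ q +i fromℚᴿ 0ℚ

fromℕ : ℕ → ℂ
fromℕ n = fromℚ (+ n ℚ./ 1)

conjugate : ℂ → ℂ
conjugate z = re z +i (-ᴿ im z)

ℂ-rawRing : RawRing 0ℓ 0ℓ
ℂ-rawRing = record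
  { Carrier = ℂ
  ; _≈_     = λ z w → re z ≈ᴿ re w × im z ≈ᴿ im w
  ; _+_     = λ z w → (re z +ᴿ re w) +i (im z +ᴿ im w)
  ; _*_     = λ z w → (re z *ᴿ re w +ᴿ (-ᴿ (im z *ᴿ im w)))
                   +i (re z *ᴿ im w +ᴿ im z *ᴿ re w)
  ; -_      = λ z → (-ᴿ re z) +i (-ᴿ im z)
  ; 0#      = fromℚ 0ℚ
  ; 1#      = fromℚ 1ℚ
  }

module Matrices (R : RawRing 0ℓ 0ℓ) where
  open RawRing R
  open RawMonoidOps +-rawMonoid using (sum)
  open RawSemiringOps rawSemiring using (_^_)

  Matrix : ℕ → Set
  Matrix m = Fin m → Fin m → Carrier

  diag : ∀ {m} → Vector Carrier m → Matrix m
  diag x i j = if does (i Fin.≟ j) then x i else 0#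

  infixl 6 _⊖_
  _⊖_ : ∀ {m} → Matrix m → Matrix m → Matrix m
  (A ⊖ B) i j = A i j + - B i j

  infixr 7 _·_
  _·_ : ∀ {m} → Matrix m → Vector Carrier m → Vector Carrier m
  (A · x) i = sum λ j → A i j * x j

  -- Cofactor expansion along the first row; removeAt drops column j.
  det : ∀ {m} → Matrix m → Carrier
  det {zero}  A = 1#
  det {suc m} A = sum λ j → (- 1#) ^ toℕ j * (A zero j * det λ i → removeAt (A (suc i)) j)

-- Polynomials in one variable, as coefficient lists a₀ ∷ a₁ ∷ … up to
-- trailing zeros.

module Polynomials (R : RawRing 0ℓ 0ℓ) where
  open RawRing R

  Poly : Set
  Poly = List Carrier

  coeff : Poly → ℕ → Carrier
  coeff []      _       = 0#
  coeff (a ∷ p) zero    = a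
  coeff (a ∷ p) (suc n) = coeff p n

  _+ᴾ_ : Poly → Poly → Poly
  []      +ᴾ q       = q
  (a ∷ p) +ᴾ []      = a ∷ p
  (a ∷ p) +ᴾ (b ∷ q) = (a + b) ∷ (p +ᴾ q)

  _*ᴾ_ : Poly → Poly → Poly
  []      *ᴾ q = []
  (a ∷ p) *ᴾ q = map (a *_) q +ᴾ (0# ∷ (p *ᴾ q))

  rawRing : RawRing 0ℓ 0ℓ
  rawRing = record
    { Carrier = Poly
    ; _≈_     = λ p q → ∀ n → coeff p n ≈ coeff q n
    ; _+_     = _+ᴾ_
    ; _*_     = _*ᴾ_
    ; -_      = map (-_)
    ; 0#      = []
    ; 1#      = [ 1# ]
    }

  constant : Carrier → Poly
  constant a = [ a ]

  X : Poly
  X = 0# ∷ 1# ∷ []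

  eval : Poly → Carrier → Carrier
  eval p x = foldr (λ a r → a + x * r) 0# p

  IsSimpleZero : Poly → Carrier → Set
  IsSimpleZero p c = ∃[ g ] ((p ≈ᴾ (X +ᴾ map (-_) (constant c)) *ᴾ g) × ¬ (eval g c ≈ 0#))
    where open RawRing rawRing using () renaming (_≈_ to _≈ᴾ_)

module _ (R : RawRing 0ℓ 0ℓ) where
  open Polynomials R using (Poly; X; constant)
  open Matrices R using (Matrix)
  open Matrices (Polynomials.rawRing R) using (diag; _⊖_; det)

  charPoly : ∀ {m} → Matrix m → Poly
  charPoly A = det (diag (λ _ → X) ⊖ λ i j → constant (A i j))

-- The zeon algebra over R.  The generators are numbered from 0, so that
-- the number i stands for ζ_{i+1}.  A finite set of generators is a list
-- of numbers in which order and repetition are ignored, and an element of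
-- the algebra is a formal finite sum of terms c ζ_I.  The same I may occur
-- in several terms: elements are compared through the coefficients u_I.

FinSet : Set
FinSet = List ℕ

_≐?_ : (I J : FinSet) → Dec (I ⊆ J × J ⊆ I)
I ≐? J = (I ⊆? J) ×-dec (J ⊆? I)

module Zeons (R : RawRing 0ℓ 0ℓ) where
  open RawRing R

  Zeon : Set
  Zeon = List (Carrier × FinSet)

  coefficient : Zeon → FinSet → Carrier
  coefficient u I = foldr _+_ 0# (map proj₁ (filter (λ (_ , J) → J ≐? I) u))

  scalarPart : Zeon → Carrier
  scalarPart u = coefficient u []

  mulTerm : Carrier × FinSet → Carrier × FinSet → Zeon
  mulTerm (a , I) (b , J) = if does (disjoint? I J) then [ (a * b , I ++ J) ] else []

  mapCoefficients : (Carrier → Carrier) → Zeon → Zeon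
  mapCoefficients f = map λ (a , I) → (f a , I)

  term : Carrier → FinSet → Zeon
  term a I = [ (a , I) ]

  scalar : Carrier → Zeon
  scalar a = term a []

  ζ : FinSet → Zeon
  ζ = term 1#

  rawRing : RawRing 0ℓ 0ℓ
  rawRing = record
    { Carrier = Zeon
    ; _≈_     = λ u v → ∀ I → coefficient u I ≈ coefficient v I
    ; _+_     = _++_
    ; _*_     = λ u v → concatMap (λ s → concatMap (mulTerm s) v) u
    ; -_      = mapCoefficients (-_)
    ; 0#      = []
    ; 1#      = scalar 1#
    }

open Zeons ℂ-rawRing public using (Zeon; scalarPart; mapCoefficients; scalar; ζ)

ℂℨ : RawRing 0ℓ 0ℓ
ℂℨ = Zeons.rawRing ℂ-rawRing

open Matrices ℂℨ public using (Matrix; diag; _⊖_; _·_)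

module _ where
  open RawRing ℂℨ
  open RawMonoidOps +-rawMonoid using (sum)

  NonNull : ∀ {m} → Vector Zeon m → Set
  NonNull ξ = ¬ (scalarPart (sum λ i → mapCoefficients conjugate (ξ i) * ξ i) ≈ᶜ 0ᶜ)
    where open RawRing ℂ-rawRing using () renaming (_≈_ to _≈ᶜ_; 0# to 0ᶜ)

  IsEigenvalue : ∀ {m} → Matrix m → Zeon → Set
  IsEigenvalue A λ′ = ∃[ ξ ] (NonNull ξ × (∀ i → (A · ξ) i ≈ λ′ * ξ i))

record IsSpectrallySimpleEigenvalue {m} (A : Matrix m) (λ′ : Zeon) : Set where
  field
    isEigenvalue     : IsEigenvalue A λ′
    simpleZero       : Polynomials.IsSimpleZero ℂℨ (charPoly ℂℨ A) λ′
    scalarSimpleZero : Polynomials.IsSimpleZero ℂ-rawRing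
                         (map scalarPart (charPoly ℂℨ A)) (scalarPart λ′)

record SimpleGraph (m : ℕ) : Set₁ where
  field
    Adj    : Fin m → Fin m → Set
    adj?   : Decidable Adj
    symm   : Symmetric Adj
    irrefl : Irreflexive _≡_ Adj

module _ {m} (G : SimpleGraph m) where
  open SimpleGraph G

  deg : Fin m → ℕ
  deg i = length (filter (adj? i) (allFin m))

  Ψ Δ Λ : Matrix m
  Ψ i j = if does (adj? i j) then ζ [ toℕ j ] else []
  Δ     = diag (λ i → scalar (fromℕ (deg i)))
  Λ     = Δ ⊖ Ψ

  -- The sequence c = (w₀ , w₁ , … , wₗ), l ≥ 1, is a cycle based at v on
  -- the vertices indexed by I; here inner = (w₁ , … , wₗ₋₁).
  record IsCycleOn (v : Fin m) (I : Subset m) (c : List (Fin m)) : Set where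
    field
      inner    : List (Fin m)
      closed   : c ≡ v ∷ inner ++ [ v ]
      adjacent : Linked Adj c
      distinct : Unique (v ∷ inner)
      support  : ∀ i → i ∈ (v ∷ inner) ⇔ i ∈ˢ I

NumberOf : {A : Set} → (A → Set) → ℕ → Set
NumberOf P n = ∃[ xs ] (Unique xs × (∀ x → x ∈ xs ⇔ P x) × length xs ≡ n)

subsets : ∀ m → List (Subset m)
subsets zero    = [ [] ]
subsets (suc m) = map (outside ∷_) (subsets m) ++ map (inside ∷_) (subsets m)

elements : ∀ {m} → Subset m → List (Fin m)
elements {m} I = filter (_∈? I) (allFin m)

ζ[_] : ∀ {m} → Subset m → Zeon
ζ[ I ] = ζ (map toℕ (elements I))

module _ where
  open RawRing ℂℨ

  ∑⊆ : ∀ m → (Subset m → Zeon) → Zeon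
  ∑⊆ m f = foldr _+_ 0# (map f (subsets m))

module _ where
  open RawRing ℂ-rawRing

  ∏∈ : ∀ {m} → Subset m → (Fin m → ℂ) → ℂ
  ∏∈ I f = foldr _*_ 1# (map f (elements I))

-- The value at 0 is immaterial: d - deg vⱼ ≠ 0 for j ≠ k when vₖ is the only
-- vertex of degree d.
reciprocal : ℤ → ℂ
reciprocal (+ zero)  = fromℚ 0ℚ
reciprocal +[1+ n ]  = fromℚ (ℤ.1ℤ ℚ./ suc n)
reciprocal -[1+ n ]  = fromℚ (ℤ.-1ℤ ℚ./ suc n)

{-# OPTIONS --safe #-}
-- Put a_j = -1/(d - deg v_j) for j ≠ k and a_k = 0, and let X_i be the sum over all walks from v_i to v_k
-- of the product of the ψ along the edges and of the a_j at the interior vertices.  Since no ζ_{j} can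
-- be used twice the sum is finite, X_i = Σ_j ψ_ij (δ_jk + a_j X_j), and X_k X_i = 0 because every X_i
-- is divisible by ζ_{k}.  Hence ξ_i = δ_ik + a_i X_i satisfies Λ ξ = (d - X_k) ξ.  The walks that survive
-- in X_k are the cycles based at v_k, which gives the formula.  As ξ_k = 1, the columns of
-- λ - Λ are dependent, so χ(λ) = 0; the derivative of χ at λ has scalar part ∏_{j≠k} (d - deg v_j) ≠ 0,
-- so both zeros are simple.

module Submission where

open import Level using (0ℓ)
open import Algebra.Bundles using (RawRing; CommutativeRing)
open import Data.Nat.Base as ℕ using (ℕ; zero; suc)
open import Data.Fin.Base using (Fin; zero; suc; toℕ; fromℕ<)
open import Data.Vec.Functional using (Vector; removeAt)
open import Data.List.Base
  using (List; []; _∷_; _++_; [_]; tabulate; map; length; filter; concatMap; foldr; allFin;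
         cartesianProductWith; lookup)
open import Data.List.Properties
  using (++-assoc; ++-identityʳ; map-id; map-∘; length-map; length-++; ++-cancelʳ; ∷-injective;
         ∷-injectiveʳ)
open import Data.List.Membership.Propositional using (_∈_)
open import Data.List.Membership.Propositional.Properties
  using (∈-tabulate⁺; ∈-∃++; ∈-++⁻; ∈-++⁺ˡ; ∈-++⁺ʳ; ∈-lookup; ∈-filter⁺; ∈-filter⁻; ∈-allFin;
         ∈-map⁺; ∈-map⁻; ∈-cartesianProductWith⁺; ∈-cartesianProductWith⁻)
open import Data.List.Relation.Unary.Any using (here; there)
open import Data.Product.Base using (∃-syntax; _×_; _,_; proj₂; swap)
open import Data.Sum.Base using (_⊎_; inj₁; inj₂; map₁; [_,_]′)
open import Function.Base using (_∘_; id)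
open import Relation.Binary.PropositionalEquality as ≡ using (_≡_; _≢_)
open import Relation.Nullary using (contradiction; does; yes; no; ¬_; Dec)
import Algebra.Definitions.RawSemiring
import Algebra.Properties.Ring
import Algebra.Properties.Semiring.Sum
import Algebra.Properties.CommutativeMonoid.Sum
import Algebra.Solver.Ring.NaturalCoefficients.Default
import Relation.Binary.Reasoning.Setoid
open import Defs
  using (module Matrices; module Polynomials; charPoly; FinSet; _≐?_; module Zeons; SimpleGraph;
         IsCycleOn; NumberOf; subsets; elements)
import Data.Fin.Properties as Fin
open import Data.Bool.Base using (true; false; if_then_else_)
open import Relation.Nullary.Decidable using (dec-false; dec-true; _×-dec_)
import Data.Nat.Properties as ℕ
open import Data.List.Relation.Binary.Subset.DecPropositional ℕ._≟_ using (_⊆_)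
open import Data.List.Relation.Binary.Subset.Propositional.Properties using (⊆-refl; ⊆-trans; ++⁺)
open import Data.List.Relation.Binary.Disjoint.Propositional using (Disjoint)
open import Data.List.Relation.Binary.Disjoint.DecPropositional ℕ._≟_ using (disjoint?)
open import Data.List.Relation.Unary.All as All using ([]; _∷_; All)
open import Data.List.Relation.Unary.AllPairs using ([]; _∷_)
open import Data.List.Relation.Unary.Unique.Propositional using (Unique)
open import Relation.Unary using (Pred; Decidable)
import Data.Bool.Properties as Bool
open import Data.Fin.Subset using (Subset; ∣_∣; inside; outside) renaming (_∈_ to _∈ˢ_; _-_ to _∖_)
open import Data.Fin.Subset.Properties using (_∈?_; ⊆-antisym; x∈p∧x≢y⇒x∈p-y; p─q⊆p)
open import Data.List.Membership.Propositional.Properties.WithK using (unique∧set⇒bag)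
open import Data.List.Relation.Binary.BagAndSetEquality using (∼bag⇒↭)
open import Data.List.Relation.Binary.Permutation.Propositional as Perm using (_↭_; ↭-sym; ↭-trans)
open import Data.List.Relation.Binary.Permutation.Propositional.Properties
  using (↭-length; ∷↭∷ʳ; ∈-resp-↭)
open import Data.List.Relation.Unary.Linked using (Linked; linked?; [-]; _∷_)
import Data.List.Relation.Unary.Unique.Propositional.Properties as Unique
open import Data.List.Relation.Unary.Unique.DecPropositional using (unique?)
import Data.List.Membership.DecPropositional as DecMembership
import Data.Vec.Base as Vec
import Data.Vec.Properties as Vec
open import Function.Bundles using (_⇔_; mk⇔; module Equivalence)
open import Function.Properties.Equivalence using () renaming (sym to ⇔-sym; trans to ⇔-trans)
import Data.List.Relation.Unary.All.Properties as All

-- Determinants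

-- The zeon algebra has zero divisors, so dependent columns alone do not force a determinant to
-- vanish. The entry 1 in ξ is what helps: replacing column k of λ - Λ by (λ - Λ) ξ leaves the
-- determinant unchanged and produces a zero column. The derivative of χ needs no product rule for
-- determinants. The zeon algebra contains its own dual numbers: with ε = ζ_{1} and ε² = 0, the
-- scalar-part polynomial is evaluated at d + ε, where the matrix has become diagonal with k-th
-- entry ε, and the coefficient of ζ_{1} is the derivative at d. Equality of Cauchy reals is not
-- decidable, so "nonzero" is carried as an explicit inverse and becomes an inequality only at the
-- end. All the algebra is done over an arbitrary commutative ring; the complex numbers enter only
-- through the reciprocals and conjugation. The sign of ω_I comes from the |I| - 1 interior vertices
-- of a cycle, one factor -1 each, and the minus sign in d - X_k.

module FiniteSums (R : CommutativeRing 0ℓ 0ℓ) where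
  open CommutativeRing R hiding (zero)
  open Algebra.Properties.Ring ring
  open Algebra.Properties.Semiring.Sum semiring public using (sum)
  open Algebra.Properties.Semiring.Sum semiring using (sum-cong-≋; *-distribˡ-sum)
  open Algebra.Properties.CommutativeMonoid.Sum +-commutativeMonoid using (∑-distrib-+)
  open Relation.Binary.Reasoning.Setoid setoid

  sum-cong : ∀ n {f g : Vector Carrier n} → (∀ i → f i ≈ g i) → sum f ≈ sum g
  sum-cong n = sum-cong-≋ {n}

  sum-+ : ∀ n (f g : Vector Carrier n) → sum (λ i → f i + g i) ≈ sum f + sum g
  sum-+ n = ∑-distrib-+ {n}

  *-distribˡ-∑ : ∀ n x (f : Vector Carrier n) → x * sum f ≈ sum (λ i → x * f i)
  *-distribˡ-∑ n = *-distribˡ-sum {n}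

  sum-zero : ∀ {n} {f : Vector Carrier n} → (∀ i → f i ≈ 0#) → sum f ≈ 0#
  sum-zero {zero}  f≈0 = refl
  sum-zero {suc n} f≈0 = trans (+-cong (f≈0 zero) (sum-zero (f≈0 ∘ suc))) (+-identityˡ 0#)

  sum-single : ∀ {n} {f : Vector Carrier n} (k : Fin n) → (∀ j → j ≢ k → f j ≈ 0#) → sum f ≈ f k
  sum-single zero    f≈0 = trans (+-congˡ (sum-zero λ j → f≈0 (suc j) λ ())) (+-identityʳ _)
  sum-single (suc k) f≈0 = trans
    (+-cong (f≈0 zero λ ()) (sum-single k λ j j≢k → f≈0 (suc j) λ { ≡.refl → j≢k ≡.refl }))
    (+-identityˡ _)

  sum-neg : ∀ n (f : Vector Carrier n) → - sum f ≈ sum (λ i → - f i)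
  sum-neg zero    f = -0#≈0#
  sum-neg (suc n) f = trans (sym (-‿+-comm _ _)) (+-congˡ (sum-neg n (f ∘ suc)))

module Determinants (R : CommutativeRing 0ℓ 0ℓ) where
  open CommutativeRing R hiding (zero)
  open Matrices rawRing
  open FiniteSums R
  open Algebra.Definitions.RawSemiring (RawRing.rawSemiring rawRing) using (_^_)
  open Algebra.Properties.Ring ring
  open Relation.Binary.Reasoning.Setoid setoid

  module _ {A : Set} where

    -- Contraction of an alternating form ω with φ.  Cofactor expansion is iterated contraction,
    -- and this recursion makes the preservation of the alternating property a list induction.
    ∂ : (A → Carrier) → (List A → Carrier) → List A → Carrier
    ∂ φ ω []       = 0#
    ∂ φ ω (x ∷ xs) = φ x * ω xs - ∂ φ (λ ys → ω (x ∷ ys)) xs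

    -- The `φ i` are the row functionals and the list holds the columns. The value 0 on lists that
    -- are too long makes the form alternating and multilinear on lists of every length, so no
    -- length hypothesis has to be carried along.
    form : ∀ n → (Fin n → A → Carrier) → List A → Carrier
    form zero    φ []      = 1#
    form zero    φ (_ ∷ _) = 0#
    form (suc n) φ xs      = ∂ (φ zero) (form n (φ ∘ suc)) xs

    ∂-tabulate : ∀ {n} φ ω (f : Fin (suc n) → A) →
      ∂ φ ω (tabulate f)
        ≈ sum λ j → (- 1#) ^ toℕ j * (φ (f j) * ω (tabulate (removeAt f j)))
    ∂-tabulate {zero}  φ ω f = +-cong (sym (*-identityˡ _)) -0#≈0#
    ∂-tabulate {suc n} φ ω f = +-cong (sym (*-identityˡ _)) (begin
      - ∂ φ (λ ys → ω (f zero ∷ ys)) (tabulate (f ∘ suc))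
        ≈⟨ -‿cong (∂-tabulate φ (λ ys → ω (f zero ∷ ys)) (f ∘ suc)) ⟩
      - sum terms
        ≈⟨ sum-neg (suc n) terms ⟩
      sum (λ j → - terms j)
        ≈⟨ sum-cong (suc n) (λ j → trans (sym (-1*x≈-x (terms j))) (sym (*-assoc _ ((- 1#) ^ toℕ j) _))) ⟩
      _ ∎)
      where
      terms : Vector Carrier (suc n)
      terms j = (- 1#) ^ toℕ j * (φ (f (suc j)) * ω (f zero ∷ tabulate (removeAt (f ∘ suc) j)))

    det≈form : ∀ {n} (φ : Fin n → A → Carrier) (f : Fin n → A) →
      det (λ i j → φ i (f j)) ≈ form n φ (tabulate f)
    det≈form {zero}  φ f = refl
    det≈form {suc n} φ f = sym (trans (∂-tabulate (φ zero) (form n (φ ∘ suc)) f)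
      (sum-cong (suc n) λ j → *-congˡ {(- 1#) ^ toℕ j}
        (*-congˡ {φ zero (f j)} (sym (det≈form (φ ∘ suc) (removeAt f j))))))

    -- Contraction is linear in the form. The case `l = 0` says that contracting a vanishing form
    -- gives 0; general `l` yields multilinearity of contractions.
    ∂-sum : ∀ {l} φ {ω : List A → Carrier} {ωs : Fin l → List A → Carrier} (c : Vector Carrier l) →
      (∀ xs → ω xs ≈ sum λ j → ωs j xs * c j) → ∀ xs → ∂ φ ω xs ≈ sum λ j → ∂ φ (ωs j) xs * c j
    ∂-sum {l} φ {ω} {ωs} c eq []       = sym (sum-zero λ j → zeroˡ (c j))
    ∂-sum {l} φ {ω} {ωs} c eq (x ∷ xs) = begin
      φ x * ω xs - ∂ φ (λ ys → ω (x ∷ ys)) xs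
        ≈⟨ +-cong (*-congˡ (eq xs)) (-‿cong (∂-sum φ c (λ ys → eq (x ∷ ys)) xs)) ⟩
      φ x * sum (λ j → ωs j xs * c j) - sum (λ j → ∂x j * c j)
        ≈⟨ +-cong (*-distribˡ-∑ l (φ x) _) (sum-neg l _) ⟩
      sum (λ j → φ x * (ωs j xs * c j)) + sum (λ j → - (∂x j * c j))
        ≈⟨ sum-+ l _ _ ⟨
      sum (λ j → φ x * (ωs j xs * c j) - ∂x j * c j)
        ≈⟨ sum-cong l (λ j → trans (+-cong (sym (*-assoc _ _ _)) (-‿distribˡ-* _ _)) (sym (distribʳ _ _ _))) ⟩
      sum (λ j → (φ x * ωs j xs - ∂x j) * c j) ∎
      where
      ∂x : Fin l → Carrier
      ∂x j = ∂ φ (λ ys → ωs j (x ∷ ys)) xs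

    Alternating : (List A → Carrier) → Set
    Alternating ω = ∀ ys x zs → ω (ys ++ x ∷ x ∷ zs) ≈ 0#

    -- For a repeated pair at the head, the two terms that contract one of its members cancel, and
    -- the remaining terms keep the pair. Otherwise the pair survives in `ω (y ∷ _)`, which is again
    -- alternating.
    ∂-alternating : ∀ φ ω → Alternating ω → Alternating (∂ φ ω)
    ∂-alternating φ ω alt [] x zs = begin
      φ x * ω (x ∷ zs) - (φ x * ω (x ∷ zs) - ∂ φ (λ ys → ω (x ∷ x ∷ ys)) zs)
        ≈⟨ +-congˡ (-‿cong (+-congˡ (-‿cong (∂-sum {0} φ {ωs = λ ()} (λ ()) (alt [] x) zs)))) ⟩
      φ x * ω (x ∷ zs) - (φ x * ω (x ∷ zs) - 0#)
        ≈⟨ +-congˡ (-‿cong (trans (+-congˡ -0#≈0#) (+-identityʳ _))) ⟩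
      φ x * ω (x ∷ zs) - φ x * ω (x ∷ zs)
        ≈⟨ -‿inverseʳ _ ⟩
      0# ∎
    ∂-alternating φ ω alt (y ∷ ys) x zs = begin
      φ y * ω (ys ++ x ∷ x ∷ zs) - ∂ φ (λ ts → ω (y ∷ ts)) (ys ++ x ∷ x ∷ zs)
        ≈⟨ +-cong (*-congˡ (alt ys x zs))
                  (-‿cong (∂-alternating φ (λ ts → ω (y ∷ ts)) (alt ∘ (y ∷_)) ys x zs)) ⟩
      φ y * 0# - 0#
        ≈⟨ trans (+-cong (zeroʳ _) -0#≈0#) (+-identityˡ 0#) ⟩
      0# ∎

    form-alternating : ∀ n φ → Alternating (form n φ)
    form-alternating zero    φ []      x zs = refl
    form-alternating zero    φ (_ ∷ _) x zs = refl
    form-alternating (suc n) φ = ∂-alternating (φ zero) _ (form-alternating n (φ ∘ suc))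

  module _ {m : ℕ} where

    -- Stated for arbitrary finite combinations and for a `w` that agrees with the combination only
    -- componentwise. This one form contains the vanishing at zero (`l = 0`), additivity (`l = 2`)
    -- and compatibility with pointwise equality of vectors.
    Linear : (Vector Carrier m → Carrier) → Set
    Linear φ = ∀ {l} (c : Vector Carrier l) (x : Fin l → Vector Carrier m) (w : Vector Carrier m) →
      (∀ i → w i ≈ sum λ j → x j i * c j) → φ w ≈ sum λ j → φ (x j) * c j

    linear-- : ∀ {φ ψ} → Linear φ → Linear ψ → Linear (λ x → φ x - ψ x)
    linear-- {φ} {ψ} lin-φ lin-ψ {l} c x w eq = begin
      φ w - ψ w
        ≈⟨ +-cong (lin-φ c x w eq) (trans (-‿cong (lin-ψ c x w eq)) (sum-neg l _)) ⟩
      sum (λ j → φ (x j) * c j) + sum (λ j → - (ψ (x j) * c j))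
        ≈⟨ sum-+ l _ _ ⟨
      sum (λ j → φ (x j) * c j - ψ (x j) * c j)
        ≈⟨ sum-cong l (λ j → trans (+-congˡ (-‿distribˡ-* _ _)) (sym (distribʳ _ _ _))) ⟩
      sum (λ j → (φ (x j) - ψ (x j)) * c j) ∎

    linear-*ˡ : ∀ {φ} a → Linear φ → Linear (λ x → a * φ x)
    linear-*ˡ a lin {l} c x w eq = trans (*-congˡ (lin c x w eq))
      (trans (*-distribˡ-∑ l a _) (sum-cong l λ j → sym (*-assoc _ _ _)))

    linear-*ʳ : ∀ {φ} a → Linear φ → Linear (λ x → φ x * a)
    linear-*ʳ {φ} a lin {l} c x w eq = trans (*-comm _ _)
      (trans (linear-*ˡ {φ} a lin c x w eq) (sum-cong l λ j → *-congʳ (*-comm _ _)))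

    linear-0 : ∀ {φ} → Linear φ → ∀ {w} → (∀ i → w i ≈ 0#) → φ w ≈ 0#
    linear-0 lin {w} w≈0 = lin {0} (λ ()) (λ ()) w w≈0

    linear-+ : ∀ {φ} → Linear φ → ∀ x y → φ (λ i → x i + y i) ≈ φ x + φ y
    linear-+ lin x y = trans
      (lin {2} (λ _ → 1#) (λ { zero → x ; (suc _) → y }) _ λ i → sym (two (x i) (y i)))
      (two _ _)
      where
      two : ∀ a b → a * 1# + (b * 1# + 0#) ≈ a + b
      two a b = +-cong (*-identityʳ a) (trans (+-identityʳ _) (*-identityʳ b))

    Multilinear : (List (Vector Carrier m) → Carrier) → Set
    Multilinear ω = ∀ ys zs → Linear (λ x → ω (ys ++ x ∷ zs))

    ∂-multilinear : ∀ {φ ω} → Linear φ → Multilinear ω → Multilinear (∂ φ ω)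
    ∂-multilinear {φ} {ω} lin mul [] zs =
      linear-- {λ x → φ x * ω zs} (linear-*ʳ {φ} (ω zs) lin)
        λ c x w eq → ∂-sum φ c (λ ts → mul [] ts c x w eq) zs
    ∂-multilinear {φ} {ω} lin mul (y ∷ ys) zs =
      linear-- {λ x → φ y * ω (ys ++ x ∷ zs)} (linear-*ˡ (φ y) (mul ys zs))
        (∂-multilinear lin (λ ts → mul (y ∷ ts)) ys zs)

    form-multilinear : ∀ n φ → (∀ i → Linear (φ i)) → Multilinear (form n φ)
    form-multilinear zero φ lin []      zs c x w eq = sym (sum-zero λ j → zeroˡ (c j))
    form-multilinear zero φ lin (_ ∷ _) zs c x w eq = sym (sum-zero λ j → zeroˡ (c j))
    form-multilinear (suc n) φ lin =
      ∂-multilinear {ω = form n (φ ∘ suc)} (lin zero) (form-multilinear n (φ ∘ suc) (lin ∘ suc))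

    module _ {ω : List (Vector Carrier m) → Carrier} (alt : Alternating ω) (mul : Multilinear ω) where

      private
        snoc : ∀ ys (y : Vector Carrier m) zs → ω ((ys ++ [ y ]) ++ zs) ≈ ω (ys ++ y ∷ zs)
        snoc ys y zs = reflexive (≡.cong ω (++-assoc ys [ y ] zs))

      -- Polarization: put `x + y` into both slots and expand; the two diagonal terms vanish.
      swap-sign : ∀ ys x y zs → ω (ys ++ x ∷ y ∷ zs) ≈ - ω (ys ++ y ∷ x ∷ zs)
      swap-sign ys x y zs = x+y≈0⇒x≈-y (begin
        q x y + q y x
          ≈⟨ +-cong (+-identityˡ _) (+-identityʳ _) ⟨
        (0# + q x y) + (q y x + 0#)
          ≈⟨ +-cong (+-congʳ (alt ys x zs)) (+-congˡ (alt ys y zs)) ⟨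
        (q x x + q x y) + (q y x + q y y)
          ≈⟨ +-cong (second x) (second y) ⟨
        q x s + q y s
          ≈⟨ linear-+ (mul ys (s ∷ zs)) x y ⟨
        q s s
          ≈⟨ alt ys s zs ⟩
        0# ∎)
        where
        s : Vector Carrier m
        s i = x i + y i
        q : (a b : Vector Carrier m) → Carrier
        q a b = ω (ys ++ a ∷ b ∷ zs)
        second : ∀ a → q a s ≈ q a x + q a y
        second a = trans (sym (snoc ys a (s ∷ zs)))
          (trans (linear-+ (mul (ys ++ [ a ]) zs) x y)
            (+-cong (snoc ys a (x ∷ zs)) (snoc ys a (y ∷ zs))))
        x+y≈0⇒x≈-y : ∀ {a b} → a + b ≈ 0# → a ≈ - b
        x+y≈0⇒x≈-y {a} {b} = +-inverseˡ-unique a b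

      -- Adjacent swaps move the left `x` to the right until the two copies touch.
      repeated : ∀ ys x ws zs → ω (ys ++ x ∷ ws ++ x ∷ zs) ≈ 0#
      repeated ys x []       zs = alt ys x zs
      repeated ys x (w ∷ ws) zs = begin
        ω (ys ++ x ∷ w ∷ ws ++ x ∷ zs)          ≈⟨ swap-sign ys x w _ ⟩
        - ω (ys ++ w ∷ x ∷ ws ++ x ∷ zs)        ≈⟨ -‿cong (snoc ys w _) ⟨
        - ω ((ys ++ [ w ]) ++ x ∷ ws ++ x ∷ zs) ≈⟨ -‿cong (repeated (ys ++ [ w ]) x ws zs) ⟩
        - 0#                                    ≈⟨ -0#≈0# ⟩
        0#                                      ∎

      repeated-∈ : ∀ ys x zs → x ∈ ys ⊎ x ∈ zs → ω (ys ++ x ∷ zs) ≈ 0#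
      repeated-∈ ys x zs (inj₁ x∈ys) with as , bs , ≡.refl ← ∈-∃++ x∈ys =
        trans (reflexive (≡.cong ω (++-assoc as (x ∷ bs) (x ∷ zs)))) (repeated as x bs zs)
      repeated-∈ ys x zs (inj₂ x∈zs) with as , bs , ≡.refl ← ∈-∃++ x∈zs = repeated ys x as bs

  -- Exposes place `k` in the list of columns. Every other column stays in `ys` or `zs`, so
  -- substituting it at place `k` creates a repetition.
  tabulate-split : ∀ {A : Set} {n} (f : Fin n → A) k → ∃[ ys ] ∃[ zs ]
    (tabulate f ≡ ys ++ f k ∷ zs × (∀ j → j ≢ k → f j ∈ ys ⊎ f j ∈ zs))
  tabulate-split f zero = [] , tabulate (f ∘ suc) , ≡.refl , λ
    { zero    0≢0 → contradiction ≡.refl 0≢0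
    ; (suc j) _   → inj₂ (∈-tabulate⁺ j) }
  tabulate-split f (suc k) with ys , zs , eq , others ← tabulate-split (f ∘ suc) k =
    f zero ∷ ys , zs , ≡.cong (f zero ∷_) eq , λ
    { zero    _   → inj₁ (here ≡.refl)
    ; (suc j) j≢k → map₁ there (others j λ { ≡.refl → j≢k ≡.refl }) }

  -- With `Ω j` the determinant in which column `j` stands at place `k`, `Ω j` vanishes for `j ≢ k`.
  -- Hence `det M` is the sum of all `Ω j * ξ j`, which by multilinearity is the determinant with
  -- `M · ξ` at place `k`.
  det-singular : ∀ {m} (M : Matrix m) (ξ : Vector Carrier m) (k : Fin m) →
    ξ k ≈ 1# → (∀ i → (M · ξ) i ≈ 0#) → det M ≈ 0#
  det-singular {m} M ξ k ξk≈1 Mξ≈0 with tabulate-split (λ j i → M i j) k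
  ... | ys , zs , eq , others = begin
    det M                          ≈⟨ det≈form row column ⟩
    ω (tabulate column)            ≡⟨ ≡.cong ω eq ⟩
    Ω k                            ≈⟨ *-identityʳ _ ⟨
    Ω k * 1#                       ≈⟨ *-congˡ ξk≈1 ⟨
    Ω k * ξ k                      ≈⟨ sum-single k (λ j j≢k → trans (*-congʳ (vanish j j≢k)) (zeroˡ _)) ⟨
    sum (λ j → Ω j * ξ j)          ≈⟨ mul ys zs ξ column _ (λ _ → refl) ⟨
    ω (ys ++ (M · ξ) ∷ zs)         ≈⟨ linear-0 (mul ys zs) Mξ≈0 ⟩
    0#                             ∎
    where
    row : Fin m → Vector Carrier m → Carrier
    row i x = x i
    column : Fin m → Vector Carrier m
    column j i = M i j
    ω : List (Vector Carrier m) → Carrier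
    ω = form m row
    mul : Multilinear ω
    mul = form-multilinear m row λ i c x w eq → eq i
    Ω : Fin m → Carrier
    Ω j = ω (ys ++ column j ∷ zs)
    vanish : ∀ j → j ≢ k → Ω j ≈ 0#
    vanish j j≢k = repeated-∈ {ω = ω} (form-alternating m row) mul ys (column j) zs (others j j≢k)

-- Homomorphisms and characteristic polynomials

-- The source is a raw ring so that evaluation of polynomials, given as coefficient lists, qualifies
-- without a proof that they form a ring.
record PreservesOperations (A : RawRing 0ℓ 0ℓ) (S : CommutativeRing 0ℓ 0ℓ)
  (f : RawRing.Carrier A → CommutativeRing.Carrier S) : Set where
  private
    module A = RawRing A
  open CommutativeRing S
  field
    +-homo  : ∀ x y → f (x A.+ y) ≈ f x + f y
    *-homo  : ∀ x y → f (x A.* y) ≈ f x * f y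
    -‿homo  : ∀ x → f (A.- x) ≈ - f x
    0#-homo : f A.0# ≈ 0#
    1#-homo : f A.1# ≈ 1#

module DeterminantHomo {A : RawRing 0ℓ 0ℓ} (S : CommutativeRing 0ℓ 0ℓ)
  {f : RawRing.Carrier A → CommutativeRing.Carrier S} (homo : PreservesOperations A S f) where
  private
    module A where
      open RawRing A public
      open Matrices A public
      open Algebra.Definitions.RawSemiring rawSemiring public using (_^_; sum)
  open CommutativeRing S hiding (zero)
  open Matrices rawRing
  open Algebra.Definitions.RawSemiring (RawRing.rawSemiring rawRing) using (_^_)
  open FiniteSums S
  open PreservesOperations homo

  sum-homo : ∀ n (g : Vector A.Carrier n) → f (A.sum g) ≈ sum (λ i → f (g i))
  sum-homo zero    g = 0#-homo
  sum-homo (suc n) g = trans (+-homo _ _) (+-congˡ (sum-homo n (g ∘ suc)))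

  ^-homo : ∀ x n → f (x A.^ n) ≈ f x ^ n
  ^-homo x zero    = 1#-homo
  ^-homo x (suc n) = trans (*-homo _ _) (*-congˡ (^-homo x n))

  ^-cong : ∀ n {x y} → x ≈ y → x ^ n ≈ y ^ n
  ^-cong zero    x≈y = refl
  ^-cong (suc n) x≈y = *-cong x≈y (^-cong n x≈y)

  det-homo : ∀ {m} {M : A.Matrix m} {N : Matrix m} → (∀ i j → f (M i j) ≈ N i j) → f (A.det M) ≈ det N
  det-homo {zero}          eq = 1#-homo
  det-homo {suc m} {M} {N} eq = trans
    (sum-homo (suc m) λ j → (A.- A.1#) A.^ toℕ j A.* (M zero j A.* A.det λ i → removeAt (M (suc i)) j))
    (sum-cong (suc m) λ j → trans (*-homo _ _) (*-cong
      (trans (^-homo (A.- A.1#) (toℕ j)) (^-cong (toℕ j) (trans (-‿homo _) (-‿cong 1#-homo))))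
      (trans (*-homo _ _) (*-cong {f (M zero j)} (eq zero j)
        (det-homo {m} {λ i → removeAt (M (suc i)) j} {λ i → removeAt (N (suc i)) j} λ i l → eq (suc i) _)))))

module DiagonalDeterminants (R : CommutativeRing 0ℓ 0ℓ) where
  open CommutativeRing R hiding (zero)
  open Matrices rawRing
  open FiniteSums R
  open Algebra.Definitions.RawSemiring (RawRing.rawSemiring rawRing) using (product; _^_)

  det-diagonal : ∀ {m} (M : Matrix m) → (∀ i j → i ≢ j → M i j ≈ 0#) → det M ≈ product (λ i → M i i)
  det-diagonal {zero}  M off = refl
  det-diagonal {suc m} M off = trans
    (sum-single {suc m} zero λ j j≢0 →
      trans (*-congˡ {(- 1#) ^ toℕ j} (trans (*-congʳ (off zero j (j≢0 ∘ ≡.sym)))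
        (zeroˡ (det λ i → removeAt (M (suc i)) j)))) (zeroʳ _))
    (trans (*-identityˡ _)
      (*-congˡ (det-diagonal (λ i j → M (suc i) (suc j)) λ i j i≢j →
        off (suc i) (suc j) (i≢j ∘ Fin.suc-injective))))

  -- `P` is a multiplicatively closed property that the cofactor inherits; it will say that the
  -- scalar part is invertible.
  product-split : (P : Carrier → Set) → P 1# → (∀ {x y} → P x → P y → P (x * y)) →
    ∀ {n} (f : Vector Carrier n) k → (∀ j → j ≢ k → P (f j)) → ∃[ y ] (P y × product f ≈ f k * y)
  product-split P P1 P* {suc n} f zero    Pf = _ , all n (f ∘ suc) (λ j → Pf (suc j) λ ()) , refl
    where
    all : ∀ n (f : Vector Carrier n) → (∀ j → P (f j)) → P (product f)
    all zero    f Pf = P1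
    all (suc n) f Pf = P* (Pf zero) (all n (f ∘ suc) (Pf ∘ suc))
  product-split P P1 P* {suc n} f (suc k) Pf
    with y , Py , eq ← product-split P P1 P* (f ∘ suc) k (λ j j≢k → Pf (suc j) (j≢k ∘ Fin.suc-injective)) =
      f zero * y , P* (Pf zero λ ()) Py , trans (*-congˡ eq)
        (trans (sym (*-assoc _ _ _)) (trans (*-congʳ (*-comm _ _)) (*-assoc _ _ _)))

-- Division by X - c and values at infinitesimal distance from c.

module PolynomialRoots (R : CommutativeRing 0ℓ 0ℓ) where
  open CommutativeRing R hiding (zero)
  open Polynomials rawRing hiding (rawRing)
  open Algebra.Properties.Ring ring
  open Algebra.Solver.Ring.NaturalCoefficients.Default commutativeSemiring
    using (solve; _:=_; _:+_; _:*_)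
  open Relation.Binary.Reasoning.Setoid setoid
  private
    module P = RawRing (Polynomials.rawRing rawRing)

  -- The quotient of p by X - c: its coefficients are the intermediate values of Horner's scheme.
  quotient : Poly → Carrier → Poly
  quotient []      c = []
  quotient (a ∷ p) c = eval p c ∷ quotient p c

  coeff-+ : ∀ p q n → coeff (p +ᴾ q) n ≈ coeff p n + coeff q n
  coeff-+ []      q       n       = sym (+-identityˡ _)
  coeff-+ (a ∷ p) []      n       = sym (+-identityʳ _)
  coeff-+ (a ∷ p) (b ∷ q) zero    = refl
  coeff-+ (a ∷ p) (b ∷ q) (suc n) = coeff-+ p q n

  coeff-map-* : ∀ a p n → coeff (map (a *_) p) n ≈ a * coeff p n
  coeff-map-* a []      n       = sym (zeroʳ a)
  coeff-map-* a (b ∷ p) zero    = refl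
  coeff-map-* a (b ∷ p) (suc n) = coeff-map-* a p n

  -- Horner's recurrence, that is, division with remainder p = (X - c) q + p(c) read off coefficient
  -- by coefficient: prepending `eval p c` shifts the quotient by one degree and puts the remainder
  -- in degree 0.
  coeff-quotient : ∀ p c n →
    coeff p n + c * coeff (quotient p c) n ≈ coeff (eval p c ∷ quotient p c) n
  coeff-quotient []      c zero    = trans (+-identityˡ _) (zeroʳ c)
  coeff-quotient []      c (suc n) = trans (+-identityˡ _) (zeroʳ c)
  coeff-quotient (a ∷ p) c zero    = refl
  coeff-quotient (a ∷ p) c (suc n) = coeff-quotient p c n

  factor : ∀ p c → eval p c ≈ 0# → p P.≈ (X P.+ P.- constant c) P.* quotient p c
  factor p c root n = sym (begin
    coeff ((X P.+ P.- constant c) P.* q) n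
      ≈⟨ coeff-+ (map ((0# - c) *_) q) _ n ⟩
    coeff (map ((0# - c) *_) q) n + coeff (0# ∷ (map (1# *_) q +ᴾ [ 0# ])) n
      ≈⟨ +-cong (trans (coeff-map-* _ q n) (trans (*-congʳ (+-identityˡ _)) (sym (-‿distribˡ-* _ _))))
           (shift n) ⟩
    - (c * coeff q n) + coeff (eval p c ∷ q) n
      ≈⟨ +-congˡ (coeff-quotient p c n) ⟨
    - (c * coeff q n) + (coeff p n + c * coeff q n)
      ≈⟨ trans (+-comm _ _) (+-assoc _ _ _) ⟩
    coeff p n + (c * coeff q n - c * coeff q n)
      ≈⟨ trans (+-congˡ (-‿inverseʳ _)) (+-identityʳ _) ⟩
    coeff p n ∎)
    where
    q = quotient p c
    coeff-[0] : ∀ n → coeff [ 0# ] n ≈ 0#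
    coeff-[0] zero    = refl
    coeff-[0] (suc n) = refl
    shift : ∀ n → coeff (0# ∷ (map (1# *_) q +ᴾ [ 0# ])) n ≈ coeff (eval p c ∷ q) n
    -- The two lists differ only in degree 0, where the remainder `eval p c` stands against 0.
    shift zero    = sym root
    shift (suc n) = trans (coeff-+ (map (1# *_) q) _ n)
      (trans (+-cong (trans (coeff-map-* 1# q n) (*-identityˡ _)) (coeff-[0] n)) (+-identityʳ _))

  -- Taylor's formula modulo e²; the quotient at c evaluates to the derivative at c.
  eval-infinitesimal : ∀ p c {e} → e * e ≈ 0# → eval p (c + e) ≈ eval p c + e * eval (quotient p c) c
  eval-infinitesimal []      c {e} e²≈0 = sym (trans (+-identityˡ _) (zeroʳ e))
  eval-infinitesimal (a ∷ p) c {e} e²≈0 = begin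
    a + (c + e) * eval p (c + e)
      ≈⟨ +-congˡ (*-congˡ (eval-infinitesimal p c e²≈0)) ⟩
    a + (c + e) * (P + e * D)
      ≈⟨ solve 5 (λ a c e P D → a :+ (c :+ e) :* (P :+ e :* D)
                             := a :+ c :* P :+ e :* (P :+ c :* D) :+ e :* e :* D) refl a c e P D ⟩
    a + c * P + e * (P + c * D) + e * e * D
      ≈⟨ trans (+-congˡ (trans (*-congʳ e²≈0) (zeroˡ D))) (+-identityʳ _) ⟩
    a + c * P + e * (P + c * D) ∎
    where
    P D : Carrier
    P = eval p c
    D = eval (quotient p c) c

module EvaluationHomo {A : RawRing 0ℓ 0ℓ} (S : CommutativeRing 0ℓ 0ℓ)
  {f : RawRing.Carrier A → CommutativeRing.Carrier S} (homo : PreservesOperations A S f)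
  (x : CommutativeRing.Carrier S) where
  private
    module A = RawRing A
    open module Aᴾ = Polynomials A using (Poly; X; constant; _+ᴾ_; _*ᴾ_)
  open CommutativeRing S hiding (zero)
  open Algebra.Properties.Ring ring using (-0#≈0#; -‿+-comm; -‿distribʳ-*)
  open Polynomials rawRing using (eval)
  open Matrices rawRing using (Matrix; diag; _⊖_; det)
  open PreservesOperations homo
  open Algebra.Solver.Ring.NaturalCoefficients.Default commutativeSemiring
    using (solve; _:=_; _:+_; _:*_; con)

  ev : Poly → Carrier
  ev p = eval (map f p) x

  ev-+ : ∀ p q → ev (p +ᴾ q) ≈ ev p + ev q
  ev-+ []      q       = sym (+-identityˡ _)
  ev-+ (a ∷ p) []      = sym (+-identityʳ _)
  ev-+ (a ∷ p) (b ∷ q) = trans (+-cong (+-homo a b) (*-congˡ (ev-+ p q)))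
    (solve 5 (λ a b x p q → a :+ b :+ x :* (p :+ q) := a :+ x :* p :+ (b :+ x :* q)) refl
      (f a) (f b) x (ev p) (ev q))

  ev-scale : ∀ a q → ev (map (a A.*_) q) ≈ f a * ev q
  ev-scale a []      = sym (zeroʳ _)
  ev-scale a (b ∷ q) = trans (+-cong (*-homo a b) (*-congˡ (ev-scale a q)))
    (solve 4 (λ a b x q → a :* b :+ x :* (a :* q) := a :* (b :+ x :* q)) refl (f a) (f b) x (ev q))

  ev-* : ∀ p q → ev (p *ᴾ q) ≈ ev p * ev q
  ev-* []      q = sym (zeroˡ _)
  ev-* (a ∷ p) q = trans (ev-+ (map (a A.*_) q) _)
    (trans (+-cong (ev-scale a q) (+-cong 0#-homo (*-congˡ (ev-* p q))))
      (solve 4 (λ a x p q → a :* q :+ (con 0 :+ x :* (p :* q)) := (a :+ x :* p) :* q) refl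
        (f a) x (ev p) (ev q)))

  ev-neg : ∀ p → ev (map A.-_ p) ≈ - ev p
  ev-neg []      = sym -0#≈0#
  ev-neg (a ∷ p) = trans (+-cong (-‿homo a) (trans (*-congˡ (ev-neg p)) (sym (-‿distribʳ-* _ _))))
    (-‿+-comm _ _)

  ev-constant : ∀ a → ev (constant a) ≈ f a
  ev-constant a = trans (+-congˡ (zeroʳ x)) (+-identityʳ _)

  ev-X : ev X ≈ x
  ev-X = trans (+-cong 0#-homo (trans (*-congˡ (trans (ev-constant A.1#) 1#-homo)) (*-identityʳ x)))
    (+-identityˡ x)

  ev-homo : PreservesOperations Aᴾ.rawRing S ev
  ev-homo = record
    { +-homo  = ev-+
    ; *-homo  = ev-*
    ; -‿homo  = ev-neg
    ; 0#-homo = refl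
    ; 1#-homo = trans (ev-constant A.1#) 1#-homo
    }

  -- Evaluation is a homomorphism and so commutes with the determinant. It is applied with the
  -- identity at the eigenvalue, and with the scalar part, re-embedded as a zeon, at an
  -- infinitesimally shifted point.
  ev-charPoly : ∀ {m} {M : Matrices.Matrix A m} {N : Matrix m} → (∀ i j → f (M i j) ≈ N i j) →
    ev (charPoly A M) ≈ det (diag (λ _ → x) ⊖ N)
  ev-charPoly {m} {M} eq = DeterminantHomo.det-homo S ev-homo {m}
    {Matrices._⊖_ Aᴾ.rawRing (Matrices.diag Aᴾ.rawRing λ _ → X) λ i j → constant (M i j)} λ i j →
    trans (ev-+ (Matrices.diag Aᴾ.rawRing (λ _ → X) i j) _)
      (+-cong (ev-diag i j) (trans (ev-neg (constant (M i j))) (-‿cong (trans (ev-constant (M i j)) (eq i j)))))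
    where
    ev-diag : ∀ (i j : Fin m) → ev (Matrices.diag Aᴾ.rawRing (λ _ → X) i j) ≈ diag (λ _ → x) i j
    ev-diag i j with does (i Fin.≟ j)
    ... | true  = ev-X
    ... | false = refl

module RootsHomo (A S : CommutativeRing 0ℓ 0ℓ)
  {f : CommutativeRing.Carrier A → CommutativeRing.Carrier S}
  (homo : PreservesOperations (CommutativeRing.rawRing A) S f) where
  private
    module A where
      open CommutativeRing A public
      open Polynomials rawRing public using (Poly; eval)
      open PolynomialRoots A public
  open CommutativeRing S
  open Polynomials rawRing using (eval)
  open PolynomialRoots S
  open PreservesOperations homo

  eval-homo : ∀ p {c c′} → f c ≈ c′ → f (A.eval p c) ≈ eval (map f p) c′
  eval-homo []      fc≈c′ = 0#-homo
  eval-homo (a ∷ p) fc≈c′ = trans (+-homo _ _)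
    (+-congˡ (trans (*-homo _ _) (*-cong fc≈c′ (eval-homo p fc≈c′))))

  derivative-homo : ∀ p {c c′} → f c ≈ c′ →
    f (A.eval (A.quotient p c) c) ≈ eval (quotient (map f p) c′) c′
  derivative-homo []      fc≈c′ = 0#-homo
  derivative-homo (a ∷ p) fc≈c′ = trans (+-homo _ _)
    (+-cong (eval-homo p fc≈c′) (trans (*-homo _ _) (*-cong fc≈c′ (derivative-homo p fc≈c′))))

-- The zeon algebra

infix 4 _≐_
_≐_ : FinSet → FinSet → Set
I ≐ J = I ⊆ J × J ⊆ I

≐-trans : ∀ {I J K} → I ≐ J → J ≐ K → I ≐ K
≐-trans (p , p′) (q , q′) = ⊆-trans p q , ⊆-trans q′ p′

module ZeonRing (R : CommutativeRing 0ℓ 0ℓ) where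
  open CommutativeRing R hiding (zero)
  open Zeons rawRing using (Zeon; coefficient; scalarPart; mulTerm; mapCoefficients; term; scalar; ζ)
  open Algebra.Properties.Ring ring using (-0#≈0#; -‿+-comm; -‿distribˡ-*)
  open Relation.Binary.Reasoning.Setoid setoid
  private
    module Z = RawRing (Zeons.rawRing rawRing)

  indicator : {P : Set} → Dec P → Carrier → Carrier
  indicator P? x = if does P? then x else 0#

  indicator-yes : ∀ {P : Set} (P? : Dec P) {x} → P → indicator P? x ≈ x
  indicator-yes P? p = reflexive (≡.cong (if_then _ else 0#) (dec-true P? p))

  indicator-no : ∀ {P : Set} (P? : Dec P) {x} → ¬ P → indicator P? x ≈ 0#
  indicator-no P? ¬p = reflexive (≡.cong (if_then _ else 0#) (dec-false P? ¬p))

  indicator-cong : ∀ {P Q : Set} (P? : Dec P) (Q? : Dec Q) {x y} →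
    (P → Q) → (Q → P) → (P → x ≈ y) → indicator P? x ≈ indicator Q? y
  indicator-cong (yes p) Q? P⇒Q Q⇒P eq = trans (eq p) (sym (indicator-yes Q? (P⇒Q p)))
  indicator-cong (no ¬p) Q? P⇒Q Q⇒P eq = sym (indicator-no Q? (¬p ∘ Q⇒P))

  -- Functions on finite sets that ignore order and repetition are the linear functionals on the
  -- algebra; u ≈ v says that the functionals δ I agree on u and v, and then all of them do.
  ⟪_,_⟫ : Zeon → (FinSet → Carrier) → Carrier
  ⟪ []          , F ⟫ = 0#
  ⟪ (a , I) ∷ u , F ⟫ = a * F I + ⟪ u , F ⟫

  Respectful : (FinSet → Carrier) → Set
  Respectful F = ∀ {I J} → I ≐ J → F I ≈ F J

  δ : FinSet → FinSet → Carrier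
  δ I J = indicator (J ≐? I) 1#

  δ-respectful : ∀ I → Respectful (δ I)
  δ-respectful I {J} {K} J≐K = indicator-cong (J ≐? I) (K ≐? I)
    (≐-trans (swap J≐K)) (≐-trans J≐K) (λ _ → refl)

  coefficient≈⟪δ⟫ : ∀ u I → coefficient u I ≈ ⟪ u , δ I ⟫
  coefficient≈⟪δ⟫ []            I = refl
  coefficient≈⟪δ⟫ ((a , J) ∷ u) I with does (J ≐? I)
  ... | true  = +-cong (sym (*-identityʳ a)) (coefficient≈⟪δ⟫ u I)
  ... | false = trans (coefficient≈⟪δ⟫ u I) (sym (trans (+-congʳ (zeroʳ a)) (+-identityˡ _)))

  ⟪⟫-cong : ∀ u {F G} → (∀ I → F I ≈ G I) → ⟪ u , F ⟫ ≈ ⟪ u , G ⟫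
  ⟪⟫-cong []            eq = refl
  ⟪⟫-cong ((a , I) ∷ u) eq = +-cong (*-congˡ (eq I)) (⟪⟫-cong u eq)

  ⟪⟫-++ : ∀ u v F → ⟪ u ++ v , F ⟫ ≈ ⟪ u , F ⟫ + ⟪ v , F ⟫
  ⟪⟫-++ []            v F = sym (+-identityˡ _)
  ⟪⟫-++ ((a , I) ∷ u) v F = trans (+-congˡ (⟪⟫-++ u v F)) (sym (+-assoc _ _ _))

  ⟪⟫-neg : ∀ u F → ⟪ Z.- u , F ⟫ ≈ - ⟪ u , F ⟫
  ⟪⟫-neg []            F = sym -0#≈0#
  ⟪⟫-neg ((a , I) ∷ u) F = trans (+-cong (sym (-‿distribˡ-* a (F I))) (⟪⟫-neg u F)) (-‿+-comm _ _)

  ⟪⟫-zero : ∀ u → ⟪ u , (λ _ → 0#) ⟫ ≈ 0#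
  ⟪⟫-zero []            = refl
  ⟪⟫-zero ((a , I) ∷ u) = trans (+-cong (zeroʳ a) (⟪⟫-zero u)) (+-identityˡ 0#)

  ⟪⟫-+ : ∀ u F G → ⟪ u , (λ I → F I + G I) ⟫ ≈ ⟪ u , F ⟫ + ⟪ u , G ⟫
  ⟪⟫-+ []            F G = sym (+-identityˡ 0#)
  ⟪⟫-+ ((a , I) ∷ u) F G = trans (+-cong (distribˡ a _ _) (⟪⟫-+ u F G)) (middleFour _ _ _ _)
    where
    middleFour : ∀ a b c d → (a + b) + (c + d) ≈ (a + c) + (b + d)
    middleFour a b c d = trans (+-assoc a b _) (trans (+-congˡ (trans (sym (+-assoc b c d))
      (trans (+-congʳ (+-comm b c)) (+-assoc c b d)))) (sym (+-assoc a c _)))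

  ⟪⟫-* : ∀ a u F → ⟪ u , (λ I → a * F I) ⟫ ≈ a * ⟪ u , F ⟫
  ⟪⟫-* a []            F = sym (zeroʳ a)
  ⟪⟫-* a ((b , I) ∷ u) F = trans
    (+-cong (trans (sym (*-assoc b a _)) (trans (*-congʳ (*-comm b a)) (*-assoc a b _))) (⟪⟫-* a u F))
    (sym (distribˡ a _ _))

  ⟪⟫-swap : ∀ u v (F : FinSet → FinSet → Carrier) →
    ⟪ u , (λ I → ⟪ v , F I ⟫) ⟫ ≈ ⟪ v , (λ J → ⟪ u , (λ I → F I J) ⟫) ⟫
  ⟪⟫-swap []            v F = sym (⟪⟫-zero v)
  ⟪⟫-swap ((a , I) ∷ u) v F = trans (+-cong (sym (⟪⟫-* a v (F I))) (⟪⟫-swap u v F)) (sym (⟪⟫-+ v _ _))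

  ⟪⟫-concatMap : ∀ f u {F} G → (∀ a I → ⟪ f (a , I) , F ⟫ ≈ a * G I) → ⟪ concatMap f u , F ⟫ ≈ ⟪ u , G ⟫
  ⟪⟫-concatMap f []            G eq = refl
  ⟪⟫-concatMap f ((a , I) ∷ u) G eq =
    trans (⟪⟫-++ (f (a , I)) (concatMap f u) _) (+-cong (eq a I) (⟪⟫-concatMap f u G eq))

  -- `translate F I` is the functional sending v to the value of `F` on the product ζ_I v. Through
  -- `⟪⟫-mul` the ring laws become identities between functions of index sets.
  translate : (FinSet → Carrier) → FinSet → FinSet → Carrier
  translate F I J = indicator (disjoint? I J) (F (I ++ J))

  ⟪⟫-mul : ∀ u v F → ⟪ u Z.* v , F ⟫ ≈ ⟪ u , (λ I → ⟪ v , translate F I ⟫) ⟫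
  ⟪⟫-mul u v F = ⟪⟫-concatMap _ u _ λ a I →
    trans (⟪⟫-concatMap (mulTerm (a , I)) v _ λ b J → inner a I b J) (⟪⟫-* a v (translate F I))
    where
    inner : ∀ a I b J → ⟪ mulTerm (a , I) (b , J) , F ⟫ ≈ b * (a * translate F I J)
    inner a I b J with does (disjoint? I J)
    ... | true  = trans (+-identityʳ _) (trans (*-congʳ (*-comm a b)) (*-assoc b a _))
    ... | false = sym (trans (*-congˡ (zeroʳ a)) (zeroʳ b))

  disjoint-≐ : ∀ {I I′ J J′ : FinSet} → I′ ⊆ I → J′ ⊆ J → Disjoint I J → Disjoint I′ J′
  disjoint-≐ I′⊆I J′⊆J I#J (i , j) = I#J (I′⊆I i , J′⊆J j)

  translate-cong : ∀ {F} → Respectful F → ∀ {I I′ J J′} → I ≐ I′ → J ≐ J′ →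
    translate F I J ≈ translate F I′ J′
  translate-cong resp {I} {I′} {J} {J′} (p , p′) (q , q′) =
    indicator-cong (disjoint? I J) (disjoint? I′ J′) (disjoint-≐ p′ q′) (disjoint-≐ p q)
      λ _ → resp (++⁺ p q , ++⁺ p′ q′)

  without : FinSet → Zeon → Zeon
  without I [] = []
  without I ((a , J) ∷ u) = if does (J ≐? I) then without I u else (a , J) ∷ without I u

  length-without : ∀ I u → length (without I u) ℕ.≤ length u
  length-without I [] = ℕ.z≤n
  length-without I ((a , J) ∷ u) with does (J ≐? I)
  ... | true  = ℕ.m≤n⇒m≤1+n (length-without I u)
  ... | false = ℕ.s≤s (length-without I u)

  -- Collects the terms of `u` whose index set equals `I`: a respectful `F` takes the same value on
  -- all of them, and their coefficients add up to `⟪ u , δ I ⟫`.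
  ⟪⟫-without : ∀ I u {F} → Respectful F → ⟪ u , F ⟫ ≈ ⟪ u , δ I ⟫ * F I + ⟪ without I u , F ⟫
  ⟪⟫-without I [] resp = sym (trans (+-identityʳ _) (zeroˡ _))
  ⟪⟫-without I ((a , J) ∷ u) {F} resp = step (J ≐? I)
    where
    step : (J≐I? : Dec (J ≐ I)) → a * F J + ⟪ u , F ⟫
      ≈ (a * indicator J≐I? 1# + ⟪ u , δ I ⟫) * F I
        + ⟪ (if does J≐I? then without I u else (a , J) ∷ without I u) , F ⟫
    step (yes J≐I) = begin
      a * F J + ⟪ u , F ⟫
        ≈⟨ +-cong (*-cong (sym (*-identityʳ a)) (resp J≐I)) (⟪⟫-without I u resp) ⟩
      a * 1# * F I + (⟪ u , δ I ⟫ * F I + ⟪ without I u , F ⟫)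
        ≈⟨ +-assoc _ _ _ ⟨
      (a * 1# * F I + ⟪ u , δ I ⟫ * F I) + ⟪ without I u , F ⟫
        ≈⟨ +-congʳ (distribʳ _ _ _) ⟨
      (a * 1# + ⟪ u , δ I ⟫) * F I + ⟪ without I u , F ⟫ ∎
    step (no _) = begin
      a * F J + ⟪ u , F ⟫
        ≈⟨ +-congˡ (⟪⟫-without I u resp) ⟩
      a * F J + (⟪ u , δ I ⟫ * F I + ⟪ without I u , F ⟫)
        ≈⟨ trans (sym (+-assoc _ _ _)) (trans (+-congʳ (+-comm _ _)) (+-assoc _ _ _)) ⟩
      ⟪ u , δ I ⟫ * F I + (a * F J + ⟪ without I u , F ⟫)
        ≈⟨ +-congʳ (*-congʳ (trans (+-congʳ (zeroʳ a)) (+-identityˡ _))) ⟨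
      (a * 0# + ⟪ u , δ I ⟫) * F I + (a * F J + ⟪ without I u , F ⟫) ∎

  ⟪⟫-null : ∀ n u → length u ℕ.≤ n → (∀ I → ⟪ u , δ I ⟫ ≈ 0#) → ∀ {F} → Respectful F → ⟪ u , F ⟫ ≈ 0#
  ⟪⟫-null n [] _ null resp = refl
  ⟪⟫-null (suc n) u@((a , I) ∷ u′) (ℕ.s≤s len) null {F} resp = begin
    ⟪ u , F ⟫             ≈⟨ reduce resp ⟩
    ⟪ without I u , F ⟫   ≈⟨ reflexive (≡.cong (λ w → ⟪ w , F ⟫) drop-head) ⟩
    ⟪ without I u′ , F ⟫
      ≈⟨ ⟪⟫-null n (without I u′) (ℕ.≤-trans (length-without I u′) len) null′ resp ⟩
    0# ∎
    where
    drop-head : without I u ≡ without I u′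
    drop-head = ≡.cong (if_then without I u′ else (a , I) ∷ without I u′)
      (dec-true (I ≐? I) (⊆-refl , ⊆-refl))
    reduce : ∀ {F} → Respectful F → ⟪ u , F ⟫ ≈ ⟪ without I u , F ⟫
    reduce {F} resp = trans (⟪⟫-without I u resp)
      (trans (+-congʳ (trans (*-congʳ (null I)) (zeroˡ (F I)))) (+-identityˡ _))
    null′ : ∀ J → ⟪ without I u′ , δ J ⟫ ≈ 0#
    null′ J = trans (reflexive (≡.cong (λ w → ⟪ w , δ J ⟫) (≡.sym drop-head)))
      (trans (sym (reduce {δ J} (δ-respectful J))) (null J))

  -- All coefficients of the difference vanish. General functionals are needed for congruence of
  -- multiplication, where `u` is paired with `λ I → ⟪ v , translate F I ⟫`, in general not a `δ`.
  ≈⇒⟪⟫≈ : ∀ {u v} → u Z.≈ v → ∀ {F} → Respectful F → ⟪ u , F ⟫ ≈ ⟪ v , F ⟫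
  ≈⇒⟪⟫≈ {u} {v} u≈v {F} resp =
    x-y≈0⇒x≈y (trans (sym (difference F)) (⟪⟫-null _ (u ++ Z.- v) ℕ.≤-refl null resp))
    where
    open Algebra.Properties.Ring ring using (x∙y⁻¹≈ε⇒x≈y)
    x-y≈0⇒x≈y : ∀ {x y} → x - y ≈ 0# → x ≈ y
    x-y≈0⇒x≈y = x∙y⁻¹≈ε⇒x≈y _ _
    difference : ∀ F → ⟪ u ++ Z.- v , F ⟫ ≈ ⟪ u , F ⟫ - ⟪ v , F ⟫
    difference F = trans (⟪⟫-++ u (Z.- v) F) (+-congˡ (⟪⟫-neg v F))
    null : ∀ I → ⟪ u ++ Z.- v , δ I ⟫ ≈ 0#
    null I = trans (difference (δ I)) (trans
      (+-congʳ (trans (sym (coefficient≈⟪δ⟫ u I)) (trans (u≈v I) (coefficient≈⟪δ⟫ v I))))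
      (-‿inverseʳ _))

  ⟪⟫≈⇒≈ : ∀ {u v} → (∀ {F} → Respectful F → ⟪ u , F ⟫ ≈ ⟪ v , F ⟫) → u Z.≈ v
  ⟪⟫≈⇒≈ {u} {v} eq I =
    trans (coefficient≈⟪δ⟫ u I) (trans (eq (δ-respectful I)) (sym (coefficient≈⟪δ⟫ v I)))

  ++-cong : ∀ {u u′ v v′} → u Z.≈ u′ → v Z.≈ v′ → u ++ v Z.≈ u′ ++ v′
  ++-cong {u} {u′} {v} {v′} u≈u′ v≈v′ = ⟪⟫≈⇒≈ {u ++ v} {u′ ++ v′} λ {F} resp →
    trans (⟪⟫-++ u v F) (trans (+-cong (≈⇒⟪⟫≈ {u} {u′} u≈u′ resp) (≈⇒⟪⟫≈ {v} {v′} v≈v′ resp))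
      (sym (⟪⟫-++ u′ v′ F)))

  neg-cong : ∀ {u v} → u Z.≈ v → Z.- u Z.≈ Z.- v
  neg-cong {u} {v} u≈v = ⟪⟫≈⇒≈ {Z.- u} {Z.- v} λ {F} resp →
    trans (⟪⟫-neg u F) (trans (-‿cong (≈⇒⟪⟫≈ {u} {v} u≈v resp)) (sym (⟪⟫-neg v F)))

  *-congZ : ∀ {u u′ v v′} → u Z.≈ u′ → v Z.≈ v′ → u Z.* v Z.≈ u′ Z.* v′
  *-congZ {u} {u′} {v} {v′} u≈u′ v≈v′ = ⟪⟫≈⇒≈ {u Z.* v} {u′ Z.* v′} λ {F} resp → begin
    ⟪ u Z.* v , F ⟫
      ≈⟨ ⟪⟫-mul u v F ⟩
    ⟪ u , (λ I → ⟪ v , translate F I ⟫) ⟫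
      ≈⟨ ≈⇒⟪⟫≈ {u} {u′} u≈u′ (λ I≐J → ⟪⟫-cong v λ K → translate-cong resp I≐J (⊆-refl , ⊆-refl)) ⟩
    ⟪ u′ , (λ I → ⟪ v , translate F I ⟫) ⟫
      ≈⟨ ⟪⟫-cong u′ (λ I → ≈⇒⟪⟫≈ {v} {v′} v≈v′ (translate-cong resp (⊆-refl , ⊆-refl))) ⟩
    ⟪ u′ , (λ I → ⟪ v′ , translate F I ⟫) ⟫
      ≈⟨ ⟪⟫-mul u′ v′ F ⟨
    ⟪ u′ Z.* v′ , F ⟫ ∎

  *-commZ : ∀ u v → u Z.* v Z.≈ v Z.* u
  *-commZ u v = ⟪⟫≈⇒≈ {u Z.* v} {v Z.* u} λ {F} resp → begin
    ⟪ u Z.* v , F ⟫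
      ≈⟨ ⟪⟫-mul u v F ⟩
    ⟪ u , (λ I → ⟪ v , translate F I ⟫) ⟫
      ≈⟨ ⟪⟫-swap u v (translate F) ⟩
    ⟪ v , (λ J → ⟪ u , (λ I → translate F I J) ⟫) ⟫
      ≈⟨ ⟪⟫-cong v (λ J → ⟪⟫-cong u λ I → indicator-cong (disjoint? I J) (disjoint? J I)
           (_∘ swap) (_∘ swap) λ _ → resp (++-comm-⊆ I J , ++-comm-⊆ J I)) ⟩
    ⟪ v , (λ J → ⟪ u , translate F J ⟫) ⟫
      ≈⟨ ⟪⟫-mul v u F ⟨
    ⟪ v Z.* u , F ⟫ ∎
    where
    ++-comm-⊆ : ∀ (I J : FinSet) → I ++ J ⊆ J ++ I
    ++-comm-⊆ I J i∈ = [ ∈-++⁺ʳ J , ∈-++⁺ˡ ]′ (∈-++⁻ I i∈)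

  ⟪⟫-indicator : ∀ {P : Set} (P? : Dec P) u F → ⟪ u , (λ I → indicator P? (F I)) ⟫ ≈ indicator P? ⟪ u , F ⟫
  ⟪⟫-indicator P? u F with does P?
  ... | true  = refl
  ... | false = ⟪⟫-zero u

  *-assocZ : ∀ u v w → (u Z.* v) Z.* w Z.≈ u Z.* (v Z.* w)
  *-assocZ u v w = ⟪⟫≈⇒≈ {(u Z.* v) Z.* w} {u Z.* (v Z.* w)} λ {F} resp → begin
    ⟪ (u Z.* v) Z.* w , F ⟫
      ≈⟨ ⟪⟫-mul (u Z.* v) w F ⟩
    ⟪ u Z.* v , (λ L → ⟪ w , translate F L ⟫) ⟫
      ≈⟨ ⟪⟫-mul u v _ ⟩
    ⟪ u , (λ I → ⟪ v , (λ J → indicator (disjoint? I J) ⟪ w , translate F (I ++ J) ⟫) ⟫) ⟫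
      ≈⟨ ⟪⟫-cong u (λ I → ⟪⟫-cong v λ J → sym (⟪⟫-indicator (disjoint? I J) w _)) ⟩
    ⟪ u , (λ I → ⟪ v , (λ J → ⟪ w , (λ K → indicator (disjoint? I J) (translate F (I ++ J) K)) ⟫) ⟫) ⟫
      ≈⟨ ⟪⟫-cong u (λ I → ⟪⟫-cong v λ J → ⟪⟫-cong w λ K → reassociate F I J K) ⟩
    ⟪ u , (λ I → ⟪ v , (λ J → ⟪ w , (λ K → indicator (disjoint? J K) (translate F I (J ++ K))) ⟫) ⟫) ⟫
      ≈⟨ ⟪⟫-cong u (λ I → ⟪⟫-mul v w (translate F I)) ⟨
    ⟪ u , (λ I → ⟪ v Z.* w , translate F I ⟫) ⟫
      ≈⟨ ⟪⟫-mul u (v Z.* w) F ⟨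
    ⟪ u Z.* (v Z.* w) , F ⟫ ∎
    where
    reassociate : ∀ F I J K →
      indicator (disjoint? I J) (translate F (I ++ J) K) ≈ indicator (disjoint? J K) (translate F I (J ++ K))
    reassociate F I J K with disjoint? I J | disjoint? J K
    ... | yes I#J | yes J#K = indicator-cong (disjoint? (I ++ J) K) (disjoint? I (J ++ K))
      (λ IJ#K (i , jk) → [ (λ j → I#J (i , j)) , (λ k → IJ#K (∈-++⁺ˡ i , k)) ]′ (∈-++⁻ J jk))
      (λ I#JK (ij , k) → [ (λ i → I#JK (i , ∈-++⁺ʳ J k)) , (λ j → J#K (j , k)) ]′ (∈-++⁻ I ij))
      (λ _ → reflexive (≡.cong F (++-assoc I J K)))
    ... | yes I#J | no ¬J#K = indicator-no (disjoint? (I ++ J) K) λ IJ#K →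
      ¬J#K λ (j , k) → IJ#K (∈-++⁺ʳ I j , k)
    ... | no ¬I#J | yes J#K = sym (indicator-no (disjoint? I (J ++ K)) λ I#JK →
      ¬I#J λ (i , j) → I#JK (i , ∈-++⁺ˡ j))
    ... | no ¬I#J | no ¬J#K = refl

  *-identityˡZ : ∀ u → Z.1# Z.* u Z.≈ u
  *-identityˡZ u = ⟪⟫≈⇒≈ {Z.1# Z.* u} {u} λ {F} resp → trans (⟪⟫-mul Z.1# u F)
    (trans (+-identityʳ _) (trans (*-identityˡ _)
      (⟪⟫-cong u λ I → indicator-yes (disjoint? [] I) λ ())))

  *-distribˡZ : ∀ u v w → u Z.* (v ++ w) Z.≈ u Z.* v ++ u Z.* w
  *-distribˡZ u v w = ⟪⟫≈⇒≈ {u Z.* (v ++ w)} {u Z.* v ++ u Z.* w} λ {F} resp → begin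
    ⟪ u Z.* (v ++ w) , F ⟫
      ≈⟨ ⟪⟫-mul u (v ++ w) F ⟩
    ⟪ u , (λ I → ⟪ v ++ w , translate F I ⟫) ⟫
      ≈⟨ ⟪⟫-cong u (λ I → ⟪⟫-++ v w (translate F I)) ⟩
    ⟪ u , (λ I → ⟪ v , translate F I ⟫ + ⟪ w , translate F I ⟫) ⟫
      ≈⟨ ⟪⟫-+ u _ _ ⟩
    ⟪ u , (λ I → ⟪ v , translate F I ⟫) ⟫ + ⟪ u , (λ I → ⟪ w , translate F I ⟫) ⟫
      ≈⟨ +-cong (⟪⟫-mul u v F) (⟪⟫-mul u w F) ⟨
    ⟪ u Z.* v , F ⟫ + ⟪ u Z.* w , F ⟫
      ≈⟨ ⟪⟫-++ (u Z.* v) (u Z.* w) F ⟨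
    ⟪ u Z.* v ++ u Z.* w , F ⟫ ∎

  ++-commZ : ∀ u v → u ++ v Z.≈ v ++ u
  ++-commZ u v = ⟪⟫≈⇒≈ {u ++ v} {v ++ u} λ {F} resp →
    trans (⟪⟫-++ u v F) (trans (+-comm _ _) (sym (⟪⟫-++ v u F)))

  neg-inverseˡ : ∀ u → Z.- u ++ u Z.≈ []
  neg-inverseˡ u = ⟪⟫≈⇒≈ {Z.- u ++ u} {[]} λ {F} resp →
    trans (⟪⟫-++ (Z.- u) u F) (trans (+-congʳ (⟪⟫-neg u F)) (-‿inverseˡ _))

  commutativeRing : CommutativeRing 0ℓ 0ℓ
  commutativeRing = record
    { Carrier = Zeon
    ; _≈_ = Z._≈_
    ; _+_ = Z._+_
    ; _*_ = Z._*_
    ; -_  = Z.-_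
    ; 0#  = Z.0#
    ; 1#  = Z.1#
    ; isCommutativeRing = record
      { isRing = record
        { +-isAbelianGroup = record
          { isGroup = record
            { isMonoid = record
              { isSemigroup = record
                { isMagma = record
                  { isEquivalence = record
                    { refl  = λ I → refl
                    ; sym   = λ eq I → sym (eq I)
                    ; trans = λ eq eq′ I → trans (eq I) (eq′ I)
                    }
                  ; ∙-cong = λ {u} {u′} {v} {v′} → ++-cong {u} {u′} {v} {v′}
                  }
                ; assoc = λ u v w I → reflexive (≡.cong (λ x → coefficient x I) (++-assoc u v w))
                }
              ; identity = (λ u I → refl) ,
                  λ u I → reflexive (≡.cong (λ x → coefficient x I) (++-identityʳ u))
              }
            ; inverse = neg-inverseˡ , λ u I → trans (++-commZ u (Z.- u) I) (neg-inverseˡ u I)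
            ; ⁻¹-cong = λ {u} {v} → neg-cong {u} {v}
            }
          ; comm = ++-commZ
          }
        ; *-cong = λ {u} {u′} {v} {v′} → *-congZ {u} {u′} {v} {v′}
        ; *-assoc = *-assocZ
        ; *-identity = *-identityˡZ , λ u I → trans (*-commZ u Z.1# I) (*-identityˡZ u I)
        ; distrib = *-distribˡZ , λ u v w I → trans (*-commZ (v ++ w) u I)
            (trans (*-distribˡZ u v w I)
              (++-cong {u Z.* v} {v Z.* u} {u Z.* w} {w Z.* u} (*-commZ u v) (*-commZ u w) I))
        }
      ; *-comm = *-commZ
      }
    }

  scalarPart-homo : PreservesOperations (Zeons.rawRing rawRing) R scalarPart
  scalarPart-homo = record
    { +-homo  = λ u v → trans (part (u ++ v)) (trans (⟪⟫-++ u v _) (sym (+-cong (part u) (part v))))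
    ; *-homo  = λ u v → begin
        scalarPart (u Z.* v)
          ≈⟨ trans (part (u Z.* v)) (⟪⟫-mul u v (δ [])) ⟩
        ⟪ u , (λ I → ⟪ v , translate (δ []) I ⟫) ⟫
          ≈⟨ ⟪⟫-cong u (λ I → trans (⟪⟫-cong v (split I)) (trans (⟪⟫-* (δ [] I) v (δ [])) (*-comm _ _))) ⟩
        ⟪ u , (λ I → ⟪ v , δ [] ⟫ * δ [] I) ⟫
          ≈⟨ trans (⟪⟫-* _ u (δ [])) (*-comm _ _) ⟩
        ⟪ u , δ [] ⟫ * ⟪ v , δ [] ⟫
          ≈⟨ *-cong (part u) (part v) ⟨
        scalarPart u * scalarPart v ∎
    ; -‿homo  = λ u → trans (part (Z.- u)) (trans (⟪⟫-neg u _) (-‿cong (sym (part u))))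
    ; 0#-homo = refl
    ; 1#-homo = +-identityʳ 1#
    }
    where
    part : ∀ u → scalarPart u ≈ ⟪ u , δ [] ⟫
    part u = coefficient≈⟪δ⟫ u []
    -- A union is empty exactly when both sets are, and empty sets are disjoint; this makes the
    -- scalar part multiplicative.
    split : ∀ I J → translate (δ []) I J ≈ δ [] I * δ [] J
    split []      []      = sym (*-identityˡ 1#)
    split []      (j ∷ J) = trans (trans (indicator-yes (disjoint? [] (j ∷ J)) λ ())
      (indicator-no ((j ∷ J) ≐? []) {1#} nonempty))
      (sym (trans (*-congˡ (indicator-no ((j ∷ J) ≐? []) {1#} nonempty)) (zeroʳ _)))
      where
      nonempty : ¬ (j ∷ J ≐ [])
      nonempty (p , _) with () ← p (here ≡.refl)
    split (i ∷ I) J = trans (vanish (disjoint? (i ∷ I) J))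
      (sym (trans (*-congʳ (indicator-no ((i ∷ I) ≐? []) {1#} nonempty)) (zeroˡ _)))
      where
      nonempty : ∀ {K} → ¬ (i ∷ K ≐ [])
      nonempty (p , _) with () ← p (here ≡.refl)
      vanish : ∀ {P : Set} (P? : Dec P) → indicator P? (δ [] (i ∷ I ++ J)) ≈ 0#
      vanish (yes _) = indicator-no ((i ∷ I ++ J) ≐? []) {1#} nonempty
      vanish (no _)  = refl

  scalar-homo : PreservesOperations rawRing commutativeRing scalar
  scalar-homo = record
    { +-homo  = λ a b → ⟪⟫≈⇒≈ {scalar (a + b)} {scalar a ++ scalar b} λ {F} _ →
        trans (+-congʳ (distribʳ (F []) a b)) (+-assoc _ _ _)
    ; *-homo  = λ a b I → refl
    ; -‿homo  = λ a I → refl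
    ; 0#-homo = ⟪⟫≈⇒≈ {scalar 0#} {[]} λ {F} _ → trans (+-identityʳ _) (zeroˡ (F []))
    ; 1#-homo = λ I → refl
    }

  term-cong : ∀ {a b I J} → a ≈ b → I ≐ J → term a I Z.≈ term b J
  term-cong {a} {b} {I} {J} a≈b I≐J =
    ⟪⟫≈⇒≈ {term a I} {term b J} λ resp → +-congʳ (*-cong a≈b (resp I≐J))

  term-* : ∀ {a b I J} → Disjoint I J → term a I Z.* term b J Z.≈ term (a * b) (I ++ J)
  term-* {a} {b} {I} {J} I#J K = reflexive (≡.cong
    (λ c → coefficient (((if c then term (a * b) (I ++ J) else []) ++ []) ++ []) K)
    (dec-true (disjoint? I J) I#J))

  term-*-null : ∀ {a b I J} → ¬ Disjoint I J → term a I Z.* term b J Z.≈ []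
  term-*-null {a} {b} {I} {J} ¬I#J K = reflexive (≡.cong
    (λ c → coefficient (((if c then term (a * b) (I ++ J) else []) ++ []) ++ []) K)
    (dec-false (disjoint? I J) ¬I#J))

  -- Only the empty set is disjoint from {i} and has union {i} with it. Thus the coefficient of
  -- ζ_{i} reads off the infinitesimal part when ζ_{i} serves as the infinitesimal.
  coefficient-ζ* : ∀ i u → coefficient (ζ [ i ] Z.* u) [ i ] ≈ scalarPart u
  coefficient-ζ* i u = begin
    coefficient (ζ [ i ] Z.* u) [ i ]
      ≈⟨ trans (coefficient≈⟪δ⟫ (ζ [ i ] Z.* u) [ i ]) (⟪⟫-mul (ζ [ i ]) u (δ [ i ])) ⟩
    1# * ⟪ u , translate (δ [ i ]) [ i ] ⟫ + 0#
      ≈⟨ trans (+-identityʳ _) (*-identityˡ _) ⟩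
    ⟪ u , translate (δ [ i ]) [ i ] ⟫
      ≈⟨ ⟪⟫-cong u only-empty ⟩
    ⟪ u , δ [] ⟫
      ≈⟨ coefficient≈⟪δ⟫ u [] ⟨
    scalarPart u ∎
    where
    only-empty : ∀ J → translate (δ [ i ]) [ i ] J ≈ δ [] J
    only-empty [] = trans (indicator-yes (disjoint? [ i ] []) λ ())
      (indicator-yes ([ i ] ≐? [ i ]) (⊆-refl , ⊆-refl))
    only-empty (j ∷ J) = trans (vanish (disjoint? [ i ] (j ∷ J)))
      (sym (indicator-no ((j ∷ J) ≐? []) {1#} λ { (p , _) → contradiction (p (here ≡.refl)) λ () }))
      where
      vanish : (d? : Dec (Disjoint [ i ] (j ∷ J))) → indicator d? (δ [ i ] (i ∷ j ∷ J)) ≈ 0#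
      vanish (no _)  = refl
      -- A union equal to {i} would force `j` to be `i`, against disjointness.
      vanish (yes d) = indicator-no ((i ∷ j ∷ J) ≐? [ i ]) {1#}
        λ (p , _) → case-j (p (there (here ≡.refl)))
        where
        case-j : ¬ (j ∈ [ i ])
        case-j (here ≡.refl) = d (here ≡.refl , here ≡.refl)

-- Walks and eigenvectors

-- A list of length l is the interior of a walk with l + 1 edges, so these lists describe the walks
-- with at most `n` edges.
listsShorterThan : ∀ m → ℕ → List (List (Fin m))
listsShorterThan m zero    = []
listsShorterThan m (suc n) = [] ∷ cartesianProductWith _∷_ (allFin m) (listsShorterThan m n)

module ListSums (R : CommutativeRing 0ℓ 0ℓ) where
  open CommutativeRing R hiding (zero)
  open Algebra.Properties.Ring ring using (-0#≈0#; -‿+-comm)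
  open FiniteSums R using (sum)

  ∑ : ∀ {A : Set} → List A → (A → Carrier) → Carrier
  ∑ xs f = foldr _+_ 0# (map f xs)

  module _ {A : Set} where

    ∑-cong : ∀ (xs : List A) {f g} → (∀ x → x ∈ xs → f x ≈ g x) → ∑ xs f ≈ ∑ xs g
    ∑-cong []       eq = refl
    ∑-cong (x ∷ xs) eq = +-cong (eq x (here ≡.refl)) (∑-cong xs λ y y∈xs → eq y (there y∈xs))

    ∑-zero : ∀ (xs : List A) {f} → (∀ x → x ∈ xs → f x ≈ 0#) → ∑ xs f ≈ 0#
    ∑-zero []       eq = refl
    ∑-zero (x ∷ xs) eq =
      trans (+-cong (eq x (here ≡.refl)) (∑-zero xs λ y y∈xs → eq y (there y∈xs))) (+-identityˡ 0#)

    ∑-++ : ∀ (xs ys : List A) f → ∑ (xs ++ ys) f ≈ ∑ xs f + ∑ ys f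
    ∑-++ []       ys f = sym (+-identityˡ _)
    ∑-++ (x ∷ xs) ys f = trans (+-congˡ (∑-++ xs ys f)) (sym (+-assoc _ _ _))

    ∑-+ : ∀ (xs : List A) f g → ∑ xs (λ x → f x + g x) ≈ ∑ xs f + ∑ xs g
    ∑-+ []       f g = sym (+-identityˡ 0#)
    ∑-+ (x ∷ xs) f g = trans (+-congˡ (∑-+ xs f g)) (trans (+-assoc _ _ _)
      (trans (+-congˡ (trans (sym (+-assoc _ _ _)) (trans (+-congʳ (+-comm _ _)) (+-assoc _ _ _))))
        (sym (+-assoc _ _ _))))

    ∑-neg : ∀ (xs : List A) f → - ∑ xs f ≈ ∑ xs (λ x → - f x)
    ∑-neg []       f = -0#≈0#
    ∑-neg (x ∷ xs) f = trans (sym (-‿+-comm _ _)) (+-congˡ (∑-neg xs f))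

    *-distribˡ-∑ : ∀ c (xs : List A) f → c * ∑ xs f ≈ ∑ xs (λ x → c * f x)
    *-distribˡ-∑ c []       f = zeroʳ c
    *-distribˡ-∑ c (x ∷ xs) f = trans (distribˡ c _ _) (+-congˡ (*-distribˡ-∑ c xs f))

    ∑-filter : ∀ {P : Pred A 0ℓ} (P? : Decidable P) (xs : List A) {f} → (∀ x → x ∈ xs → ¬ P x → f x ≈ 0#) →
      ∑ (filter P? xs) f ≈ ∑ xs f
    ∑-filter P? []       vanish = refl
    ∑-filter P? (x ∷ xs) vanish with rest ← ∑-filter P? xs (λ y y∈xs → vanish y (there y∈xs)) with P? x
    ... | yes _ = +-congˡ rest
    ... | no ¬p = trans rest (sym (trans (+-congʳ (vanish x (here ≡.refl) ¬p)) (+-identityˡ _)))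

    ∑-map : ∀ {B : Set} (h : B → A) (xs : List B) f → ∑ (map h xs) f ≈ ∑ xs (f ∘ h)
    ∑-map h []       f = refl
    ∑-map h (x ∷ xs) f = +-congˡ (∑-map h xs f)

    ∑-tabulate : ∀ n (g : Fin n → A) f → sum (λ i → f (g i)) ≈ ∑ (tabulate g) f
    ∑-tabulate zero    g f = refl
    ∑-tabulate (suc n) g f = +-congˡ (∑-tabulate n (g ∘ suc) f)

  ∑-cartesianProductWith : ∀ {A B C : Set} (h : A → B → C) xs ys f →
    ∑ (cartesianProductWith h xs ys) f ≈ ∑ xs (λ x → ∑ ys (λ y → f (h x y)))
  ∑-cartesianProductWith h []       ys f = refl
  ∑-cartesianProductWith h (x ∷ xs) ys f = trans (∑-++ (map (h x) ys) _ f)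
    (+-cong (∑-map (h x) ys f) (∑-cartesianProductWith h xs ys f))

  -- Interchange of summation: the filters are turned into indicators, and the hypothesis evaluates
  -- the sum over `ys` for each fixed `x`. When every `x` is related to a single `y`, this groups a
  -- sum by fibres.
  ∑-fibres : ∀ {A B : Set} {_∼_ : A → B → Set} (_∼?_ : ∀ x y → Dec (x ∼ y))
    (xs : List A) (ys : List B) (f : A → B → Carrier) {g} →
    (∀ x → x ∈ xs → ∑ ys (λ y → if does (x ∼? y) then f x y else 0#) ≈ g x) →
    ∑ ys (λ y → ∑ (filter (_∼? y) xs) (λ x → f x y)) ≈ ∑ xs g
  ∑-fibres _∼?_ []       ys f eq = ∑-zero ys λ _ _ → refl
  ∑-fibres _∼?_ (x ∷ xs) ys f eq = trans
    (∑-cong ys λ y _ → split y)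
    (trans (∑-+ ys _ _) (+-cong (eq x (here ≡.refl)) (∑-fibres _∼?_ xs ys f λ z z∈xs → eq z (there z∈xs))))
    where
    split : ∀ y → ∑ (filter (_∼? y) (x ∷ xs)) (λ z → f z y)
      ≈ (if does (x ∼? y) then f x y else 0#) + ∑ (filter (_∼? y) xs) (λ z → f z y)
    split y with does (x ∼? y)
    ... | true  = refl
    ... | false = sym (+-identityˡ _)

  ∑-delta : ∀ {B : Set} {y : B} (y≟ : ∀ z → Dec (y ≡ z)) {ys} → Unique ys → y ∈ ys → ∀ (f : B → Carrier) →
    ∑ ys (λ z → if does (y≟ z) then f z else 0#) ≈ f y
  ∑-delta y≟ {z ∷ ys} (z∉ys ∷ u) y∈ f with y≟ z
  ... | yes ≡.refl = trans (+-congˡ (∑-zero ys others)) (+-identityʳ _)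
    where
    others : ∀ w → w ∈ ys → (if does (y≟ w) then f w else 0#) ≈ 0#
    others w w∈ys with y≟ w
    ... | yes ≡.refl = contradiction ≡.refl (All.lookup z∉ys w∈ys)
    ... | no _       = refl
  ... | no y≢z with y∈
  ...   | here y≡z   = contradiction y≡z y≢z
  ...   | there y∈ys = trans (+-identityˡ _) (∑-delta y≟ u y∈ys f)

-- Eigenvalues as zeros of the characteristic polynomial.

module CharacteristicRoots (R : CommutativeRing 0ℓ 0ℓ) where
  open CommutativeRing R hiding (zero)
  open Matrices rawRing
  open Polynomials rawRing using (eval)
  open FiniteSums R
  open Algebra.Properties.Ring ring using (-‿distribˡ-*)
  open Relation.Binary.Reasoning.Setoid setoid

  id-homo : PreservesOperations rawRing R id
  id-homo = record
    { +-homo  = λ _ _ → refl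
    ; *-homo  = λ _ _ → refl
    ; -‿homo  = λ _ → refl
    ; 0#-homo = refl
    ; 1#-homo = refl
    }

  diag-· : ∀ {m} (x ξ : Vector Carrier m) i → (diag x · ξ) i ≈ x i * ξ i
  diag-· {m} x ξ i = trans (sum-single i off) on
    where
    off : ∀ j → j ≢ i → diag x i j * ξ j ≈ 0#
    off j j≢i with i Fin.≟ j
    ... | yes ≡.refl = contradiction ≡.refl j≢i
    ... | no _       = zeroˡ _
    on : diag x i i * ξ i ≈ x i * ξ i
    on with i Fin.≟ i
    ... | yes _  = refl
    ... | no i≢i = contradiction ≡.refl i≢i

  ⊖-· : ∀ {m} (M N : Matrix m) ξ i → ((M ⊖ N) · ξ) i ≈ (M · ξ) i - (N · ξ) i
  ⊖-· {m} M N ξ i = begin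
    sum (λ j → (M i j - N i j) * ξ j)
      ≈⟨ sum-cong m (λ j → trans (distribʳ _ _ _) (+-congˡ (sym (-‿distribˡ-* _ _)))) ⟩
    sum (λ j → M i j * ξ j - N i j * ξ j)
      ≈⟨ sum-+ m _ _ ⟩
    sum (λ j → M i j * ξ j) + sum (λ j → - (N i j * ξ j))
      ≈⟨ +-congˡ (sum-neg m _) ⟨
    (M · ξ) i - (N · ξ) i ∎

  eigenvalue-root : ∀ {m} (M : Matrix m) c ξ k → ξ k ≈ 1# → (∀ i → (M · ξ) i ≈ c * ξ i) →
    eval (charPoly rawRing M) c ≈ 0#
  eigenvalue-root {m} M c ξ k ξk≈1 eigen = begin
    eval (charPoly rawRing M) c
      ≡⟨ ≡.cong (λ p → eval p c) (map-id (charPoly rawRing M)) ⟨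
    eval (map id (charPoly rawRing M)) c
      ≈⟨ EvaluationHomo.ev-charPoly R id-homo c {m} {M} (λ i j → refl) ⟩
    det (diag (λ _ → c) ⊖ M)
      ≈⟨ Determinants.det-singular R (diag (λ _ → c) ⊖ M) ξ k ξk≈1 (λ i →
           trans (⊖-· (diag λ _ → c) M ξ i)
             (trans (+-cong (diag-· (λ _ → c) ξ i) (-‿cong (eigen i))) (-‿inverseʳ _))) ⟩
    0# ∎

module Eigenvectors (R : CommutativeRing 0ℓ 0ℓ) {m : ℕ}
  (ψ : Matrices.Matrix (CommutativeRing.rawRing R) m)
  (x a : Vector (CommutativeRing.Carrier R) m) (k : Fin m) where
  open CommutativeRing R hiding (zero)
  open Matrices rawRing
  open CharacteristicRoots R
  open FiniteSums R
  open ListSums R using (∑)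
  open Algebra.Properties.Ring ring using (-‿distribˡ-*; -1*x≈-x; -0#≈0#)
  open Relation.Binary.Reasoning.Setoid setoid

  step : Vector Carrier m → Vector Carrier m
  step X i = sum λ j → ψ i j * (a j * X j)

  -- walks n i is the generating function of the walks from i to k with at most n edges,
  -- longest n i that of the walks with exactly n + 1 edges.
  walks longest : ℕ → Vector Carrier m
  walks zero    i = 0#
  walks (suc n) i = ψ i k + step (walks n) i
  longest zero    i = ψ i k
  longest (suc n) i = step (longest n) i

  -- The definition peels off the first edge of a walk; here the increment is isolated instead. Once
  -- `longest m` vanishes, `walks m` is a fixed point of the recursion.
  walks-suc : ∀ n i → walks (suc n) i ≈ walks n i + longest n i
  walks-suc zero    i = trans
    (+-congˡ (sum-zero {m} λ j → trans (*-congˡ (zeroʳ (a j))) (zeroʳ (ψ i j)))) (+-comm _ _)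
  walks-suc (suc n) i = begin
    ψ i k + step (walks (suc n)) i
      ≈⟨ +-congˡ (sum-cong m λ j →
           trans (*-congˡ (trans (*-congˡ (walks-suc n j)) (distribˡ _ _ _))) (distribˡ _ _ _)) ⟩
    ψ i k + sum (λ j → ψ i j * (a j * walks n j) + ψ i j * (a j * longest n j))
      ≈⟨ +-congˡ (sum-+ m _ _) ⟩
    ψ i k + (step (walks n) i + step (longest n) i)
      ≈⟨ +-assoc _ _ _ ⟨
    ψ i k + step (walks n) i + step (longest n) i ∎

  -- Every walk ends with an edge into `k`, so `walks n i` is a combination of the entries `ψ j k`.
  walks-annihilate : ∀ z → (∀ i → z * ψ i k ≈ 0#) → ∀ n i → z * walks n i ≈ 0#
  walks-annihilate z zψ≈0 zero    i = zeroʳ z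
  walks-annihilate z zψ≈0 (suc n) i = begin
    z * (ψ i k + step (walks n) i)
      ≈⟨ trans (distribˡ z _ _) (+-cong (zψ≈0 i) (*-distribˡ-∑ m z _)) ⟩
    0# + sum (λ j → z * (ψ i j * (a j * walks n j)))
      ≈⟨ trans (+-identityˡ _) (sum-zero λ j → trans (exchange z (ψ i j) (a j) (walks n j))
           (trans (*-congˡ (walks-annihilate z zψ≈0 n j)) (zeroʳ _))) ⟩
    0# ∎
    where
    exchange : ∀ z p a w → z * (p * (a * w)) ≈ (p * a) * (z * w)
    exchange z p a w = trans (*-congˡ (sym (*-assoc p a w))) (trans (sym (*-assoc _ _ _))
      (trans (*-congʳ (*-comm z _)) (*-assoc _ _ _)))

  δₖ : Vector Carrier m
  δₖ i = if does (i Fin.≟ k) then 1# else 0#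

  δₖ-yes : δₖ k ≈ 1#
  δₖ-yes with k Fin.≟ k
  ... | yes _  = refl
  ... | no k≢k = contradiction ≡.refl k≢k

  δₖ-no : ∀ {i} → i ≢ k → δₖ i ≈ 0#
  δₖ-no {i} i≢k with i Fin.≟ k
  ... | yes i≡k = contradiction i≡k i≢k
  ... | no _    = refl

  eigenvalue : Carrier
  eigenvalue = x k - walks m k

  eigenvector : Vector Carrier m
  eigenvector i = δₖ i + a i * walks m i

  module _ (a-k : a k ≈ 0#) where

    eigenvector-k : eigenvector k ≈ 1#
    eigenvector-k = trans (+-cong δₖ-yes (trans (*-congʳ a-k) (zeroˡ _))) (+-identityʳ 1#)

    -- Applying `ψ` performs one more step of the recursion: the `δₖ` part of the eigenvector
    -- supplies the one-edge walks, the rest supplies `step (walks m)`.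
    ψ-eigenvector : (∀ i → longest m i ≈ 0#) → ∀ i → (ψ · eigenvector) i ≈ walks m i
    ψ-eigenvector nilpotent i = begin
      sum (λ j → ψ i j * (δₖ j + a j * walks m j))
        ≈⟨ sum-cong m (λ j → distribˡ _ _ _) ⟩
      sum (λ j → ψ i j * δₖ j + ψ i j * (a j * walks m j))
        ≈⟨ sum-+ m _ _ ⟩
      sum (λ j → ψ i j * δₖ j) + step (walks m) i
        ≈⟨ +-congʳ (sum-single k λ j j≢k → trans (*-congˡ (δₖ-no j≢k)) (zeroʳ _)) ⟩
      ψ i k * δₖ k + step (walks m) i
        ≈⟨ +-congʳ (trans (*-congˡ δₖ-yes) (*-identityʳ _)) ⟩
      walks (suc m) i
        ≈⟨ trans (walks-suc m i) (trans (+-congˡ (nilpotent i)) (+-identityʳ _)) ⟩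
      walks m i ∎

    module _ (a-inverse : ∀ i → i ≢ k → (x k - x i) * a i ≈ - 1#)
      (ψψ≈0 : ∀ i j → ψ i k * ψ j k ≈ 0#)
      (nilpotent : ∀ i → longest m i ≈ 0#) where

      -- Annihilation used twice: each `ψ j k` kills `walks m k`, so `walks m k` kills each `ψ j k`
      -- and with them every `walks m i`.
      walks-k : ∀ i → walks m k * walks m i ≈ 0#
      walks-k i = walks-annihilate (walks m k) (λ j →
        trans (*-comm _ _) (walks-annihilate (ψ j k) (ψψ≈0 j) m k)) m i

      eigen : ∀ i → ((diag x ⊖ ψ) · eigenvector) i ≈ eigenvalue * eigenvector i
      eigen i = trans (⊖-· (diag x) ψ eigenvector i)
        (trans (+-cong (diag-· x eigenvector i) (-‿cong (ψ-eigenvector nilpotent i))) (row i))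
        where
        row : ∀ i → x i * eigenvector i - walks m i ≈ eigenvalue * eigenvector i
        row i with i Fin.≟ k
        ... | yes ≡.refl = begin
          x k * (1# + a k * walks m k) - walks m k
            ≈⟨ +-congʳ (trans (*-congˡ one) (*-identityʳ _)) ⟩
          x k - walks m k
            ≈⟨ trans (*-congˡ one) (*-identityʳ _) ⟨
          (x k - walks m k) * (1# + a k * walks m k) ∎
          where
          one : 1# + a k * walks m k ≈ 1#
          one = trans (+-congˡ (trans (*-congʳ a-k) (zeroˡ _))) (+-identityʳ 1#)
        ... | no i≢k = begin
          x i * (0# + y) - w
            ≈⟨ +-congʳ (*-congˡ (+-identityˡ y)) ⟩
          x i * y - w
            ≈⟨ +-congˡ (-1*x≈-x w) ⟨
          x i * y + - 1# * w
            -- The choice of `a i` turns the term `- w` into `(x k - x i) * y`, which raises the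
            -- factor `x i` to `x k`.
            ≈⟨ +-congˡ (*-congʳ (a-inverse i i≢k)) ⟨
          x i * y + (x k - x i) * a i * w
            ≈⟨ +-congˡ (*-assoc _ _ _) ⟩
          x i * y + (x k - x i) * y
            ≈⟨ distribʳ y (x i) (x k - x i) ⟨
          (x i + (x k - x i)) * y
            ≈⟨ *-congʳ (trans (+-comm _ _) (trans (+-assoc _ _ _)
                 (trans (+-congˡ (-‿inverseˡ _)) (+-identityʳ _)))) ⟩
          x k * y
            ≈⟨ +-identityʳ _ ⟨
          x k * y + 0#
            -- The missing correction `walks m k * y` is quadratic in the walks and vanishes by
            -- `walks-k`.
            ≈⟨ +-congˡ (trans (-‿cong wy≈0) -0#≈0#) ⟨
          x k * y - walks m k * y
            ≈⟨ trans (+-congˡ (-‿distribˡ-* _ _)) (sym (distribʳ y _ _)) ⟩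
          (x k - walks m k) * y
            ≈⟨ *-congˡ (+-identityˡ y) ⟨
          (x k - walks m k) * (0# + y) ∎
          where
          w y : Carrier
          w = walks m i
          y = a i * w
          wy≈0 : walks m k * y ≈ 0#
          wy≈0 = trans (sym (*-assoc _ _ _)) (trans (*-congʳ (*-comm _ _))
            (trans (*-assoc _ _ _) (trans (*-congˡ (walks-k i)) (zeroʳ _))))

  weight : Fin m → List (Fin m) → Carrier
  weight i []      = ψ i k
  weight i (j ∷ p) = ψ i j * (a j * weight j p)

  walks≈∑ : ∀ n i → walks n i ≈ ∑ (listsShorterThan m n) (weight i)
  walks≈∑ zero    i = refl
  walks≈∑ (suc n) i = +-congˡ (begin
    sum (λ j → ψ i j * (a j * walks n j))
      ≈⟨ sum-cong m (λ j → trans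
           (*-congˡ (trans (*-congˡ (walks≈∑ n j)) (L.*-distribˡ-∑ (a j) (listsShorterThan m n) (weight j))))
           (L.*-distribˡ-∑ (ψ i j) (listsShorterThan m n) _)) ⟩
    sum (λ j → ∑ (listsShorterThan m n) (λ p → weight i (j ∷ p)))
      ≈⟨ L.∑-tabulate m id _ ⟩
    ∑ (allFin m) (λ j → ∑ (listsShorterThan m n) (λ p → weight i (j ∷ p)))
      ≈⟨ L.∑-cartesianProductWith _∷_ (allFin m) (listsShorterThan m n) (weight i) ⟨
    ∑ (cartesianProductWith _∷_ (allFin m) (listsShorterThan m n)) (weight i) ∎)
    where module L = ListSums R

∘-homo : ∀ {A : RawRing 0ℓ 0ℓ} {S T : CommutativeRing 0ℓ 0ℓ} {f g} →
  (∀ {x y} → CommutativeRing._≈_ S x y → CommutativeRing._≈_ T (g x) (g y)) →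
  PreservesOperations (CommutativeRing.rawRing S) T g → PreservesOperations A S f →
  PreservesOperations A T (g ∘ f)
∘-homo {T = T} g-cong g-homo f-homo = record
  { +-homo  = λ x y → trans (g-cong (F.+-homo x y)) (G.+-homo _ _)
  ; *-homo  = λ x y → trans (g-cong (F.*-homo x y)) (G.*-homo _ _)
  ; -‿homo  = λ x → trans (g-cong (F.-‿homo x)) (G.-‿homo _)
  ; 0#-homo = trans (g-cong F.0#-homo) G.0#-homo
  ; 1#-homo = trans (g-cong F.1#-homo) G.1#-homo
  }
  where
  module F = PreservesOperations f-homo
  module G = PreservesOperations g-homo
  open CommutativeRing T using (trans)

-- Simplicity of zeros by means of an infinitesimal.

module SimpleRoots (R Z : CommutativeRing 0ℓ 0ℓ) where
  private
    module R = CommutativeRing R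
    module Z = CommutativeRing Z

  -- Z is an R-algebra with augmentation 𝔠; ε is an infinitesimal and ∂ its coefficient.
  module Augmented (1≉0 : ¬ (R.1# R.≈ R.0#))
    {𝔠 : Z.Carrier → R.Carrier} (𝔠-homo : PreservesOperations Z.rawRing R 𝔠)
    (𝔠-cong : ∀ u v → u Z.≈ v → 𝔠 u R.≈ 𝔠 v)
    {ι : R.Carrier → Z.Carrier} (ι-homo : PreservesOperations R.rawRing Z ι)
    (ι-cong : ∀ {a b} → a R.≈ b → ι a Z.≈ ι b)
    (𝔠∘ι : ∀ a → 𝔠 (ι a) R.≈ a)
    {ε : Z.Carrier} (ε²≈0 : ε Z.* ε Z.≈ Z.0#) (𝔠ε≈0 : 𝔠 ε R.≈ R.0#)
    {∂ : Z.Carrier → R.Carrier} (∂-cong : ∀ u v → u Z.≈ v → ∂ u R.≈ ∂ v)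
    (∂-+ : ∀ u v → ∂ (u Z.+ v) R.≈ ∂ u R.+ ∂ v)
    (∂∘ι : ∀ a → ∂ (ι a) R.≈ R.0#)
    (∂ε* : ∀ u → ∂ (ε Z.* u) R.≈ 𝔠 u)
    where
    private
      module 𝔠 = PreservesOperations 𝔠-homo
      module ι = PreservesOperations ι-homo
      module MR = Matrices R.rawRing
      module MZ = Matrices Z.rawRing
      module QR = PolynomialRoots R
      module QZ = PolynomialRoots Z

    -- An explicit inverse passes to products, whereas a product of elements that are merely nonzero
    -- may vanish in a general ring.
    Unit : R.Carrier → Set
    Unit a = ∃[ b ] (a R.* b R.≈ R.1#)

    Unit-cong : ∀ {a b} → a R.≈ b → Unit a → Unit b
    Unit-cong a≈b (c , ac≈1) = c , R.trans (R.*-congʳ (R.sym a≈b)) ac≈1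

    Unit-* : ∀ {a b} → Unit a → Unit b → Unit (a R.* b)
    Unit-* {a} {b} (a′ , p) (b′ , q) = a′ R.* b′ , (begin
      (a R.* b) R.* (a′ R.* b′)
        ≈⟨ solve 4 (λ a b a′ b′ → (a :* b) :* (a′ :* b′) := (a :* a′) :* (b :* b′)) R.refl a b a′ b′ ⟩
      (a R.* a′) R.* (b R.* b′)
        ≈⟨ R.*-cong p q ⟩
      R.1# R.* R.1#
        ≈⟨ R.*-identityˡ R.1# ⟩
      R.1# ∎)
      where
      open Relation.Binary.Reasoning.Setoid R.setoid
      open import Algebra.Solver.Ring.NaturalCoefficients.Default R.commutativeSemiring

    Unit⇒≉0 : ∀ {a} → Unit a → ¬ (a R.≈ R.0#)
    Unit⇒≉0 (b , ab≈1) a≈0 = 1≉0 (R.trans (R.sym ab≈1) (R.trans (R.*-congʳ a≈0) (R.zeroˡ b)))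

    module _ {m} (M : MZ.Matrix m) (x : Vector R.Carrier m) (k : Fin m)
      (𝔠M : ∀ i j → 𝔠 (M i j) R.≈ MR.diag x i j)
      (separated : ∀ i → i ≢ k → Unit (x k R.- x i))
      where

      private
        χ  = charPoly Z.rawRing M
        χ′ = map 𝔠 χ
        open Polynomials R.rawRing renaming (eval to evalR) hiding (rawRing)
        open Polynomials Z.rawRing renaming (eval to evalZ) hiding (rawRing)

        c : R.Carrier
        c = x k

        -- The derivative of `χ′` at `c`, as the value there of the quotient by X - c.
        D : R.Carrier
        D = evalR (QR.quotient χ′ c) c

        -- `N` is the matrix of scalar parts, embedded again into `Z`; `T` is its characteristic
        -- matrix at `ι c + ε`, diagonal with entry `ε` at `k`.
        N T : MZ.Matrix m
        N i j = ι (MR.diag x i j)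
        T = MZ._⊖_ (MZ.diag λ _ → ι c Z.+ ε) N

        T-diagonal : ∀ i → T i i Z.≈ (ι c Z.+ ε) Z.- ι (x i)
        T-diagonal i with i Fin.≟ i
        ... | yes _  = Z.refl
        ... | no i≢i = contradiction ≡.refl i≢i

        T-off-diagonal : ∀ i j → i ≢ j → T i j Z.≈ Z.0#
        T-off-diagonal i j i≢j with i Fin.≟ j
        ... | yes i≡j = contradiction i≡j i≢j
        ... | no _    = Z.trans (Z.+-congˡ (Z.-‿cong ι.0#-homo)) (Z.-‿inverseʳ Z.0#)

        T-unit : ∀ i → i ≢ k → Unit (𝔠 (T i i))
        T-unit i i≢k = Unit-cong (R.sym (begin
          𝔠 (T i i)
            ≈⟨ 𝔠-cong _ _ (T-diagonal i) ⟩
          𝔠 ((ι c Z.+ ε) Z.- ι (x i))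
            ≈⟨ R.trans (𝔠.+-homo _ _) (R.+-cong (𝔠.+-homo _ _) (𝔠.-‿homo _)) ⟩
          (𝔠 (ι c) R.+ 𝔠 ε) R.- 𝔠 (ι (x i))
            ≈⟨ R.+-cong (R.trans (R.+-cong (𝔠∘ι c) 𝔠ε≈0) (R.+-identityʳ c)) (R.-‿cong (𝔠∘ι (x i))) ⟩
          c R.- x i ∎)) (separated i i≢k)
          where open Relation.Binary.Reasoning.Setoid R.setoid

        T-k : T k k Z.≈ ε
        T-k = Z.trans (T-diagonal k) (Z.trans (Z.+-congʳ (Z.+-comm _ _))
          (Z.trans (Z.+-assoc _ _ _) (Z.trans (Z.+-congˡ (Z.-‿inverseʳ _)) (Z.+-identityʳ ε))))

        expansion : evalZ (map (ι ∘ 𝔠) χ) (ι c Z.+ ε) Z.≈ ι (evalR χ′ c) Z.+ ε Z.* ι D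
        expansion = begin
          evalZ (map (ι ∘ 𝔠) χ) (ι c Z.+ ε)
            ≡⟨ ≡.cong (λ p → evalZ p (ι c Z.+ ε)) (map-∘ χ) ⟩
          evalZ (map ι χ′) (ι c Z.+ ε)
            ≈⟨ QZ.eval-infinitesimal (map ι χ′) (ι c) ε²≈0 ⟩
          evalZ (map ι χ′) (ι c) Z.+ ε Z.* evalZ (QZ.quotient (map ι χ′) (ι c)) (ι c)
            ≈⟨ Z.+-cong (eval-homo χ′ Z.refl) (Z.*-congˡ (derivative-homo χ′ Z.refl)) ⟨
          ι (evalR χ′ c) Z.+ ε Z.* ι D ∎
          where
          open Relation.Binary.Reasoning.Setoid Z.setoid
          open RootsHomo R Z ι-homo

        -- The value of `χ′` at `ι c + ε` is computed twice. Taylor's formula gives a constant plus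
        -- `ε * ι D`; the diagonal determinant gives `ε * y`, with `y` the product of the other
        -- diagonal entries of `T`. Applying `∂` yields that `D` is the scalar part of `y`, a
        -- product of units.
        derivative-unit : Unit D
        derivative-unit with DiagonalDeterminants.product-split Z (Unit ∘ 𝔠)
            (Unit-cong (R.sym 𝔠.1#-homo) (R.1# , R.*-identityˡ R.1#))
            (λ {u} {v} p q → Unit-cong (R.sym (𝔠.*-homo u v)) (Unit-* p q))
            (λ i → T i i) k T-unit
        ... | y , unit , split = Unit-cong (R.sym (begin
          D
            ≈⟨ 𝔠∘ι D ⟨
          𝔠 (ι D)
            ≈⟨ R.+-identityˡ _ ⟨
          R.0# R.+ 𝔠 (ι D)
            ≈⟨ R.+-cong (∂∘ι _) (∂ε* _) ⟨
          ∂ (ι (evalR χ′ c)) R.+ ∂ (ε Z.* ι D)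
            ≈⟨ ∂-+ _ _ ⟨
          ∂ (ι (evalR χ′ c) Z.+ ε Z.* ι D)
            ≈⟨ ∂-cong _ _ expansion ⟨
          ∂ (evalZ (map (ι ∘ 𝔠) χ) (ι c Z.+ ε))
            ≈⟨ ∂-cong _ _ (EvaluationHomo.ev-charPoly Z (∘-homo ι-cong ι-homo 𝔠-homo) (ι c Z.+ ε)
                 {m} {M} {N} λ i j → ι-cong (𝔠M i j)) ⟩
          ∂ (MZ.det T)
            ≈⟨ ∂-cong _ _ (Z.trans (DiagonalDeterminants.det-diagonal Z T T-off-diagonal)
                 (Z.trans split (Z.*-congʳ T-k))) ⟩
          ∂ (ε Z.* y)
            ≈⟨ ∂ε* y ⟩
          𝔠 y ∎)) unit
          where open Relation.Binary.Reasoning.Setoid R.setoid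

      module _ {c′ : Z.Carrier} (𝔠c′ : 𝔠 c′ R.≈ x k) (root : evalZ χ c′ Z.≈ Z.0#) where

        private
          open RootsHomo Z R 𝔠-homo

          -- Taking scalar parts commutes with division and evaluation, so the derivative of `χ` at
          -- any `c′` lying over `x k` has scalar part `D`.
          𝔠-derivative≉0 : ¬ (𝔠 (evalZ (QZ.quotient χ c′) c′) R.≈ R.0#)
          𝔠-derivative≉0 ≈0 = Unit⇒≉0 derivative-unit (R.trans (R.sym (derivative-homo χ 𝔠c′)) ≈0)

        simple-zero : Polynomials.IsSimpleZero Z.rawRing χ c′
        simple-zero = QZ.quotient χ c′ , QZ.factor χ c′ root ,
          λ ≈0 → 𝔠-derivative≉0 (R.trans (𝔠-cong _ _ ≈0) 𝔠.0#-homo)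

        scalar-simple-zero : Polynomials.IsSimpleZero R.rawRing χ′ (𝔠 c′)
        scalar-simple-zero = QR.quotient χ′ (𝔠 c′) ,
          QR.factor χ′ (𝔠 c′) (R.trans (R.sym (eval-homo χ R.refl)) (R.trans (𝔠-cong _ _ root) 𝔠.0#-homo)) ,
          λ ≈0 → 𝔠-derivative≉0 (R.trans (derivative-homo χ R.refl) ≈0)

-- Cycles

unique-lookup : ∀ {A : Set} {xs : List A} → Unique xs → ∀ {i j} → lookup xs i ≡ lookup xs j → i ≡ j
unique-lookup (x∉xs ∷ u) {zero}  {zero}  eq = ≡.refl
unique-lookup (x∉xs ∷ u) {zero}  {suc j} eq = contradiction eq (All.lookup x∉xs (∈-lookup j))
unique-lookup (x∉xs ∷ u) {suc i} {zero}  eq = contradiction (≡.sym eq) (All.lookup x∉xs (∈-lookup i))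
unique-lookup (x∉xs ∷ u) {suc i} {suc j} eq = ≡.cong suc (unique-lookup u eq)

-- Pigeonhole: sending a position to its entry is an injection into `Fin m`.
unique-bounded : ∀ {m} {xs : List ℕ} → Unique xs → All (ℕ._< m) xs → length xs ℕ.≤ m
unique-bounded {m} {xs} u xs<m = Fin.injective⇒≤ {f = f} λ {i} {j} eq →
  unique-lookup u (≡.trans (≡.sym (Fin.toℕ-fromℕ< _)) (≡.trans (≡.cong toℕ eq) (Fin.toℕ-fromℕ< _)))
  where
  f : Fin (length xs) → Fin m
  f i = fromℕ< (All.lookup xs<m (∈-lookup i))

unique-length : ∀ {m} {xs : List (Fin m)} → Unique xs → length xs ℕ.≤ m
unique-length {m} {xs} u = ≡.subst (ℕ._≤ m) (length-map toℕ xs)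
  (unique-bounded (Unique.map⁺ Fin.toℕ-injective u) (All.tabulate bounded))
  where
  bounded : ∀ {n} → n ∈ map toℕ xs → n ℕ.< m
  bounded n∈ with i , _ , ≡.refl ← ∈-map⁻ toℕ n∈ = Fin.toℕ<n i

unique-set⇒↭ : ∀ {A : Set} {xs ys : List A} → Unique xs → Unique ys → (∀ x → x ∈ xs ⇔ x ∈ ys) → xs ↭ ys
unique-set⇒↭ ux uy eq = ∼bag⇒↭ (unique∧set⇒bag ux uy λ {x} → eq x)

unique-∷ʳ : ∀ {A : Set} {x : A} {xs} → Unique (x ∷ xs) → Unique (xs ++ [ x ])
unique-∷ʳ (x∉xs ∷ u) = Unique.++⁺ u ([] ∷ []) λ { (x∈xs , here ≡.refl) → All.lookup x∉xs x∈xs ≡.refl }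

unique-∷ʳ⁻ : ∀ {A : Set} (x : A) xs → Unique (xs ++ [ x ]) → Unique (x ∷ xs)
unique-∷ʳ⁻ x []       _        = [] ∷ []
unique-∷ʳ⁻ x (y ∷ xs) (y∉ ∷ u) with x∉xs ∷ u′ ← unique-∷ʳ⁻ x xs u =
  ((λ { ≡.refl → All.lookup y∉ (∈-++⁺ʳ xs (here ≡.refl)) ≡.refl }) ∷ x∉xs) ∷
  All.tabulate (λ z∈xs → All.lookup y∉ (∈-++⁺ˡ z∈xs)) ∷ u′

does-∈? : ∀ {m} (I : Subset m) i → does (i ∈? I) ≡ Vec.lookup I i
does-∈? (true  Vec.∷ I) zero    = ≡.refl
does-∈? (false Vec.∷ I) zero    = ≡.refl
does-∈? (_     Vec.∷ I) (suc i) = does-∈? I i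

length-filter-tabulate : ∀ {A : Set} {P : Pred A 0ℓ} (P? : Decidable P) {m} (f : Fin m → A) (I : Subset m) →
  (∀ i → does (P? (f i)) ≡ Vec.lookup I i) → length (filter P? (tabulate f)) ≡ ∣ I ∣
length-filter-tabulate P? f Vec.[]      eq = ≡.refl
length-filter-tabulate P? f (s Vec.∷ I) eq
  with rest ← length-filter-tabulate P? (f ∘ suc) I (eq ∘ suc) | does (P? (f zero)) | eq zero
... | true  | ≡.refl = ≡.cong suc rest
... | false | ≡.refl = rest

∈-elements : ∀ {m} (I : Subset m) i → i ∈ elements I ⇔ i ∈ˢ I
∈-elements {m} I i = mk⇔ (proj₂ ∘ ∈-filter⁻ (_∈? I) {xs = allFin m}) (∈-filter⁺ (_∈? I) (∈-allFin i))

elements-unique : ∀ {m} (I : Subset m) → Unique (elements I)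
elements-unique {m} I = Unique.filter⁺ (_∈? I) (Unique.allFin⁺ m)

elements-↭ : ∀ {m} (I : Subset m) {xs} → Unique xs → (∀ i → i ∈ xs ⇔ i ∈ˢ I) → xs ↭ elements I
elements-↭ I u eq = unique-set⇒↭ u (elements-unique I) λ i → ⇔-trans (eq i) (⇔-sym (∈-elements I i))

length≡∣∣ : ∀ {m} (I : Subset m) {xs} → Unique xs → (∀ i → i ∈ xs ⇔ i ∈ˢ I) → length xs ≡ ∣ I ∣
length≡∣∣ I u eq = ≡.trans (↭-length (elements-↭ I u eq)) (length-filter-tabulate (_∈? I) id I (does-∈? I))

x∉p-x : ∀ {m} (p : Subset m) x → ¬ (x ∈ˢ p ∖ x)
x∉p-x (s Vec.∷ p) zero    ()
x∉p-x (s Vec.∷ p) (suc x) (Vec.there x∈) = x∉p-x p x x∈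

module _ {m : ℕ} where
  open DecMembership (Fin._≟_ {m}) using () renaming (_∈?_ to _∈ᴸ?_)

  support : List (Fin m) → Subset m
  support xs = Vec.tabulate λ i → does (i ∈ᴸ? xs)

  ∈-support : ∀ xs i → i ∈ xs ⇔ i ∈ˢ support xs
  ∈-support xs i = mk⇔
    (λ i∈xs → Vec.lookup⇒[]= i _ (≡.trans (Vec.lookup∘tabulate _ i) (dec-true (i ∈ᴸ? xs) i∈xs)))
    (λ i∈s → from-does (i ∈ᴸ? xs) (≡.trans (≡.sym (Vec.lookup∘tabulate _ i)) (Vec.[]=⇒lookup i∈s)))
    where
    from-does : ∀ {P : Set} (P? : Dec P) → does P? ≡ true → P
    from-does (yes p) _ = p

  support-unique : ∀ xs {I} → (∀ i → i ∈ xs ⇔ i ∈ˢ I) → support xs ≡ I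
  support-unique xs eq = ⊆-antisym
    (λ {i} → Equivalence.to (eq i) ∘ Equivalence.from (∈-support xs i))
    (λ {i} → Equivalence.to (∈-support xs i) ∘ Equivalence.from (eq i))

  -- The interior of a cycle runs once through its index set without `k`. This converts a product
  -- along the cycle into the product over I minus k in the formula.
  elements-support-tail : ∀ k p → Unique (k ∷ p) → p ↭ elements (support (k ∷ p) ∖ k)
  elements-support-tail k p (k∉p ∷ u) = elements-↭ _ u λ i → mk⇔
    (λ i∈p → x∈p∧x≢y⇒x∈p-y (Equivalence.to (∈-support (k ∷ p) i) (there i∈p))
      λ { ≡.refl → All.lookup k∉p i∈p ≡.refl })
    (λ i∈s → tail i i∈s (Equivalence.from (∈-support (k ∷ p) i) (p─q⊆p _ _ i∈s)))
    where
    tail : ∀ i → i ∈ˢ support (k ∷ p) ∖ k → i ∈ k ∷ p → i ∈ p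
    tail i i∈s (here ≡.refl) = contradiction i∈s (x∉p-x (support (k ∷ p)) k)
    tail i i∈s (there i∈p)   = i∈p

∈-subsets : ∀ {m} (I : Subset m) → I ∈ subsets m
∈-subsets Vec.[]          = here ≡.refl
∈-subsets (false Vec.∷ I) = ∈-++⁺ˡ (∈-map⁺ (outside Vec.∷_) (∈-subsets I))
∈-subsets {suc m} (true Vec.∷ I) =
  ∈-++⁺ʳ (map (outside Vec.∷_) (subsets m)) (∈-map⁺ (inside Vec.∷_) (∈-subsets I))

subsets-unique : ∀ m → Unique (subsets m)
subsets-unique zero    = [] ∷ []
subsets-unique (suc m) = Unique.++⁺
  (Unique.map⁺ Vec.∷-injectiveʳ (subsets-unique m)) (Unique.map⁺ Vec.∷-injectiveʳ (subsets-unique m))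
  λ (∈out , ∈in) → different (∈-map⁻ (outside Vec.∷_) ∈out , ∈-map⁻ (inside Vec.∷_) ∈in)
  where
  different : ∀ {I} → ¬ ((∃[ J ] (J ∈ subsets m × I ≡ outside Vec.∷ J)) ×
    ∃[ J ] (J ∈ subsets m × I ≡ inside Vec.∷ J))
  different ((_ , _ , ≡.refl) , (_ , _ , ()))

∈-listsShorterThan : ∀ {m n} (p : List (Fin m)) → length p ℕ.< n → p ∈ listsShorterThan m n
∈-listsShorterThan []      (ℕ.s≤s _) = here ≡.refl
∈-listsShorterThan (j ∷ p) (ℕ.s≤s p<n) =
  there (∈-cartesianProductWith⁺ _∷_ (∈-allFin j) (∈-listsShorterThan p p<n))

listsShorterThan-unique : ∀ m n → Unique (listsShorterThan m n)
listsShorterThan-unique m zero    = []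
listsShorterThan-unique m (suc n) =
  All.tabulate (λ {p} → nonempty {p}) ∷
  Unique.cartesianProductWith⁺ _∷_ ∷-injective (Unique.allFin⁺ m) (listsShorterThan-unique m n)
  where
  nonempty : ∀ {p} → p ∈ cartesianProductWith _∷_ (allFin m) (listsShorterThan m n) → [] ≢ p
  nonempty p∈ ≡.refl with ∈-cartesianProductWith⁻ _∷_ (allFin m) (listsShorterThan m n) p∈
  ... | _ , _ , _ , _ , ()

module Cycles {m : ℕ} (G : SimpleGraph m) (k : Fin m) where
  open SimpleGraph G

  -- A cycle based at `k` is determined by its interior, which is also the index of the
  -- corresponding summand of `walks`; counting and summation thus run over the same lists.
  IsInterior : List (Fin m) → Set
  IsInterior p = Linked Adj (k ∷ p ++ [ k ]) × Unique (k ∷ p)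

  isInterior? : Decidable IsInterior
  isInterior? p = linked? adj? (k ∷ p ++ [ k ]) ×-dec unique? Fin._≟_ (k ∷ p)

  -- The bound loses no cycle: distinctness of `k ∷ p` forces `length p < m`. It is also the bound
  -- in the expansion of `walks m`.
  interiors : List (List (Fin m))
  interiors = filter isInterior? (listsShorterThan m m)

  interiorsOn : Subset m → List (List (Fin m))
  interiorsOn I = filter (λ p → Vec.≡-dec Bool._≟_ (support (k ∷ p)) I) interiors

  numberOf-cycles : ∀ I → NumberOf (IsCycleOn G k I) (length (interiorsOn I))
  numberOf-cycles I = map close (interiorsOn I) , unique , (λ c → mk⇔ to from) , length-map close (interiorsOn I)
    where
    close : List (Fin m) → List (Fin m)
    close p = k ∷ p ++ [ k ]

    on? : Decidable λ p → support (k ∷ p) ≡ I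
    on? p = Vec.≡-dec Bool._≟_ (support (k ∷ p)) I

    unique : Unique (map close (interiorsOn I))
    unique = Unique.map⁺ (λ {p} {q} eq → ++-cancelʳ [ k ] p q (∷-injectiveʳ eq))
      (Unique.filter⁺ on? (Unique.filter⁺ isInterior? (listsShorterThan-unique m m)))

    to : ∀ {c} → c ∈ map close (interiorsOn I) → IsCycleOn G k I c
    to c∈ with p , p∈ , ≡.refl ← ∈-map⁻ close c∈
      with p∈′ , ≡.refl ← ∈-filter⁻ on? {xs = interiors} p∈
      with _ , linked , u ← ∈-filter⁻ isInterior? {xs = listsShorterThan m m} p∈′ = record
        { inner    = p
        ; closed   = ≡.refl
        ; adjacent = linked
        ; distinct = u
        ; support  = ∈-support (k ∷ p)
        }

    from : ∀ {c} → IsCycleOn G k I c → c ∈ map close (interiorsOn I)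
    from record { inner = p ; closed = ≡.refl ; adjacent = linked ; distinct = u ; support = supp } =
      ∈-map⁺ close (∈-filter⁺ on? (∈-filter⁺ isInterior? (∈-listsShorterThan p (unique-length u)) (linked , u))
        (support-unique (k ∷ p) supp))

-- The zeon Laplacian

module HomogeneousZeons (R : CommutativeRing 0ℓ 0ℓ) (m : ℕ) where
  open CommutativeRing R using (Carrier; rawRing)
  open Zeons rawRing using (Zeon; mulTerm)
  private
    module Z = RawRing (Zeons.rawRing rawRing)

  -- A condition on the formal terms, regardless of whether their coefficients vanish. It is not
  -- invariant under equality of zeons, but it lets `homogeneous-null` conclude that there are no
  -- terms at all.
  IsMonomial : ℕ → Carrier × FinSet → Set
  IsMonomial n (_ , I) = Unique I × length I ≡ n × All (ℕ._< m) I

  Homogeneous : ℕ → Zeon → Set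
  Homogeneous n = All (IsMonomial n)

  homogeneous-null : ∀ {n} u → m ℕ.< n → Homogeneous n u → u ≡ []
  homogeneous-null []      m<n _ = ≡.refl
  homogeneous-null (_ ∷ _) m<n ((unique , ≡.refl , bounded) ∷ _) =
    contradiction (unique-bounded unique bounded) (ℕ.<⇒≱ m<n)

  homogeneous-* : ∀ {n n′} u v → Homogeneous n u → Homogeneous n′ v → Homogeneous (n ℕ.+ n′) (u Z.* v)
  homogeneous-* {n} {n′} u v hu hv = All.concat⁺ (All.map⁺ (All.map (λ {s} hs →
    All.concat⁺ (All.map⁺ (All.map (λ {t} ht → product s t hs ht) hv))) hu))
    where
    product : ∀ s t → IsMonomial n s → IsMonomial n′ t → Homogeneous (n ℕ.+ n′) (mulTerm s t)
    product (_ , I) (_ , J) (uI , ≡.refl , bI) (uJ , ≡.refl , bJ) with disjoint? I J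
    ... | yes I#J = (Unique.++⁺ uI uJ I#J , length-++ I , All.++⁺ bI bJ) ∷ []
    ... | no _    = []

  homogeneous-sum : ∀ {n} l (f : Vector Zeon l) → (∀ i → Homogeneous n (f i)) →
    Homogeneous n (FiniteSums.sum (ZeonRing.commutativeRing R) f)
  homogeneous-sum zero    f hf = []
  homogeneous-sum (suc l) f hf = All.++⁺ (hf zero) (homogeneous-sum l (f ∘ suc) (hf ∘ suc))

module ZeonLaplacian (R : CommutativeRing 0ℓ 0ℓ) {m : ℕ} (G : SimpleGraph m) (k : Fin m)
  (x r : Vector (CommutativeRing.Carrier R) m) where
  private
    module R = CommutativeRing R
  open SimpleGraph G
  open ZeonRing R
  open Zeons R.rawRing using (Zeon; coefficient; scalarPart; mapCoefficients; term; scalar; ζ)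
  open HomogeneousZeons R m
  open Cycles G k
  open Matrices (Zeons.rawRing R.rawRing) using (Matrix; diag; _⊖_; _·_)
  open Algebra.Definitions.RawSemiring (RawRing.rawSemiring R.rawRing) using (_^_) renaming (_×_ to _×ᴿ_)
  private
    module Z = CommutativeRing commutativeRing
    module 𝔠 = PreservesOperations scalarPart-homo
    module ι = PreservesOperations scalar-homo
    module LZ = ListSums commutativeRing
    module RP = Algebra.Properties.Ring R.ring
    open LZ using (∑)

  -- `r` holds the reciprocals of the differences of degrees; the negation yields the factors that
  -- weight interior vertices.
  diagonal recip : Vector Zeon m
  diagonal i = scalar (x i)
  recip i = scalar (R.- r i)

  ψ Λ : Matrix m
  ψ i j = if does (adj? i j) then ζ [ toℕ j ] else []
  Λ = diag diagonal ⊖ ψ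

  scalar-cong : ∀ {a b} → a R.≈ b → scalar a Z.≈ scalar b
  scalar-cong {a} {b} a≈b = term-cong {a} {b} {[]} {[]} a≈b (⊆-refl , ⊆-refl)

  open Eigenvectors commutativeRing ψ diagonal recip k public
    using (step; walks; longest; weight; eigenvalue; eigenvector; eigenvector-k; eigen; δₖ; δₖ-no; walks≈∑)

  ψ-homogeneous : ∀ i j → Homogeneous 1 (ψ i j)
  ψ-homogeneous i j with does (adj? i j)
  ... | true  = ([] ∷ [] , ≡.refl , Fin.toℕ<n j ∷ []) ∷ []
  ... | false = []

  longest-homogeneous : ∀ n i → Homogeneous (suc n) (longest n i)
  longest-homogeneous zero    i = ψ-homogeneous i k
  longest-homogeneous (suc n) i = homogeneous-sum m (λ j → ψ i j Z.* (scalar (R.- r j) Z.* longest n j)) λ j →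
    homogeneous-* (ψ i j) (scalar (R.- r j) Z.* longest n j) (ψ-homogeneous i j)
      (homogeneous-* (scalar (R.- r j)) (longest n j) (([] , ≡.refl , []) ∷ []) (longest-homogeneous n j))

  -- Each edge contributes one generator, so `longest m` is homogeneous of degree m + 1, while only
  -- m generators are available.
  nilpotent : ∀ i → longest m i Z.≈ Z.0#
  nilpotent i rewrite homogeneous-null (longest m i) (ℕ.n<1+n m) (longest-homogeneous m i) = λ I → R.refl

  ψψ≈0 : ∀ i j → ψ i k Z.* ψ j k Z.≈ Z.0#
  ψψ≈0 i j with does (adj? i k) | does (adj? j k)
  ... | true  | true  = term-*-null {R.1#} {R.1#} {[ toℕ k ]} {[ toℕ k ]} λ d → d (here ≡.refl , here ≡.refl)
  ... | true  | false = λ I → R.refl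
  ... | false | _     = λ I → R.refl

  𝔠ψ≈0 : ∀ i j → scalarPart (ψ i j) R.≈ R.0#
  𝔠ψ≈0 i j with does (adj? i j)
  ... | true  = R.refl
  ... | false = R.refl

  𝔠-cong : ∀ u v → u Z.≈ v → scalarPart u R.≈ scalarPart v
  𝔠-cong u v u≈v = u≈v []

  𝔠∘scalar : ∀ a → scalarPart (scalar a) R.≈ a
  𝔠∘scalar a = R.+-identityʳ a

  𝔠-walks : ∀ n i → scalarPart (walks n i) R.≈ R.0#
  𝔠-walks zero    i = R.refl
  𝔠-walks (suc n) i = R.trans (𝔠.+-homo (ψ i k) (step (walks n) i)) (R.trans (R.+-cong (𝔠ψ≈0 i k)
    (R.trans (DeterminantHomo.sum-homo R scalarPart-homo m λ j → ψ i j Z.* (scalar (R.- r j) Z.* walks n j))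
      (FiniteSums.sum-zero R λ j → R.trans (𝔠.*-homo (ψ i j) (scalar (R.- r j) Z.* walks n j))
        (R.trans (R.*-congʳ (𝔠ψ≈0 i j)) (R.zeroˡ _)))))
    (R.+-identityˡ R.0#))

  𝔠-eigenvalue : scalarPart eigenvalue R.≈ x k
  𝔠-eigenvalue = R.trans (𝔠.+-homo (scalar (x k)) (Z.- walks m k))
    (R.trans (R.+-cong (𝔠∘scalar (x k)) (R.trans (𝔠.-‿homo (walks m k))
      (R.trans (R.-‿cong (𝔠-walks m k)) RP.-0#≈0#)))
      (R.+-identityʳ _))

  𝔠Λ : ∀ i j → scalarPart (Λ i j) R.≈ Matrices.diag R.rawRing x i j
  𝔠Λ i j = R.trans (𝔠.+-homo (diag diagonal i j) (Z.- ψ i j))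
    (R.trans (R.+-cong (diagonal-part i j) (R.trans (𝔠.-‿homo (ψ i j))
      (R.trans (R.-‿cong (𝔠ψ≈0 i j)) RP.-0#≈0#)))
      (R.+-identityʳ _))
    where
    diagonal-part : ∀ i j → scalarPart (diag diagonal i j) R.≈ Matrices.diag R.rawRing x i j
    diagonal-part i j with does (i Fin.≟ j)
    ... | true  = 𝔠∘scalar (x i)
    ... | false = R.refl

  ∏ : ∀ {A : Set} → List A → (A → R.Carrier) → R.Carrier
  ∏ xs f = foldr R._*_ R.1# (map f xs)

  ∏-↭ : ∀ {A : Set} {xs ys : List A} (f : A → R.Carrier) → xs ↭ ys → ∏ xs f R.≈ ∏ ys f
  ∏-↭ f Perm.refl          = R.refl
  ∏-↭ f (Perm.prep x p)    = R.*-congˡ (∏-↭ f p)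
  ∏-↭ f (Perm.trans p q)   = R.trans (∏-↭ f p) (∏-↭ f q)
  ∏-↭ f (Perm.swap x y p)  = R.trans (R.*-congˡ (R.*-congˡ (∏-↭ f p)))
    (R.trans (R.sym (R.*-assoc _ _ _)) (R.trans (R.*-congʳ (R.*-comm _ _)) (R.*-assoc _ _ _)))

  ∏-neg : ∀ {A : Set} (xs : List A) f → ∏ xs (λ j → R.- f j) R.≈ (R.- R.1#) ^ length xs R.* ∏ xs f
  ∏-neg []       f = R.sym (R.*-identityˡ R.1#)
  ∏-neg (j ∷ xs) f = begin
    (R.- f j) R.* ∏ xs (λ j → R.- f j)
      ≈⟨ R.*-cong (R.sym (RP.-1*x≈-x (f j))) (∏-neg xs f) ⟩
    (R.- R.1# R.* f j) R.* ((R.- R.1#) ^ length xs R.* ∏ xs f)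
      ≈⟨ solve 4 (λ a b c d → (a :* b) :* (c :* d) := (a :* c) :* (b :* d)) R.refl
           (R.- R.1#) (f j) ((R.- R.1#) ^ length xs) (∏ xs f) ⟩
    (R.- R.1# R.* (R.- R.1#) ^ length xs) R.* (f j R.* ∏ xs f) ∎
    where
    open Relation.Binary.Reasoning.Setoid R.setoid
    open import Algebra.Solver.Ring.NaturalCoefficients.Default R.commutativeSemiring

  ψ-adjacent : ∀ {i j} → Adj i j → ψ i j ≡ ζ [ toℕ j ]
  ψ-adjacent {i} {j} i~j = ≡.cong (if_then ζ [ toℕ j ] else []) (dec-true (adj? i j) i~j)

  -- An edge carries the generator of its head. The start `i` therefore contributes none and the end
  -- `k` one, which is why distinctness concerns `p ++ [ k ]`.
  weight-interior : ∀ i p → Linked Adj (i ∷ p ++ [ k ]) → Unique (p ++ [ k ]) →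
    weight i p Z.≈ term (∏ p (λ j → R.- r j)) (map toℕ (p ++ [ k ]))
  weight-interior i []      (i~k ∷ _) _ = Z.reflexive (ψ-adjacent i~k)
  weight-interior i (j ∷ p) (i~j ∷ l) (j∉ ∷ u) = begin
    ψ i j Z.* (scalar (R.- r j) Z.* weight j p)
      ≡⟨ ≡.cong (Z._* (scalar (R.- r j) Z.* weight j p)) (ψ-adjacent i~j) ⟩
    ζ [ toℕ j ] Z.* (scalar (R.- r j) Z.* weight j p)
      ≈⟨ Z.*-congˡ {ζ [ toℕ j ]} {scalar (R.- r j) Z.* weight j p} {scalar (R.- r j) Z.* term c L}
           (Z.*-congˡ {scalar (R.- r j)} {weight j p} {term c L} (weight-interior j p l u)) ⟩
    ζ [ toℕ j ] Z.* (scalar (R.- r j) Z.* term c L)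
      ≈⟨ Z.*-congˡ {ζ [ toℕ j ]} {scalar (R.- r j) Z.* term c L} {term ((R.- r j) R.* c) L}
           (term-* {R.- r j} {c} {[]} {L} λ ()) ⟩
    ζ [ toℕ j ] Z.* term ((R.- r j) R.* c) L
      ≈⟨ term-* {R.1#} {(R.- r j) R.* c} {[ toℕ j ]} {L} disjoint ⟩
    term (R.1# R.* ((R.- r j) R.* c)) (toℕ j ∷ L)
      ≈⟨ term-cong {I = toℕ j ∷ L} {toℕ j ∷ L} (R.*-identityˡ _) (⊆-refl , ⊆-refl) ⟩
    term ((R.- r j) R.* c) (toℕ j ∷ L) ∎
    where
    open Relation.Binary.Reasoning.Setoid Z.setoid
    c : R.Carrier
    c = ∏ p (λ j → R.- r j)
    L : FinSet
    L = map toℕ (p ++ [ k ])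
    disjoint : Disjoint [ toℕ j ] L
    disjoint (here ≡.refl , j∈) with j′ , j′∈ , eq ← ∈-map⁻ toℕ j∈ = All.lookup j∉ j′∈ (Fin.toℕ-injective eq)

  private
    interior? : ∀ i p → Dec (Linked Adj (i ∷ p ++ [ k ]) × Unique (p ++ [ k ]))
    interior? i p = linked? adj? (i ∷ p ++ [ k ]) ×-dec unique? Fin._≟_ (p ++ [ k ])

  -- Either the first edge is missing, or the rest of the walk has weight zero by induction, or the
  -- rest is a single term that already contains the generator of `j`, whose square is zero.
  weight-null : ∀ i p → ¬ (Linked Adj (i ∷ p ++ [ k ]) × Unique (p ++ [ k ])) → weight i p Z.≈ Z.0#
  weight-null i [] ¬int with adj? i k
  ... | yes i~k = contradiction (i~k ∷ [-] , [] ∷ []) ¬int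
  ... | no _    = λ I → R.refl
  weight-null i (j ∷ p) ¬int with adj? i j
  ... | no _    = λ I → R.refl
  ... | yes i~j with interior? j p
  ...   | no ¬int′ = begin
    ζ [ toℕ j ] Z.* (scalar (R.- r j) Z.* weight j p)
      ≈⟨ Z.*-congˡ {ζ [ toℕ j ]} {scalar (R.- r j) Z.* weight j p} {scalar (R.- r j) Z.* Z.0#}
           (Z.*-congˡ {scalar (R.- r j)} {weight j p} {Z.0#} (weight-null j p ¬int′)) ⟩
    ζ [ toℕ j ] Z.* (scalar (R.- r j) Z.* Z.0#)
      ≈⟨ (λ I → R.refl) ⟩
    Z.0# ∎
    where open Relation.Binary.Reasoning.Setoid Z.setoid
  ...   | yes (l , u) = begin
    ζ [ toℕ j ] Z.* (scalar (R.- r j) Z.* weight j p)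
      ≈⟨ Z.*-congˡ {ζ [ toℕ j ]} {scalar (R.- r j) Z.* weight j p} {scalar (R.- r j) Z.* term c L}
           (Z.*-congˡ {scalar (R.- r j)} {weight j p} {term c L} (weight-interior j p l u)) ⟩
    ζ [ toℕ j ] Z.* (scalar (R.- r j) Z.* term c L)
      ≈⟨ Z.*-congˡ {ζ [ toℕ j ]} {scalar (R.- r j) Z.* term c L} {term ((R.- r j) R.* c) L}
           (term-* {R.- r j} {c} {[]} {L} λ ()) ⟩
    ζ [ toℕ j ] Z.* term ((R.- r j) R.* c) L
      ≈⟨ term-*-null {R.1#} {(R.- r j) R.* c} {[ toℕ j ]} {L} (λ disjoint →
           ¬int (i~j ∷ l , All.tabulate (λ { {j′} j′∈ ≡.refl → disjoint (here ≡.refl , ∈-map⁺ toℕ j′∈) }) ∷ u)) ⟩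
    Z.0# ∎
    where
    open Relation.Binary.Reasoning.Setoid Z.setoid
    c : R.Carrier
    c = ∏ p (λ j → R.- r j)
    L : FinSet
    L = map toℕ (p ++ [ k ])

  -- What a single cycle on `I` contributes to `- walks m k`. The exponent `∣ I ∣` counts the signs
  -- of the `∣ I ∣` - 1 interior factors and the overall minus sign.
  monomial : Subset m → Zeon
  monomial I = term ((R.- R.1#) ^ ∣ I ∣ R.* ∏ (elements (I ∖ k)) r) (map toℕ (elements I))

  ↭⇒≐ : ∀ {xs ys : List (Fin m)} → xs ↭ ys → map toℕ xs ≐ map toℕ ys
  ↭⇒≐ p = map-⊆ p , map-⊆ (↭-sym p)
    where
    map-⊆ : ∀ {xs ys : List (Fin m)} → xs ↭ ys → ∀ {n} → n ∈ map toℕ xs → n ∈ map toℕ ys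
    map-⊆ p n∈ with i , i∈ , ≡.refl ← ∈-map⁻ toℕ n∈ = ∈-map⁺ toℕ (∈-resp-↭ p i∈)

  weight-monomial : ∀ p → IsInterior p → Z.- weight k p Z.≈ monomial (support (k ∷ p))
  weight-monomial p (l , u) = begin
    Z.- weight k p
      ≈⟨ Z.-‿cong {weight k p} {term c (map toℕ (p ++ [ k ]))} (weight-interior k p l (unique-∷ʳ u)) ⟩
    term (R.- c) (map toℕ (p ++ [ k ]))
      ≈⟨ term-cong sign (↭⇒≐ (↭-trans (↭-sym (∷↭∷ʳ k p)) (elements-↭ I u (∈-support (k ∷ p))))) ⟩
    monomial I ∎
    where
    open Relation.Binary.Reasoning.Setoid Z.setoid
    I : Subset m
    I = support (k ∷ p)
    c : R.Carrier
    c = ∏ p (λ j → R.- r j)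
    sign : R.- c R.≈ (R.- R.1#) ^ ∣ I ∣ R.* ∏ (elements (I ∖ k)) r
    sign = R.trans (R.sym (RP.-1*x≈-x c)) (R.trans (R.*-congˡ (∏-neg p r)) (R.trans (R.sym (R.*-assoc _ _ _))
      (R.*-cong (R.reflexive (≡.cong ((R.- R.1#) ^_) (length≡∣∣ I u (∈-support (k ∷ p)))))
        (∏-↭ r (elements-support-tail k p u)))))

  cycle-sum : Z.- walks m k Z.≈ ∑ interiors (λ p → monomial (support (k ∷ p)))
  cycle-sum = begin
    Z.- walks m k
      ≈⟨ Z.-‿cong {walks m k} {∑ (listsShorterThan m m) (weight k)} (walks≈∑ m k) ⟩
    Z.- ∑ (listsShorterThan m m) (weight k)
      ≈⟨ LZ.∑-neg (listsShorterThan m m) (weight k) ⟩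
    ∑ (listsShorterThan m m) (λ p → Z.- weight k p)
      ≈⟨ LZ.∑-filter isInterior? (listsShorterThan m m) {λ p → Z.- weight k p} (λ p _ ¬int →
           Z.-‿cong {weight k p} {Z.0#} (weight-null k p λ (l , u) → ¬int (l , unique-∷ʳ⁻ k p u))) ⟨
    ∑ interiors (λ p → Z.- weight k p)
      ≈⟨ LZ.∑-cong interiors {λ p → Z.- weight k p} (λ p p∈ →
           weight-monomial p (proj₂ (∈-filter⁻ isInterior? {xs = listsShorterThan m m} p∈))) ⟩
    ∑ interiors (λ p → monomial (support (k ∷ p))) ∎
    where open Relation.Binary.Reasoning.Setoid Z.setoid

  signedCount : Subset m → R.Carrier
  signedCount I = (R.- R.1#) ^ ∣ I ∣ R.* (length (interiorsOn I) ×ᴿ R.1#)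

  ∑-constant : ∀ {A : Set} (xs : List A) c L → ∑ xs (λ _ → term c L) Z.≈ term ((length xs ×ᴿ R.1#) R.* c) L
  ∑-constant []       c L = ⟪⟫≈⇒≈ {[]} {term (R.0# R.* c) L} λ {F} _ →
    R.sym (R.trans (R.+-identityʳ _) (R.trans (R.*-congʳ (R.zeroˡ c)) (R.zeroˡ (F L))))
  ∑-constant (x ∷ xs) c L = begin
    term c L ++ ∑ xs (λ _ → term c L)
      ≈⟨ Z.+-congˡ {term c L} {∑ xs (λ _ → term c L)} {term (n R.* c) L} (∑-constant xs c L) ⟩
    term c L ++ term (n R.* c) L
      ≈⟨ ⟪⟫≈⇒≈ {term c L ++ term (n R.* c) L} {term ((R.1# R.+ n) R.* c) L} (λ {F} _ → merge (F L)) ⟩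
    term ((R.1# R.+ n) R.* c) L ∎
    where
    open Relation.Binary.Reasoning.Setoid Z.setoid
    n : R.Carrier
    n = length xs ×ᴿ R.1#
    merge : ∀ y → c R.* y R.+ ((n R.* c) R.* y R.+ R.0#) R.≈ ((R.1# R.+ n) R.* c) R.* y R.+ R.0#
    merge y = R.trans (R.+-congʳ (R.*-congʳ (R.sym (R.*-identityˡ c))))
      (solve 4 (λ o n c y → (o :* c) :* y :+ ((n :* c) :* y :+ con 0) := ((o :+ n) :* c) :* y :+ con 0)
        R.refl R.1# n c y)
      where open import Algebra.Solver.Ring.NaturalCoefficients.Default R.commutativeSemiring

  cycleTerm : Subset m → Zeon
  cycleTerm I = scalar (signedCount I) Z.* ζ (map toℕ (elements I)) Z.* scalar (∏ (elements (I ∖ k)) r)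

  -- The contribution of a cycle depends only on its support. Grouping by support turns the sum over
  -- cycles into a sum over subsets, with the number of cycles as multiplicity.
  walks≈cycles : Z.- walks m k Z.≈ ∑ (subsets m) cycleTerm
  walks≈cycles = begin
    Z.- walks m k
      ≈⟨ cycle-sum ⟩
    ∑ interiors (λ p → monomial (support (k ∷ p)))
      ≈⟨ LZ.∑-fibres (λ p I → Vec.≡-dec Bool._≟_ (support (k ∷ p)) I) interiors (subsets m)
           (λ _ → monomial) {λ p → monomial (support (k ∷ p))} (λ p _ → fibre (support (k ∷ p))) ⟨
    ∑ (subsets m) (λ I → ∑ (interiorsOn I) (λ _ → monomial I))
      ≈⟨ LZ.∑-cong (subsets m) {λ I → ∑ (interiorsOn I) (λ _ → monomial I)} {cycleTerm} (λ I _ → collect I) ⟩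
    ∑ (subsets m) cycleTerm ∎
    where
    open Relation.Binary.Reasoning.Setoid Z.setoid
    fibre : ∀ I → ∑ (subsets m) (λ J → if does (Vec.≡-dec Bool._≟_ I J) then monomial J else Z.0#)
      Z.≈ monomial I
    fibre I = LZ.∑-delta (λ J → Vec.≡-dec Bool._≟_ I J) (subsets-unique m) (∈-subsets I) monomial
    collect : ∀ I → ∑ (interiorsOn I) (λ _ → monomial I) Z.≈ cycleTerm I
    collect I = begin
      ∑ (interiorsOn I) (λ _ → monomial I)
        ≈⟨ ∑-constant (interiorsOn I) (s R.* p) L ⟩
      term (n R.* (s R.* p)) L
        ≈⟨ term-cong {I = L} {L} reorder (⊆-refl , ⊆-refl) ⟩
      term (s R.* n R.* R.1# R.* p) L
        ≡⟨ ≡.cong (term (s R.* n R.* R.1# R.* p)) (++-identityʳ L) ⟨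
      term (s R.* n R.* R.1# R.* p) (L ++ [])
        ≈⟨ term-* {s R.* n R.* R.1#} {p} {L} {[]} (λ ()) ⟨
      term (s R.* n R.* R.1#) L Z.* scalar p
        ≈⟨ Z.*-congʳ {scalar p} {scalar (s R.* n) Z.* ζ L} {term (s R.* n R.* R.1#) L}
             (term-* {s R.* n} {R.1#} {[]} {L} λ ()) ⟨
      scalar (s R.* n) Z.* ζ L Z.* scalar p ∎
      where
      open import Algebra.Solver.Ring.NaturalCoefficients.Default R.commutativeSemiring
        using (solve; _:=_; _:*_)
      n s p : R.Carrier
      n = length (interiorsOn I) ×ᴿ R.1#
      s = (R.- R.1#) ^ ∣ I ∣
      p = ∏ (elements (I ∖ k)) r
      L : FinSet
      L = map toℕ (elements I)
      reorder : n R.* (s R.* p) R.≈ s R.* n R.* R.1# R.* p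
      reorder = R.trans (solve 3 (λ n s p → n :* (s :* p) := s :* n :* p) R.refl n s p)
        (R.*-congʳ (R.sym (R.*-identityʳ _)))

  -- The parameter `w` allows the signed counts, formed inside the ring, to be replaced by images of
  -- integers.
  eigenvalue≈cycles : ∀ (w : Subset m → R.Carrier) → (∀ I → signedCount I R.≈ w I) →
    eigenvalue Z.≈ scalar (x k) Z.+
    ∑ (subsets m) (λ I → scalar (w I) Z.* ζ (map toℕ (elements I)) Z.* scalar (∏ (elements (I ∖ k)) r))
  eigenvalue≈cycles w eq = Z.+-congˡ {scalar (x k)} {Z.- walks m k} {∑ (subsets m) wTerm}
    (Z.trans {Z.- walks m k} {∑ (subsets m) cycleTerm} {∑ (subsets m) wTerm} walks≈cycles
      (LZ.∑-cong (subsets m) {cycleTerm} {wTerm} λ I _ →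
        Z.*-congʳ {scalar (∏ (elements (I ∖ k)) r)}
          {scalar (signedCount I) Z.* ζ (map toℕ (elements I))} {scalar (w I) Z.* ζ (map toℕ (elements I))}
          (Z.*-congʳ {ζ (map toℕ (elements I))} {scalar (signedCount I)} {scalar (w I)} (scalar-cong (eq I)))))
    where
    wTerm : Subset m → Zeon
    wTerm I = scalar (w I) Z.* ζ (map toℕ (elements I)) Z.* scalar (∏ (elements (I ∖ k)) r)

  module _ (r-k : r k R.≈ R.0#) (r-inverse : ∀ i → i ≢ k → (x k R.- x i) R.* r i R.≈ R.1#) where

    private
      a-k : scalar (R.- r k) Z.≈ Z.0#
      a-k = Z.trans {scalar (R.- r k)} {scalar R.0#} {Z.0#}
        (scalar-cong (R.trans (R.-‿cong r-k) RP.-0#≈0#)) ι.0#-homo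

      a-inverse : ∀ i → i ≢ k → (scalar (x k) Z.- scalar (x i)) Z.* scalar (R.- r i) Z.≈ Z.- Z.1#
      a-inverse i i≢k = begin
        (scalar (x k) Z.- scalar (x i)) Z.* scalar (R.- r i)
          ≈⟨ Z.*-congʳ {scalar (R.- r i)} {scalar (x k) Z.- scalar (x i)} {scalar (x k R.- x i)}
               (Z.sym {scalar (x k R.- x i)} {scalar (x k) Z.- scalar (x i)} (ι.+-homo (x k) (R.- x i))) ⟩
        scalar (x k R.- x i) Z.* scalar (R.- r i)
          ≈⟨ ι.*-homo (x k R.- x i) (R.- r i) ⟨
        scalar ((x k R.- x i) R.* (R.- r i))
          ≈⟨ scalar-cong (R.trans (R.sym (RP.-‿distribʳ-* _ _)) (R.-‿cong (r-inverse i i≢k))) ⟩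
        scalar (R.- R.1#) ∎
        where open Relation.Binary.Reasoning.Setoid Z.setoid

    eigenvector-k≈1 : eigenvector k Z.≈ Z.1#
    eigenvector-k≈1 = eigenvector-k a-k

    eigenvector-equation : ∀ i → (Λ · eigenvector) i Z.≈ eigenvalue Z.* eigenvector i
    eigenvector-equation = eigen a-k a-inverse ψψ≈0 nilpotent

    𝔠-eigenvector : ∀ i → i ≢ k → scalarPart (eigenvector i) R.≈ R.0#
    𝔠-eigenvector i i≢k = R.trans (𝔠.+-homo (δₖ i) (scalar (R.- r i) Z.* walks m i))
      (R.trans (R.+-cong (𝔠-cong (δₖ i) Z.0# (δₖ-no i≢k)) (R.trans (𝔠.*-homo (scalar (R.- r i)) (walks m i))
        (R.trans (R.*-congˡ (𝔠-walks m i)) (R.zeroʳ _)))) (R.+-identityˡ R.0#))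

    -- `f` stands for complex conjugation. Walk sums have scalar part zero, so only component `k`
    -- contributes to the norm, with scalar part 1.
    eigenvector-norm : ∀ {f : R.Carrier → R.Carrier} → (∀ {a b} → a R.≈ b → f a R.≈ f b) →
      (∀ a b → f (a R.+ b) R.≈ f a R.+ f b) → f R.0# R.≈ R.0# → f R.1# R.≈ R.1# →
      scalarPart (FiniteSums.sum commutativeRing λ i → mapCoefficients f (eigenvector i) Z.* eigenvector i)
        R.≈ R.1#
    eigenvector-norm {f} f-cong f-+ f-0 f-1 = begin
      scalarPart (FiniteSums.sum commutativeRing λ i → mapCoefficients f (eigenvector i) Z.* eigenvector i)
        ≈⟨ DeterminantHomo.sum-homo R scalarPart-homo m
             (λ i → mapCoefficients f (eigenvector i) Z.* eigenvector i) ⟩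
      sum (λ i → scalarPart (mapCoefficients f (eigenvector i) Z.* eigenvector i))
        ≈⟨ sum-cong m (λ i → 𝔠.*-homo (mapCoefficients f (eigenvector i)) (eigenvector i)) ⟩
      sum (λ i → scalarPart (mapCoefficients f (eigenvector i)) R.* scalarPart (eigenvector i))
        ≈⟨ sum-single k (λ i i≢k → R.trans (R.*-congˡ (𝔠-eigenvector i i≢k)) (R.zeroʳ _)) ⟩
      scalarPart (mapCoefficients f (eigenvector k)) R.* scalarPart (eigenvector k)
        ≈⟨ R.*-cong (R.trans (coefficient-map (eigenvector k) []) (R.trans (f-cong 𝔠≈1) f-1)) 𝔠≈1 ⟩
      R.1# R.* R.1#
        ≈⟨ R.*-identityˡ R.1# ⟩
      R.1# ∎
      where
      open FiniteSums R
      open Relation.Binary.Reasoning.Setoid R.setoid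
      𝔠≈1 : scalarPart (eigenvector k) R.≈ R.1#
      𝔠≈1 = R.trans (𝔠-cong (eigenvector k) Z.1# eigenvector-k≈1) 𝔠.1#-homo
      coefficient-map : ∀ u I → coefficient (mapCoefficients f u) I R.≈ f (coefficient u I)
      coefficient-map []            I = R.sym f-0
      coefficient-map ((a , J) ∷ u) I with does (J ≐? I)
      ... | true  = R.trans (R.+-congˡ (coefficient-map u I)) (R.sym (f-+ _ _))
      ... | false = coefficient-map u I

    module _ (1≉0 : ¬ (R.1# R.≈ R.0#)) where

      -- ζ_{1}, which is killed by the scalar part, serves as the infinitesimal.
      private
        ε : Zeon
        ε = ζ [ 0 ]

        ε²≈0 : ε Z.* ε Z.≈ Z.0#
        ε²≈0 = term-*-null {R.1#} {R.1#} {[ 0 ]} {[ 0 ]} λ d → d (here ≡.refl , here ≡.refl)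

        ∂ : Zeon → R.Carrier
        ∂ u = coefficient u [ 0 ]

        ∂-cong : ∀ u v → u Z.≈ v → ∂ u R.≈ ∂ v
        ∂-cong u v u≈v = u≈v [ 0 ]

        ∂-+ : ∀ u v → ∂ (u ++ v) R.≈ ∂ u R.+ ∂ v
        ∂-+ u v = R.trans (coefficient≈⟪δ⟫ (u ++ v) [ 0 ]) (R.trans (⟪⟫-++ u v (δ [ 0 ]))
          (R.sym (R.+-cong (coefficient≈⟪δ⟫ u [ 0 ]) (coefficient≈⟪δ⟫ v [ 0 ]))))

        ∂∘scalar : ∀ a → ∂ (scalar a) R.≈ R.0#
        ∂∘scalar a = R.refl

        open SimpleRoots.Augmented R commutativeRing 1≉0 {scalarPart} scalarPart-homo 𝔠-cong
          {scalar} scalar-homo scalar-cong 𝔠∘scalar {ε} ε²≈0 R.refl {∂} ∂-cong ∂-+ ∂∘scalar (coefficient-ζ* 0)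
          using (simple-zero; scalar-simple-zero)

        separated : ∀ i → i ≢ k → ∃[ b ] ((x k R.- x i) R.* b R.≈ R.1#)
        separated i i≢k = r i , r-inverse i i≢k

        root : Polynomials.eval Z.rawRing (charPoly Z.rawRing Λ) eigenvalue Z.≈ Z.0#
        root = CharacteristicRoots.eigenvalue-root commutativeRing Λ eigenvalue eigenvector k
          eigenvector-k≈1 eigenvector-equation

      eigenvalue-simple : Polynomials.IsSimpleZero Z.rawRing (charPoly Z.rawRing Λ) eigenvalue
      eigenvalue-simple = simple-zero Λ x k 𝔠Λ separated {eigenvalue} 𝔠-eigenvalue root

      scalarPart-simple : Polynomials.IsSimpleZero R.rawRing
        (map scalarPart (charPoly Z.rawRing Λ)) (scalarPart eigenvalue)
      scalarPart-simple = scalar-simple-zero Λ x k 𝔠Λ separated {eigenvalue} 𝔠-eigenvalue root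

-- The complex numbers

import Algebra.Consequences.Setoid
open import Data.Nat.Base using (_<_)
open import Data.Integer.Base as ℤ using (ℤ; +_; -[1+_]; +[1+_]; -1ℤ; _*_; _^_; _-_)
import Data.Integer.Properties as ℤ
import Data.Integer.Solver
open import Data.Rational.Base as ℚ using (ℚ; 0ℚ; 1ℚ; ½; _/_)
import Data.Rational.Properties as ℚ
open import Data.Rational.Solver using (module +-*-Solver)
import Data.Rational.Unnormalised.Base as ℚᵘ
import Data.Rational.Unnormalised.Properties as ℚᵘ
open import Data.Product.Base using (Σ-syntax)
open import Relation.Binary.Bundles using (Setoid)
open import Relation.Binary.Structures using (IsEquivalence)
open import Defs

-- Operations act termwise on sequences, so ring laws of the reals reduce to identities in ℚ; only
-- the congruence and transitivity proofs need estimates.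
pointwise : ∀ {x y} → (∀ n → seq x n ≡ seq y n) → x ≈ᴿ y
pointwise {x} {y} eq ε 0<ε = 0 , λ n _ → ≡.subst (ℚ._< ε)
  (≡.sym (≡.trans (≡.cong (λ q → ℚ.∣ q ℚ.- seq y n ∣) (eq n)) (≡.cong ℚ.∣_∣ (ℚ.+-inverseʳ (seq y n))))) 0<ε

≈ᴿ-refl : ∀ {x} → x ≈ᴿ x
≈ᴿ-refl {x} = pointwise {x} {x} λ _ → ≡.refl

∣p-q∣≡∣q-p∣ : ∀ p q → ℚ.∣ p ℚ.- q ∣ ≡ ℚ.∣ q ℚ.- p ∣
∣p-q∣≡∣q-p∣ p q = ≡.trans (≡.sym (ℚ.∣-p∣≡∣p∣ (p ℚ.- q)))
  (≡.cong ℚ.∣_∣ (solve 2 (λ p q → :- (p :- q) := q :- p) ≡.refl p q))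
  where open +-*-Solver

≈ᴿ-sym : ∀ {x y} → x ≈ᴿ y → y ≈ᴿ x
≈ᴿ-sym {x} {y} x≈y ε 0<ε with N , p ← x≈y ε 0<ε =
  N , λ n N≤n → ≡.subst (ℚ._< ε) (∣p-q∣≡∣q-p∣ (seq x n) (seq y n)) (p n N≤n)

halves : ∀ {ε} p q {r} → r ≡ p ℚ.+ q → ℚ.∣ p ∣ ℚ.< ε ℚ.* ½ → ℚ.∣ q ∣ ℚ.< ε ℚ.* ½ → ℚ.∣ r ∣ ℚ.< ε
halves {ε} p q ≡.refl p< q< = begin-strict
  ℚ.∣ p ℚ.+ q ∣           ≤⟨ ℚ.∣p+q∣≤∣p∣+∣q∣ p q ⟩
  ℚ.∣ p ∣ ℚ.+ ℚ.∣ q ∣     <⟨ ℚ.+-mono-< p< q< ⟩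
  ε ℚ.* ½ ℚ.+ ε ℚ.* ½     ≡⟨ half+half ε ⟩
  ε                       ∎
  where open ℚ.≤-Reasoning

≈ᴿ-trans : ∀ {x y z} → x ≈ᴿ y → y ≈ᴿ z → x ≈ᴿ z
≈ᴿ-trans {x} {y} {z} x≈y y≈z ε 0<ε
  with M , p ← x≈y (ε ℚ.* ½) (half-pos 0<ε) | N , q ← y≈z (ε ℚ.* ½) (half-pos 0<ε) =
  M ℕ.⊔ N , λ n ≤n → halves _ _ (split (seq x n) (seq y n) (seq z n))
    (p n (ℕ.m⊔n≤o⇒m≤o M N ≤n)) (q n (ℕ.m⊔n≤o⇒n≤o M N ≤n))
  where
  split : ∀ a b c → a ℚ.- c ≡ (a ℚ.- b) ℚ.+ (b ℚ.- c)
  split = solve 3 (λ a b c → a :- c := (a :- b) :+ (b :- c)) ≡.refl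
    where open +-*-Solver

+ᴿ-cong : ∀ {x x′ y y′} → x ≈ᴿ x′ → y ≈ᴿ y′ → x +ᴿ y ≈ᴿ x′ +ᴿ y′
+ᴿ-cong {x} {x′} {y} {y′} x≈x′ y≈y′ ε 0<ε
  with M , p ← x≈x′ (ε ℚ.* ½) (half-pos 0<ε) | N , q ← y≈y′ (ε ℚ.* ½) (half-pos 0<ε) =
  M ℕ.⊔ N , λ n ≤n → halves _ _ (regroup (seq x n) (seq x′ n) (seq y n) (seq y′ n))
    (p n (ℕ.m⊔n≤o⇒m≤o M N ≤n)) (q n (ℕ.m⊔n≤o⇒n≤o M N ≤n))
  where
  regroup : ∀ a b c d → (a ℚ.+ c) ℚ.- (b ℚ.+ d) ≡ (a ℚ.- b) ℚ.+ (c ℚ.- d)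
  regroup = solve 4 (λ a b c d → (a :+ c) :- (b :+ d) := (a :- b) :+ (c :- d)) ≡.refl
    where open +-*-Solver

-ᴿ-cong : ∀ {x y} → x ≈ᴿ y → -ᴿ x ≈ᴿ -ᴿ y
-ᴿ-cong {x} {y} x≈y ε 0<ε with N , p ← x≈y ε 0<ε = N , λ n N≤n →
  ≡.subst (ℚ._< ε)
    (≡.trans (∣p-q∣≡∣q-p∣ (seq x n) (seq y n)) (≡.cong ℚ.∣_∣ (flip (seq y n) (seq x n)))) (p n N≤n)
  where
  flip : ∀ a b → a ℚ.- b ≡ (ℚ.- b) ℚ.- (ℚ.- a)
  flip = solve 2 (λ a b → a :- b := (:- b) :- (:- a)) ≡.refl
    where open +-*-Solver

-- The sequence of `x` is eventually bounded, so a tolerance scaled down by the bound suffices for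
-- `y` and `y′`.
*ᴿ-congʳ : ∀ {x y y′} → y ≈ᴿ y′ → x *ᴿ y ≈ᴿ x *ᴿ y′
*ᴿ-congʳ {x} {y} {y′} y≈y′ ε 0<ε
  with B , 0<B , M , x<B ← bound {seq x} (cauchy x)
  with δ , 0<δ , small ← scaled 0<B 0<ε
  with N , close ← y≈y′ δ 0<δ =
  M ℕ.⊔ N , λ n ≤n → ≡.subst (ℚ._< ε) (≡.cong ℚ.∣_∣ (regroup (seq x n) (seq y n) (seq y′ n)))
    (small _ _ (x<B n (ℕ.m⊔n≤o⇒m≤o M N ≤n)) (close n (ℕ.m⊔n≤o⇒n≤o M N ≤n)))
  where
  regroup : ∀ a b c → a ℚ.* (b ℚ.- c) ≡ a ℚ.* b ℚ.- a ℚ.* c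
  regroup = solve 3 (λ a b c → a :* (b :- c) := a :* b :- a :* c) ≡.refl
    where open +-*-Solver

*ᴿ-comm : ∀ x y → x *ᴿ y ≈ᴿ y *ᴿ x
*ᴿ-comm x y = pointwise {x *ᴿ y} {y *ᴿ x} λ n → ℚ.*-comm (seq x n) (seq y n)

*ᴿ-cong : ∀ {x x′ y y′} → x ≈ᴿ x′ → y ≈ᴿ y′ → x *ᴿ y ≈ᴿ x′ *ᴿ y′
*ᴿ-cong {x} {x′} {y} {y′} x≈x′ y≈y′ = ≈ᴿ-trans {x *ᴿ y} {x *ᴿ y′} {x′ *ᴿ y′} (*ᴿ-congʳ {x} {y} {y′} y≈y′)
  (≈ᴿ-trans {x *ᴿ y′} {y′ *ᴿ x} {x′ *ᴿ y′} (*ᴿ-comm x y′)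
    (≈ᴿ-trans {y′ *ᴿ x} {y′ *ᴿ x′} {x′ *ᴿ y′} (*ᴿ-congʳ {y′} {x} {x′} x≈x′) (*ᴿ-comm y′ x′)))

open RawRing ℂ-rawRing using ()
  renaming (_≈_ to _≈ᶜ_; _+_ to _+ᶜ_; _*_ to _*ᶜ_; -_ to -ᶜ_; 0# to 0ᶜ; 1# to 1ᶜ)

pointwiseᶜ : ∀ {z w} → (∀ n → seq (re z) n ≡ seq (re w) n) → (∀ n → seq (im z) n ≡ seq (im w) n) → z ≈ᶜ w
pointwiseᶜ {z} {w} p q = pointwise {re z} {re w} p , pointwise {im z} {im w} q

ℂ-isEquivalence : IsEquivalence _≈ᶜ_
ℂ-isEquivalence = record
  { refl  = λ {z} → ≈ᴿ-refl {re z} , ≈ᴿ-refl {im z}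
  ; sym   = λ {z} {w} (p , q) → ≈ᴿ-sym {re z} {re w} p , ≈ᴿ-sym {im z} {im w} q
  ; trans = λ {z} {w} {v} (p , q) (p′ , q′) →
      ≈ᴿ-trans {re z} {re w} {re v} p p′ , ≈ᴿ-trans {im z} {im w} {im v} q q′
  }

+ᶜ-cong : ∀ {z z′ w w′} → z ≈ᶜ z′ → w ≈ᶜ w′ → z +ᶜ w ≈ᶜ z′ +ᶜ w′
+ᶜ-cong {z} {z′} {w} {w′} (p , q) (r , s) =
  +ᴿ-cong {re z} {re z′} {re w} {re w′} p r , +ᴿ-cong {im z} {im z′} {im w} {im w′} q s

*ᶜ-cong : ∀ {z z′ w w′} → z ≈ᶜ z′ → w ≈ᶜ w′ → z *ᶜ w ≈ᶜ z′ *ᶜ w′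
*ᶜ-cong {a +i b} {a′ +i b′} {c +i d} {c′ +i d′} (p , q) (r , s) =
  +ᴿ-cong {a *ᴿ c} {a′ *ᴿ c′} { -ᴿ (b *ᴿ d)} { -ᴿ (b′ *ᴿ d′)}
    (*ᴿ-cong {a} {a′} {c} {c′} p r) (-ᴿ-cong {b *ᴿ d} {b′ *ᴿ d′} (*ᴿ-cong {b} {b′} {d} {d′} q s)) ,
  +ᴿ-cong {a *ᴿ d} {a′ *ᴿ d′} {b *ᴿ c} {b′ *ᴿ c′}
    (*ᴿ-cong {a} {a′} {d} {d′} p s) (*ᴿ-cong {b} {b′} {c} {c′} q r)

-ᶜ-cong : ∀ {z w} → z ≈ᶜ w → -ᶜ z ≈ᶜ -ᶜ w
-ᶜ-cong {z} {w} (p , q) = -ᴿ-cong {re z} {re w} p , -ᴿ-cong {im z} {im w} q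

+ᶜ-comm : ∀ z w → z +ᶜ w ≈ᶜ w +ᶜ z
+ᶜ-comm z w = pointwiseᶜ {z +ᶜ w} {w +ᶜ z}
  (λ n → ℚ.+-comm (seq (re z) n) (seq (re w) n)) (λ n → ℚ.+-comm (seq (im z) n) (seq (im w) n))

+ᶜ-identityˡ : ∀ z → 0ᶜ +ᶜ z ≈ᶜ z
+ᶜ-identityˡ z = pointwiseᶜ {0ᶜ +ᶜ z} {z}
  (λ n → ℚ.+-identityˡ (seq (re z) n)) (λ n → ℚ.+-identityˡ (seq (im z) n))

+ᶜ-inverseˡ : ∀ z → -ᶜ z +ᶜ z ≈ᶜ 0ᶜ
+ᶜ-inverseˡ z = pointwiseᶜ { -ᶜ z +ᶜ z} {0ᶜ}
  (λ n → ℚ.+-inverseˡ (seq (re z) n)) (λ n → ℚ.+-inverseˡ (seq (im z) n))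

*ᶜ-comm : ∀ z w → z *ᶜ w ≈ᶜ w *ᶜ z
*ᶜ-comm z@(a +i b) w@(c +i d) = pointwiseᶜ {z *ᶜ w} {w *ᶜ z}
  (λ n → real (seq a n) (seq b n) (seq c n) (seq d n))
  (λ n → imag (seq a n) (seq b n) (seq c n) (seq d n))
  where
  open +-*-Solver
  real : ∀ a b c d → a ℚ.* c ℚ.+ (ℚ.- (b ℚ.* d)) ≡ c ℚ.* a ℚ.+ (ℚ.- (d ℚ.* b))
  real = solve 4 (λ a b c d → a :* c :+ :- (b :* d) := c :* a :+ :- (d :* b)) ≡.refl
  imag : ∀ a b c d → a ℚ.* d ℚ.+ b ℚ.* c ≡ c ℚ.* b ℚ.+ d ℚ.* a
  imag = solve 4 (λ a b c d → a :* d :+ b :* c := c :* b :+ d :* a) ≡.refl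

*ᶜ-identityˡ : ∀ z → 1ᶜ *ᶜ z ≈ᶜ z
*ᶜ-identityˡ z@(a +i b) = pointwiseᶜ {1ᶜ *ᶜ z} {z}
  (λ n → real (seq a n) (seq b n)) (λ n → imag (seq a n) (seq b n))
  where
  open +-*-Solver
  real : ∀ a b → 1ℚ ℚ.* a ℚ.+ (ℚ.- (0ℚ ℚ.* b)) ≡ a
  real = solve 2 (λ a b → con 1ℚ :* a :+ :- (con 0ℚ :* b) := a) ≡.refl
  imag : ∀ a b → 1ℚ ℚ.* b ℚ.+ 0ℚ ℚ.* a ≡ b
  imag = solve 2 (λ a b → con 1ℚ :* b :+ con 0ℚ :* a := b) ≡.refl

*ᶜ-assoc : ∀ z w v → (z *ᶜ w) *ᶜ v ≈ᶜ z *ᶜ (w *ᶜ v)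
*ᶜ-assoc z@(a +i b) w@(c +i d) v@(e +i f) = pointwiseᶜ {(z *ᶜ w) *ᶜ v} {z *ᶜ (w *ᶜ v)}
  (λ n → real (seq a n) (seq b n) (seq c n) (seq d n) (seq e n) (seq f n))
  (λ n → imag (seq a n) (seq b n) (seq c n) (seq d n) (seq e n) (seq f n))
  where
  open +-*-Solver
  real : ∀ a b c d e f →
    (a ℚ.* c ℚ.+ (ℚ.- (b ℚ.* d))) ℚ.* e ℚ.+ (ℚ.- ((a ℚ.* d ℚ.+ b ℚ.* c) ℚ.* f))
    ≡ a ℚ.* (c ℚ.* e ℚ.+ (ℚ.- (d ℚ.* f))) ℚ.+ (ℚ.- (b ℚ.* (c ℚ.* f ℚ.+ d ℚ.* e)))
  real = solve 6 (λ a b c d e f → (a :* c :+ :- (b :* d)) :* e :+ :- ((a :* d :+ b :* c) :* f)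
    := a :* (c :* e :+ :- (d :* f)) :+ :- (b :* (c :* f :+ d :* e))) ≡.refl
  imag : ∀ a b c d e f →
    (a ℚ.* c ℚ.+ (ℚ.- (b ℚ.* d))) ℚ.* f ℚ.+ (a ℚ.* d ℚ.+ b ℚ.* c) ℚ.* e
    ≡ a ℚ.* (c ℚ.* f ℚ.+ d ℚ.* e) ℚ.+ b ℚ.* (c ℚ.* e ℚ.+ (ℚ.- (d ℚ.* f)))
  imag = solve 6 (λ a b c d e f → (a :* c :+ :- (b :* d)) :* f :+ (a :* d :+ b :* c) :* e
    := a :* (c :* f :+ d :* e) :+ b :* (c :* e :+ :- (d :* f))) ≡.refl

*ᶜ-distribˡ : ∀ z w v → z *ᶜ (w +ᶜ v) ≈ᶜ z *ᶜ w +ᶜ z *ᶜ v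
*ᶜ-distribˡ z@(a +i b) w@(c +i d) v@(e +i f) = pointwiseᶜ {z *ᶜ (w +ᶜ v)} {z *ᶜ w +ᶜ z *ᶜ v}
  (λ n → real (seq a n) (seq b n) (seq c n) (seq d n) (seq e n) (seq f n))
  (λ n → imag (seq a n) (seq b n) (seq c n) (seq d n) (seq e n) (seq f n))
  where
  open +-*-Solver
  real : ∀ a b c d e f → a ℚ.* (c ℚ.+ e) ℚ.+ (ℚ.- (b ℚ.* (d ℚ.+ f)))
    ≡ (a ℚ.* c ℚ.+ (ℚ.- (b ℚ.* d))) ℚ.+ (a ℚ.* e ℚ.+ (ℚ.- (b ℚ.* f)))
  real = solve 6 (λ a b c d e f → a :* (c :+ e) :+ :- (b :* (d :+ f))
    := (a :* c :+ :- (b :* d)) :+ (a :* e :+ :- (b :* f))) ≡.refl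
  imag : ∀ a b c d e f → a ℚ.* (d ℚ.+ f) ℚ.+ b ℚ.* (c ℚ.+ e)
    ≡ (a ℚ.* d ℚ.+ b ℚ.* c) ℚ.+ (a ℚ.* f ℚ.+ b ℚ.* e)
  imag = solve 6 (λ a b c d e f → a :* (d :+ f) :+ b :* (c :+ e)
    := (a :* d :+ b :* c) :+ (a :* f :+ b :* e)) ≡.refl

ℂ-commutativeRing : CommutativeRing 0ℓ 0ℓ
ℂ-commutativeRing = record
  { Carrier = ℂ
  ; _≈_ = _≈ᶜ_
  ; _+_ = _+ᶜ_
  ; _*_ = _*ᶜ_
  ; -_  = -ᶜ_
  ; 0#  = 0ᶜ
  ; 1#  = 1ᶜ
  ; isCommutativeRing = record
    { isRing = record
      { +-isAbelianGroup = record
        { isGroup = record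
          { isMonoid = record
            { isSemigroup = record
              { isMagma = record
                { isEquivalence = ℂ-isEquivalence
                ; ∙-cong = λ {z} {z′} {w} {w′} → +ᶜ-cong {z} {z′} {w} {w′}
                }
              ; assoc = λ z w v → pointwiseᶜ {(z +ᶜ w) +ᶜ v} {z +ᶜ (w +ᶜ v)}
                  (λ n → ℚ.+-assoc (seq (re z) n) (seq (re w) n) (seq (re v) n))
                  (λ n → ℚ.+-assoc (seq (im z) n) (seq (im w) n) (seq (im v) n))
              }
            ; identity = comm∧idˡ⇒id {_+ᶜ_} +ᶜ-comm {0ᶜ} +ᶜ-identityˡ
            }
          ; inverse = comm∧invˡ⇒inv {_+ᶜ_} { -ᶜ_} {0ᶜ} +ᶜ-comm +ᶜ-inverseˡ
          ; ⁻¹-cong = λ {z} {w} → -ᶜ-cong {z} {w}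
          }
        ; comm = +ᶜ-comm
        }
      ; *-cong = λ {z} {z′} {w} {w′} → *ᶜ-cong {z} {z′} {w} {w′}
      ; *-assoc = *ᶜ-assoc
      ; *-identity = comm∧idˡ⇒id {_*ᶜ_} *ᶜ-comm {1ᶜ} *ᶜ-identityˡ
      ; distrib = comm∧distrˡ⇒distr {_*ᶜ_} {_+ᶜ_}
          (λ {z} {z′} {w} {w′} → +ᶜ-cong {z} {z′} {w} {w′}) *ᶜ-comm *ᶜ-distribˡ
      }
    ; *-comm = *ᶜ-comm
    }
  }
  where
  ℂ-setoid : Setoid 0ℓ 0ℓ
  ℂ-setoid = record { isEquivalence = ℂ-isEquivalence }
  open Algebra.Consequences.Setoid ℂ-setoid

1ᶜ≉0ᶜ : ¬ (1ᶜ ≈ᶜ 0ᶜ)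
1ᶜ≉0ᶜ (1≈0 , _) with N , p ← 1≈0 1ℚ (ℚ.positive⁻¹ 1ℚ) = ℚ.<-irrefl ≡.refl (p N ℕ.≤-refl)

-- Integers and rationals inside the complex numbers.

module IntegerImages (R : CommutativeRing 0ℓ 0ℓ) {f : ℤ → CommutativeRing.Carrier R}
  (homo : PreservesOperations ℤ.+-*-rawRing R f) where
  open CommutativeRing R renaming (_*_ to _⋆_; _-_ to _−_)
  open PreservesOperations homo
  open Algebra.Definitions.RawSemiring (RawRing.rawSemiring rawRing) using () renaming (_^_ to _^ᴿ_; _×_ to _×ᴿ_)

  image-ℕ : ∀ n → f (+ n) ≈ n ×ᴿ 1#
  image-ℕ zero    = 0#-homo
  image-ℕ (suc n) = trans (+-homo (+ 1) (+ n)) (+-cong 1#-homo (image-ℕ n))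

  image-sign : ∀ n → f (-1ℤ ^ n) ≈ (- 1#) ^ᴿ n
  image-sign zero    = 1#-homo
  image-sign (suc n) = trans (*-homo -1ℤ (-1ℤ ^ n))
    (*-cong (trans (-‿homo (+ 1)) (-‿cong 1#-homo)) (image-sign n))

  image-signed : ∀ n c → (- 1#) ^ᴿ n ⋆ (c ×ᴿ 1#) ≈ f (-1ℤ ^ n * + c)
  image-signed n c = sym (trans (*-homo (-1ℤ ^ n) (+ c)) (*-cong (image-sign n) (image-ℕ c)))

  difference-inverse : ∀ i j {r} → f (i - j) ⋆ r ≈ 1# → (f i − f j) ⋆ r ≈ 1#
  difference-inverse i j inv = trans (*-congʳ (sym (trans (+-homo i (ℤ.- j)) (+-congˡ (-‿homo j))))) inv

-1^n*-1^n≡1 : ∀ n → -1ℤ ^ n * -1ℤ ^ n ≡ + 1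
-1^n*-1^n≡1 zero    = ≡.refl
-1^n*-1^n≡1 (suc n) = ≡.trans (interchange -1ℤ (-1ℤ ^ n)) (≡.cong (+ 1 *_) (-1^n*-1^n≡1 n))
  where
  interchange : ∀ a b → (a * b) * (a * b) ≡ (a * a) * (b * b)
  interchange = solve 2 (λ a b → (a :* b) :* (a :* b) := (a :* a) :* (b :* b)) ≡.refl
    where open Data.Integer.Solver.+-*-Solver

sign-cancel : ∀ n c → -1ℤ ^ n * (-1ℤ ^ n * c) ≡ c
sign-cancel n c = ≡.trans (≡.sym (ℤ.*-assoc (-1ℤ ^ n) (-1ℤ ^ n) c))
  (≡.trans (≡.cong (_* c) (-1^n*-1^n≡1 n)) (ℤ.*-identityˡ c))

-- Rationals are kept in lowest terms, so `i / 1` does not compute for a variable `i`. In the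
-- unnormalised rationals, identities become integer equations by cross-multiplication.
toℚᵘ-/1 : ∀ i → ℚ.toℚᵘ (i / 1) ℚᵘ.≃ ℚᵘ.mkℚᵘ i 0
toℚᵘ-/1 i = ℚ.toℚᵘ-fromℚᵘ (ℚᵘ.mkℚᵘ i 0)

/1-homo : PreservesOperations ℤ.+-*-rawRing ℚ.+-*-commutativeRing (_/ 1)
/1-homo = record
  { +-homo  = λ i j → ℚ.toℚᵘ-injective (ℚᵘ.≃-trans (toℚᵘ-/1 (i ℤ.+ j)) (ℚᵘ.≃-trans (ℚᵘ.*≡* (add i j))
      (ℚᵘ.≃-sym (ℚᵘ.≃-trans (ℚ.toℚᵘ-homo-+ (i / 1) (j / 1)) (ℚᵘ.+-cong (toℚᵘ-/1 i) (toℚᵘ-/1 j))))))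
  ; *-homo  = λ i j → ℚ.toℚᵘ-injective (ℚᵘ.≃-trans (toℚᵘ-/1 (i * j))
      (ℚᵘ.≃-sym (ℚᵘ.≃-trans (ℚ.toℚᵘ-homo-* (i / 1) (j / 1)) (ℚᵘ.*-cong (toℚᵘ-/1 i) (toℚᵘ-/1 j)))))
  ; -‿homo  = λ i → ℚ.toℚᵘ-injective (ℚᵘ.≃-trans (toℚᵘ-/1 (ℤ.- i))
      (ℚᵘ.≃-sym (ℚᵘ.≃-trans (ℚ.toℚᵘ-homo‿- (i / 1)) (ℚᵘ.-‿cong (toℚᵘ-/1 i)))))
  ; 0#-homo = ≡.refl
  ; 1#-homo = ≡.refl
  }
  where
  add : ∀ i j → (i ℤ.+ j) * + 1 ≡ (i * + 1 ℤ.+ j * + 1) * + 1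
  add i j = ≡.cong (_* + 1) (≡.sym (≡.cong₂ ℤ._+_ (ℤ.*-identityʳ i) (ℤ.*-identityʳ j)))

fromℚ-homo : PreservesOperations (CommutativeRing.rawRing ℚ.+-*-commutativeRing) ℂ-commutativeRing fromℚ
fromℚ-homo = record
  { +-homo  = λ p q → pointwiseᶜ {fromℚ (p ℚ.+ q)} {fromℚ p +ᶜ fromℚ q} (λ _ → ≡.refl) (λ _ → ≡.refl)
  ; *-homo  = λ p q → pointwiseᶜ {fromℚ (p ℚ.* q)} {fromℚ p *ᶜ fromℚ q} (λ _ → real p q) (λ _ → imag p q)
  ; -‿homo  = λ p → pointwiseᶜ {fromℚ (ℚ.- p)} { -ᶜ fromℚ p} (λ _ → ≡.refl) (λ _ → ≡.refl)
  ; 0#-homo = pointwiseᶜ {fromℚ 0ℚ} {fromℚ 0ℚ} (λ _ → ≡.refl) (λ _ → ≡.refl)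
  ; 1#-homo = pointwiseᶜ {fromℚ 1ℚ} {fromℚ 1ℚ} (λ _ → ≡.refl) (λ _ → ≡.refl)
  }
  where
  open +-*-Solver
  real : ∀ p q → p ℚ.* q ≡ p ℚ.* q ℚ.+ (ℚ.- (0ℚ ℚ.* 0ℚ))
  real = solve 2 (λ p q → p :* q := p :* q :+ :- (con 0ℚ :* con 0ℚ)) ≡.refl
  imag : ∀ p q → 0ℚ ≡ p ℚ.* 0ℚ ℚ.+ 0ℚ ℚ.* q
  imag = solve 2 (λ p q → con 0ℚ := p :* con 0ℚ :+ con 0ℚ :* q) ≡.refl

fromℤ-homo : PreservesOperations ℤ.+-*-rawRing ℂ-commutativeRing (λ i → fromℚ (i / 1))
fromℤ-homo = ∘-homo {S = ℚ.+-*-commutativeRing} {T = ℂ-commutativeRing} {f = _/ 1} {g = fromℚ}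
  (λ { {p} ≡.refl → CommutativeRing.refl ℂ-commutativeRing {fromℚ p} }) fromℚ-homo /1-homo

fromℚ-inverse : ∀ p q → p ℚ.* q ≡ 1ℚ → fromℚ p *ᶜ fromℚ q ≈ᶜ 1ᶜ
fromℚ-inverse p q eq = CommutativeRing.trans ℂ-commutativeRing {fromℚ p *ᶜ fromℚ q} {fromℚ (p ℚ.* q)} {1ᶜ}
  (CommutativeRing.sym ℂ-commutativeRing {fromℚ (p ℚ.* q)} {fromℚ p *ᶜ fromℚ q}
    (PreservesOperations.*-homo fromℚ-homo p q))
  (CommutativeRing.reflexive ℂ-commutativeRing (≡.cong fromℚ eq))

-- Treats both signs at once: `j` will be the sign of `i`, so that `i * j` is the absolute value.
/-inverse : ∀ i j n → i * j ≡ +[1+ n ] → (i / 1) ℚ.* (j / suc n) ≡ 1ℚ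
/-inverse i j n eq = ℚ.toℚᵘ-injective (ℚᵘ.≃-trans (ℚ.toℚᵘ-homo-* (i / 1) (j / suc n))
  (ℚᵘ.≃-trans (ℚᵘ.*-cong (toℚᵘ-/1 i) (ℚ.toℚᵘ-fromℚᵘ (ℚᵘ.mkℚᵘ j n)))
    (ℚᵘ.*≡* (≡.trans (ℤ.*-identityʳ (i * j)) (≡.trans eq
      (≡.sym (≡.trans (ℤ.*-identityˡ _) (≡.cong +[1+_] (ℕ.+-identityʳ n)))))))))

reciprocal-inverse : ∀ i → i ≢ + 0 → fromℚ (i / 1) *ᶜ reciprocal i ≈ᶜ 1ᶜ
reciprocal-inverse (+ zero) i≢0 = contradiction ≡.refl i≢0
reciprocal-inverse +[1+ n ] _   = fromℚ-inverse (+[1+ n ] / 1) (ℤ.1ℤ / suc n)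
  (/-inverse +[1+ n ] ℤ.1ℤ n (ℤ.*-identityʳ _))
reciprocal-inverse -[1+ n ] _   = fromℚ-inverse (-[1+ n ] / 1) (ℤ.-1ℤ / suc n)
  (/-inverse -[1+ n ] ℤ.-1ℤ n (≡.trans (ℤ.*-comm -[1+ n ] -1ℤ) (ℤ.-1*i≡-i -[1+ n ])))

open RawRing ℂℨ using (_≈_) renaming (_+_ to _⊕_; _*_ to _⊗_)

theorem3p7 : ∀ {m : ℕ} (G : SimpleGraph m) (d : ℕ) → 0 < d →
    ∀ (k : Fin m) → deg G k ≡ d → (∀ j → deg G j ≡ d → j ≡ k) →
    Σ[ λ′ ∈ Zeon ] Σ[ ω ∈ (Subset m → ℤ) ]
    ( IsSpectrallySimpleEigenvalue (Λ G) λ′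
    × (∀ (I : Subset m) → ∃[ n ] (NumberOf (IsCycleOn G k I) n × -1ℤ ^ ∣ I ∣ * ω I ≡ + n))
    × λ′ ≈ scalar (fromℕ d)
    ⊕ ∑⊆ m (λ I → scalar (fromℚ (ω I / 1)) ⊗ ζ[ I ]
    ⊗ scalar (∏∈ (I ∖ k) (λ j → reciprocal (+ d - + deg G j)))) )
theorem3p7 {m} G d _ k ≡.refl unique = L.eigenvalue , ω , record
  { isEigenvalue     = L.eigenvector , nonNull , L.eigenvector-equation r-k r-inverse
  ; simpleZero       = L.eigenvalue-simple r-k r-inverse 1ᶜ≉0ᶜ
  ; scalarSimpleZero = L.scalarPart-simple r-k r-inverse 1ᶜ≉0ᶜ
  } , (λ I → count I , Cycles.numberOf-cycles G k I , sign-cancel ∣ I ∣ (+ count I)) ,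
  L.eigenvalue≈cycles (λ I → fromℚ (ω I / 1)) (λ I → F.image-signed ∣ I ∣ (count I))
  where
  module F = IntegerImages ℂ-commutativeRing {λ i → fromℚ (i / 1)} fromℤ-homo
  module C = CommutativeRing ℂ-commutativeRing
  count : Subset m → ℕ
  count I = length (Cycles.interiorsOn G k I)
  ω : Subset m → ℤ
  -- The sign is its own inverse, so multiplying by it once more recovers the count.
  ω I = -1ℤ ^ ∣ I ∣ * + count I
  x r : Fin m → ℂ
  x j = fromℕ (deg G j)
  r j = reciprocal (+ d - + deg G j)
  module L = ZeonLaplacian ℂ-commutativeRing G k x r
  r-k : r k C.≈ C.0#
  -- The default `reciprocal (+ 0)` = 0 supplies the weight zero at `k`, which suppresses walks that
  -- return to `k` before their end.
  r-k = C.reflexive (≡.cong reciprocal (ℤ.+-inverseʳ (+ d)))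
  r-inverse : ∀ i → i ≢ k → (x k C.- x i) C.* r i C.≈ C.1#
  r-inverse i i≢k = F.difference-inverse (+ d) (+ deg G i) {r i} (reciprocal-inverse (+ d - + deg G i) λ eq →
    -- A vanishing difference would make `i` a second vertex of degree `d`.
    i≢k (unique i (≡.sym (ℤ.+-injective (ℤ.i-j≡0⇒i≡j (+ d) (+ deg G i) eq)))))
  nonNull : NonNull L.eigenvector
  nonNull ≈0 = 1ᶜ≉0ᶜ (C.trans {C.1#} {norm} {C.0#} (C.sym {norm} {C.1#}
    (L.eigenvector-norm r-k r-inverse {conjugate}
      (λ {a} {b} (p , q) → p , -ᴿ-cong {im a} {im b} q)
      (λ a b → pointwiseᶜ {conjugate (a C.+ b)} {conjugate a C.+ conjugate b}
        (λ _ → ≡.refl) (λ n → ℚ.neg-distrib-+ (seq (im a) n) (seq (im b) n)))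
      (pointwiseᶜ {conjugate C.0#} {C.0#} (λ _ → ≡.refl) (λ _ → ≡.refl))
      (pointwiseᶜ {conjugate C.1#} {C.1#} (λ _ → ≡.refl) (λ _ → ≡.refl)))) ≈0)
    where
    norm : ℂ
    norm = scalarPart (FiniteSums.sum (ZeonRing.commutativeRing ℂ-commutativeRing) λ i →
      mapCoefficients conjugate (L.eigenvector i) ⊗ L.eigenvector i)
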